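{- Fix $n\in\mathbb Z_{\ge2}$ and $k\in\mathbb Z_{\ge1}$, and let $\searrow_n=n(n-1)\cdots1$. Let $\Pi:\mathbb R^{\mathcal C_{n-1}(k)}\to\mathbb R^{\mathrm{Av}_k(\searrow_n)}$ be the linear map sending the basis vector indexed by $(\pi,\mathfrak c)\in\mathcal C_{n-1}(k)$ to the basis vector indexed by $\pi$ (the map forgetting colourings). Then $$P^{\mathrm{Av}(\searrow_n)}_k=\Pi\big(P(\mathcal{O}v_c(k,\searrow_n))\big),$$ where $\mathbb R^{\mathrm{Av}_k(\searrow_n)}$ is identified with the subspace of $\mathbb R^{\mathcal S_k}$ of vectors vanishing outside $\mathrm{Av}_k(\searrow_n)$.
   Context: For $I=\{i_1<\dots<i_m\}$, $\mathrm{pat}_I(\sigma)$ is the unique permutation of $[m]$ with entries in the same relative order as $\sigma(i_1),\dots,\sigma(i_m)$. $\sigma$ avoids $\pi$ if no $I$ has $\mathrm{pat}_I(\sigma)=\pi$; $\mathrm{Av}_m(\searrow_n)$ is the set of size-$m$ permutations avoiding $\searrow_n$ (with $\mathrm{Av}_0$ consisting of the empty permutation), $\mathrm{Av}(\searrow_n)=\bigcup_{m\ge1}\mathrm{Av}_m(\searrow_n)$. $\widetilde{\mathrm{c\text{ - }occ}}(\pi,\sigma)$ for $\pi\in\mathcal S_k,\sigma\in\mathcal S_m$ is $1/m$ times the number of intervals $I=\{i,\dots,i+k-1\}$ with $\mathrm{pat}_I(\sigma)=\pi$. $P^{\mathrm{Av}(B)}_k$ is the set of $\vec v\in[0,1]^{\mathcal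 S_k}$ for which there is a sequence $(\sigma^m)$ in $\mathrm{Av}(B)$ with $|\sigma^m|\to\infty$ and $\widetilde{\mathrm{c\text{ - }occ}}(\pi,\sigma^m)\to\vec v_\pi$ for all $\pi\in\mathcal S_k$. Colourings: a colouring of $\sigma\in\mathcal S_m$ is a map $\mathfrak c:[m]\to\mathbb Z_{\ge1}$ on indices; the pair $(\sigma,\mathfrak c)$ is a coloured permutation. Restriction: for $I=\{i_1<\dots<i_j\}$, $\mathrm{pat}_I(\sigma,\mathfrak c)=(\mathrm{pat}_I(\sigma),\mathfrak c')$ with $\mathfrak c'(\ell)=\mathfrak c(i_\ell)$; $\mathrm{be}_j(\cdot)=\mathrm{pat}_{\{1,\dots,j\}}(\cdot)$ and $\mathrm{en}_j(\cdot)=\mathrm{pat}_{\{m-j+1,\dots,m\}}(\cdot)$. The RITMO colouring $\mathbb C(\sigma)$ is defined by processing indices in decreasing order of value, giving each index $i$ the smallest positive integer $c$ such that no already coloured index $j<i$ (necessarily with $\sigma(j)>\sigma(i)$) has colour $c$; equivalently, colour 1 is given to the left-to-right maxima, colour 2 to the left-to-right maxima of the remaining entries, etc. Write $\mathbb S(\sigma)=(\sigma,\mathbb C(\sigma))$. For $\sigma\in\mathrm{Av}(\searrow_n)$, $\mathbb C(\sigma)$ takes values in $[n-1]$. A coloured permutation $(\pi,\mathfrak c)$ with $\pi\in\mathrm{Av}_k(\searrow_n)$ is an inherited colouring if there is $\sigma\in\mathrm{Av}(\searrow_n)$ with $|\sigma|\ge k$ and $\mathrm{en}_k(\mathbb S(\sigma))=(\pi,\mathfrak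 c)$. $\mathcal C_{n-1}(k)$ is the set of inherited colourings $(\pi,\mathfrak c)$ with $\pi\in\mathrm{Av}_k(\searrow_n)$ (their colours lie in $[n-1]$). Coloured overlap graph $\mathcal{O}v_c(k,\searrow_n)$: vertex set $\mathcal C_{n-1}(k-1)$, edge set $\mathcal C_{n-1}(k)$, the edge $(\pi,\mathfrak c)$ going from $\mathrm{be}_{k-1}(\pi,\mathfrak c)$ to $\mathrm{en}_{k-1}(\pi,\mathfrak c)$. A simple cycle is a closed walk with distinct edges and distinct vertices; for a nonempty cycle $\mathcal C$, $\vec e_{\mathcal C}\in\mathbb R^E$ has $e$-coordinate (number of occurrences of $e$ in $\mathcal C$)$/|\mathcal C|$; the cycle polytope $P(G)$ is the convex hull of $\vec e_{\mathcal C}$ over simple cycles. -}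

module Defs where

open import Data.Fin as Fin using (Fin; zero; suc; toℕ; fromℕ; fromℕ<; inject₁)
open import Data.Fin.Permutation as Perm
  using (Permutation′; _⟨$⟩ʳ_; _⟨$⟩ˡ_)
import Data.Fin.Properties as Fin
open import Data.Integer using (+_)
open import Data.List as List using (List; []; _∷_)
open import Data.Nat as ℕ using (ℕ; zero; suc; NonZero; _∸_)
import Data.Nat.Properties as ℕ
open import Data.Product using (Σ; Σ-syntax; ∃; ∃-syntax; _×_; _,_; proj₁; proj₂)
open import Data.Rational as ℚ using (ℚ; 0ℚ; 1ℚ; ½)
import Data.Rational.Properties as ℚ
import Data.Rational.Solver as ℚ
open import Data.Sum using (inj₁; inj₂)
open import Data.Vec.Functional as Vector using (Vector)
open import Function using (_∘_)
open import Function.Definitions using (Injective)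
open import Level using (0ℓ)
open import Relation.Binary using (DecSetoid; Setoid)
import Relation.Binary.Construct.On as On
open import Relation.Binary.PropositionalEquality
  using (_≡_; _≢_; refl; sym; trans; cong; subst; _≗_)
open import Relation.Nullary using (¬_; Dec; yes; no; does; ¬?; _×-dec_; _→-dec_)
open import Relation.Nullary.Decidable using (map′)
open import Data.Bool using (if_then_else_)

------------------------------------------------------------------------
-- Real numbers: Cauchy sequences of rationals, with the operations
-- defined termwise.

record ℝ : Set where
  constructor mkℝ
  field
    approx : ℕ → ℚ
    cauchy : ∀ ε → 0ℚ ℚ.< ε → ∃[ N ] ∀ m n → N ℕ.≤ m → N ℕ.≤ n →
             ℚ.∣ approx m ℚ.- approx n ∣ ℚ.≤ ε

open ℝ public

infix 4 _≈_ _≤_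
infixl 6 _+_
infixl 7 _*_

_≈_ : ℝ → ℝ → Set
x ≈ y = ∀ ε → 0ℚ ℚ.< ε → ∃[ N ] ∀ n → N ℕ.≤ n →
        ℚ.∣ approx x n ℚ.- approx y n ∣ ℚ.≤ ε

_≤_ : ℝ → ℝ → Set
x ≤ y = ∀ ε → 0ℚ ℚ.< ε → ∃[ N ] ∀ n → N ℕ.≤ n →
        approx x n ℚ.≤ approx y n ℚ.+ ε

fromℚ : ℚ → ℝ
fromℚ q = mkℝ (λ _ → q) λ ε 0<ε → 0 , λ _ _ _ _ →
  ℚ.≤-trans (ℚ.≤-reflexive (cong ℚ.∣_∣ (ℚ.+-inverseʳ q))) (ℚ.<⇒≤ 0<ε)

0ℝ 1ℝ : ℝ
0ℝ = fromℚ 0ℚ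
1ℝ = fromℚ 1ℚ

private
  2halves : ∀ ε → ½ ℚ.* ε ℚ.+ ½ ℚ.* ε ≡ ε
  2halves ε = trans (sym (ℚ.*-distribʳ-+ ε ½ ½)) (ℚ.*-identityˡ ε)

  half-pos : ∀ {ε} → 0ℚ ℚ.< ε → 0ℚ ℚ.< ½ ℚ.* ε
  half-pos 0<ε = ℚ.*-monoʳ-<-pos ½ 0<ε

  maxAbs : (ℕ → ℚ) → ℕ → ℚ
  maxAbs f zero    = 0ℚ
  maxAbs f (suc N) = ℚ.∣ f N ∣ ℚ.⊔ maxAbs f N

  maxAbs-bound : ∀ f {n N} → n ℕ.< N → ℚ.∣ f n ∣ ℚ.≤ maxAbs f N
  maxAbs-bound f {n} {suc N} (ℕ.s≤s n≤N) with ℕ.m≤n⇒m<n∨m≡n n≤N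
  ... | inj₁ n<N  = ℚ.≤-trans (maxAbs-bound f n<N) (ℚ.p≤q⊔p ℚ.∣ f N ∣ _)
  ... | inj₂ refl = ℚ.p≤p⊔q _ _

  0<1 : 0ℚ ℚ.< 1ℚ
  0<1 = ℚ.positive⁻¹ 1ℚ

  bounded : ∀ x → ∃[ B ] (0ℚ ℚ.< B) × (∀ n → ℚ.∣ approx x n ∣ ℚ.≤ B)
  bounded x = B , 0<B , bound
    where
    f = approx x
    N = proj₁ (cauchy x 1ℚ 0<1)
    M = maxAbs f (suc N)
    B = 1ℚ ℚ.+ M

    0≤M : 0ℚ ℚ.≤ M
    0≤M = ℚ.≤-trans (ℚ.0≤∣p∣ (f N)) (maxAbs-bound f (ℕ.n<1+n N))

    0<B : 0ℚ ℚ.< B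
    0<B = ℚ.<-≤-trans 0<1
      (ℚ.≤-trans (ℚ.≤-reflexive (sym (ℚ.+-identityʳ 1ℚ))) (ℚ.+-monoʳ-≤ 1ℚ 0≤M))

    split : ∀ a b → (a ℚ.- b) ℚ.+ b ≡ a
    split = ℚ.+-*-Solver.solve 2 (λ a b → (a :- b) :+ b := a) refl
      where open ℚ.+-*-Solver

    bound : ∀ n → ℚ.∣ f n ∣ ℚ.≤ B
    bound n with ℕ.≤-total N n
    ... | inj₁ N≤n = begin
      ℚ.∣ f n ∣                          ≡⟨ cong ℚ.∣_∣ (split (f n) (f N)) ⟨
      ℚ.∣ (f n ℚ.- f N) ℚ.+ f N ∣        ≤⟨ ℚ.∣p+q∣≤∣p∣+∣q∣ (f n ℚ.- f N) (f N) ⟩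
      ℚ.∣ f n ℚ.- f N ∣ ℚ.+ ℚ.∣ f N ∣
        ≤⟨ ℚ.+-mono-≤ (proj₂ (cauchy x 1ℚ 0<1) n N N≤n ℕ.≤-refl)
                      (maxAbs-bound f (ℕ.n<1+n N)) ⟩
      B                                  ∎
      where open ℚ.≤-Reasoning
    ... | inj₂ n≤N = begin
      ℚ.∣ f n ∣    ≤⟨ maxAbs-bound f (ℕ.s≤s n≤N) ⟩
      M            ≡⟨ ℚ.+-identityˡ M ⟨
      0ℚ ℚ.+ M     ≤⟨ ℚ.+-monoˡ-≤ M (ℚ.<⇒≤ 0<1) ⟩
      B            ∎
      where open ℚ.≤-Reasoning

_+_ : ℝ → ℝ → ℝ
x + y = mkℝ (λ n → approx x n ℚ.+ approx y n) λ ε 0<ε →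
  let N₁ , h₁ = cauchy x (½ ℚ.* ε) (half-pos 0<ε)
      N₂ , h₂ = cauchy y (½ ℚ.* ε) (half-pos 0<ε)
  in N₁ ℕ.⊔ N₂ , λ m n N≤m N≤n →
     let a = approx x m ; b = approx y m ; c = approx x n ; d = approx y n
     in begin
     ℚ.∣ (a ℚ.+ b) ℚ.- (c ℚ.+ d) ∣           ≡⟨ cong ℚ.∣_∣ (regroup a b c d) ⟩
     ℚ.∣ (a ℚ.- c) ℚ.+ (b ℚ.- d) ∣           ≤⟨ ℚ.∣p+q∣≤∣p∣+∣q∣ (a ℚ.- c) (b ℚ.- d) ⟩
     ℚ.∣ a ℚ.- c ∣ ℚ.+ ℚ.∣ b ℚ.- d ∣
       ≤⟨ ℚ.+-mono-≤
            (h₁ m n (ℕ.m⊔n≤o⇒m≤o N₁ N₂ N≤m) (ℕ.m⊔n≤o⇒m≤o N₁ N₂ N≤n))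
            (h₂ m n (ℕ.m⊔n≤o⇒n≤o N₁ N₂ N≤m) (ℕ.m⊔n≤o⇒n≤o N₁ N₂ N≤n)) ⟩
     ½ ℚ.* ε ℚ.+ ½ ℚ.* ε                     ≡⟨ 2halves ε ⟩
     ε                                       ∎
  where
  open ℚ.≤-Reasoning
  regroup : ∀ a b c d → (a ℚ.+ b) ℚ.- (c ℚ.+ d) ≡ (a ℚ.- c) ℚ.+ (b ℚ.- d)
  regroup = solve 4 (λ a b c d → (a :+ b) :- (c :+ d) := (a :- c) :+ (b :- d)) refl
    where open ℚ.+-*-Solver

_*_ : ℝ → ℝ → ℝ
x * y = mkℝ (λ n → approx x n ℚ.* approx y n) isCauchy
  where
  open ℚ.≤-Reasoning

  Bx = proj₁ (bounded x)
  By = proj₁ (bounded y)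
  S  = Bx ℚ.+ By

  instance
    S-pos : ℚ.Positive S
    S-pos = ℚ.positive (ℚ.+-mono-< (proj₁ (proj₂ (bounded x))) (proj₁ (proj₂ (bounded y))))
    S-nonZero : ℚ.NonZero S
    S-nonZero = ℚ.pos⇒nonZero S
    1/S-pos : ℚ.Positive (ℚ.1/ S)
    1/S-pos = ℚ.1/pos⇒pos S

  regroup : ∀ a b c d → a ℚ.* b ℚ.- c ℚ.* d ≡ a ℚ.* (b ℚ.- d) ℚ.+ d ℚ.* (a ℚ.- c)
  regroup = solve 4 (λ a b c d →
    a :* b :- c :* d := a :* (b :- d) :+ d :* (a :- c)) refl
    where open ℚ.+-*-Solver

  mul-bound : ∀ p q {B δ} → ℚ.∣ p ∣ ℚ.≤ B → ℚ.∣ q ∣ ℚ.≤ δ →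
              ℚ.∣ p ℚ.* q ∣ ℚ.≤ B ℚ.* δ
  mul-bound p q {B} {δ} p≤B q≤δ = begin
    ℚ.∣ p ℚ.* q ∣            ≡⟨ ℚ.∣p*q∣≡∣p∣*∣q∣ p q ⟩
    ℚ.∣ p ∣ ℚ.* ℚ.∣ q ∣      ≤⟨ ℚ.*-monoʳ-≤-nonNeg ℚ.∣ q ∣
                                  {{ℚ.nonNegative (ℚ.0≤∣p∣ q)}} p≤B ⟩
    B ℚ.* ℚ.∣ q ∣            ≤⟨ ℚ.*-monoˡ-≤-nonNeg B
                                  {{ℚ.nonNegative (ℚ.≤-trans (ℚ.0≤∣p∣ p) p≤B)}} q≤δ ⟩
    B ℚ.* δ                  ∎

  isCauchy : ∀ ε → 0ℚ ℚ.< ε → ∃[ N ] ∀ m n → N ℕ.≤ m → N ℕ.≤ n →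
    ℚ.∣ approx x m ℚ.* approx y m ℚ.- approx x n ℚ.* approx y n ∣ ℚ.≤ ε
  isCauchy ε 0<ε = N₁ ℕ.⊔ N₂ , λ m n N≤m N≤n →
    let a = approx x m ; b = approx y m ; c = approx x n ; d = approx y n
    in begin
    ℚ.∣ a ℚ.* b ℚ.- c ℚ.* d ∣
      ≡⟨ cong ℚ.∣_∣ (regroup a b c d) ⟩
    ℚ.∣ a ℚ.* (b ℚ.- d) ℚ.+ d ℚ.* (a ℚ.- c) ∣
      ≤⟨ ℚ.∣p+q∣≤∣p∣+∣q∣ (a ℚ.* (b ℚ.- d)) (d ℚ.* (a ℚ.- c)) ⟩
    ℚ.∣ a ℚ.* (b ℚ.- d) ∣ ℚ.+ ℚ.∣ d ℚ.* (a ℚ.- c) ∣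
      ≤⟨ ℚ.+-mono-≤
           (mul-bound a (b ℚ.- d) (proj₂ (proj₂ (bounded x)) m)
             (h₂ m n (ℕ.m⊔n≤o⇒n≤o N₁ N₂ N≤m) (ℕ.m⊔n≤o⇒n≤o N₁ N₂ N≤n)))
           (mul-bound d (a ℚ.- c) (proj₂ (proj₂ (bounded y)) n)
             (h₁ m n (ℕ.m⊔n≤o⇒m≤o N₁ N₂ N≤m) (ℕ.m⊔n≤o⇒m≤o N₁ N₂ N≤n))) ⟩
    Bx ℚ.* δ ℚ.+ By ℚ.* δ      ≡⟨ ℚ.*-distribʳ-+ δ Bx By ⟨
    S ℚ.* δ                    ≡⟨ ℚ.*-assoc S (ℚ.1/ S) ε ⟨
    S ℚ.* ℚ.1/ S ℚ.* ε         ≡⟨ cong (ℚ._* ε) (ℚ.*-inverseʳ S) ⟩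
    1ℚ ℚ.* ε                   ≡⟨ ℚ.*-identityˡ ε ⟩
    ε                          ∎
    where
    δ = ℚ.1/ S ℚ.* ε
    0<δ : 0ℚ ℚ.< δ
    0<δ = subst (ℚ._< δ) (ℚ.*-zeroʳ (ℚ.1/ S)) (ℚ.*-monoʳ-<-pos (ℚ.1/ S) 0<ε)
    N₁ = proj₁ (cauchy x δ 0<δ)
    h₁ = proj₂ (cauchy x δ 0<δ)
    N₂ = proj₁ (cauchy y δ 0<δ)
    h₂ = proj₂ (cauchy y δ 0<δ)

∑ : ∀ {r} → Vector ℝ r → ℝ
∑ = Vector.foldr _+_ 0ℝ

∑ₗ : ∀ {A : Set} → List A → (A → ℝ) → ℝ
∑ₗ xs f = List.foldr (λ x s → f x + s) 0ℝ xs

_⟶_ : (ℕ → ℝ) → ℝ → Set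
a ⟶ x = ∀ ε → 0ℚ ℚ.< ε → ∃[ N ] ∀ i → N ℕ.≤ i →
        (a i ≤ x + fromℚ ε) × (x ≤ a i + fromℚ ε)

-- The coordinate subspace identification: for a subset P of A, the vector
-- u ∈ ℝ^P is identified with the vector v ∈ ℝ^A which agrees with u on P and
-- vanishes outside P.
IsZeroExtension : ∀ {A : Set} {P : A → Set} → (Σ A P → ℝ) → (A → ℝ) → Set
IsZeroExtension {P = P} u v =
  (∀ x (px : P x) → v x ≈ u (x , px)) × (∀ x → ¬ P x → v x ≈ 0ℝ)

------------------------------------------------------------------------
-- Indices and values are counted from 0: positions and values
-- 1, …, m of a permutation in S_m are the elements of Fin m.

-- π = pat_I(σ), where I is the image of the increasing map ι.
IsPattern : ∀ {j m} → (Fin j → Fin m) → Permutation′ m → Permutation′ j → Set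
IsPattern ι σ π = ∀ a b →
  (π ⟨$⟩ʳ a Fin.< π ⟨$⟩ʳ b → σ ⟨$⟩ʳ ι a Fin.< σ ⟨$⟩ʳ ι b) ×
  (σ ⟨$⟩ʳ ι a Fin.< σ ⟨$⟩ʳ ι b → π ⟨$⟩ʳ a Fin.< π ⟨$⟩ʳ b)

isPattern? : ∀ {j m} (ι : Fin j → Fin m) σ π → Dec (IsPattern ι σ π)
isPattern? ι σ π = Fin.all? λ a → Fin.all? λ b →
  ((π ⟨$⟩ʳ a Fin.<? π ⟨$⟩ʳ b) →-dec (σ ⟨$⟩ʳ ι a Fin.<? σ ⟨$⟩ʳ ι b)) ×-dec
  ((σ ⟨$⟩ʳ ι a Fin.<? σ ⟨$⟩ʳ ι b) →-dec (π ⟨$⟩ʳ a Fin.<? π ⟨$⟩ʳ b))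

Increasing : ∀ {j m} → (Fin j → Fin m) → Set
Increasing ι = ∀ a b → a Fin.< b → ι a Fin.< ι b

Avoids : ∀ {j m} → Permutation′ m → Permutation′ j → Set
Avoids {j} {m} σ π = ¬ (Σ[ ι ∈ (Fin j → Fin m) ] Increasing ι × IsPattern ι σ π)

↘ : ∀ n → Permutation′ n
↘ n = Perm.reverse

-- An element of Av(π) = ⋃_{m ≥ 1} Av_m(π).
record Av {j} (π : Permutation′ j) : Set where
  field
    size     : ℕ
    nonEmpty : NonZero size
    perm     : Permutation′ size
    avoids   : Avoids perm π

open Av public

-- The interval of length j whose first element is i.
window : ∀ {m} i j → .(i ℕ.+ j ℕ.≤ m) → Fin j → Fin m
window i j i+j≤m a =
  fromℕ< (ℕ.<-≤-trans (ℕ.+-monoʳ-< i (Fin.toℕ<n a)) i+j≤m)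

OccursAt : ∀ {j m} → Permutation′ j → Permutation′ m → ℕ → Set
OccursAt {j} {m} π σ i = Σ[ i+j≤m ∈ i ℕ.+ j ℕ.≤ m ] IsPattern (window i j i+j≤m) σ π

occursAt? : ∀ {j m} (π : Permutation′ j) (σ : Permutation′ m) i → Dec (OccursAt π σ i)
occursAt? {j} {m} π σ i with i ℕ.+ j ℕ.≤? m
... | no  i+j≰m = no (i+j≰m ∘ proj₁)
... | yes i+j≤m = map′ (i+j≤m ,_) proj₂ (isPattern? (window i j i+j≤m) σ π)

-- c-occ~(π, σ) (normalised by m); for patterns π of size at least 1 every interval starts at
-- some i < m.
c-occ : ∀ {j m} .{{_ : NonZero m}} → Permutation′ j → Permutation′ m → ℚ
c-occ {m = m} π σ =
  (+ List.length (List.filter (occursAt? π σ) (List.upTo m))) ℚ./ m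

-- The feasible region P_k^{Av(π)}, as a subset of ℝ^{S_k}.
FeasibleRegion : ∀ {j} (τ : Permutation′ j) k → (Permutation′ k → ℝ) → Set
FeasibleRegion τ k v =
  (∀ π → (0ℝ ≤ v π) × (v π ≤ 1ℝ)) ×
  Σ[ σ ∈ (ℕ → Av τ) ]
    (∀ M → ∃[ N ] ∀ i → N ℕ.≤ i → M ℕ.≤ size (σ i)) ×
    (∀ π → (λ i → fromℚ (c-occ {{nonEmpty (σ i)}} π (perm (σ i)))) ⟶ v π)

------------------------------------------------------------------------

-- Colours are the integers ≥ 1; the value 0 stands for "not yet coloured"
-- while the RITMO colouring is being constructed, and never remains in it.
Colouring : ℕ → Set
Colouring m = Fin m → ℕ

ColouredPerm : ℕ → Set
ColouredPerm m = Permutation′ m × Colouring m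

infix 4 _≈ᶜ_

_≈ᶜ_ : ∀ {m} → ColouredPerm m → ColouredPerm m → Set
(π , c) ≈ᶜ (π′ , c′) = (π Perm.≈ π′) × (c ≗ c′)

colouredPerm : ℕ → DecSetoid 0ℓ 0ℓ
colouredPerm m = record
  { Carrier = ColouredPerm m
  ; _≈_     = _≈ᶜ_
  ; isDecEquivalence = record
    { isEquivalence = record
      { refl  = (λ _ → refl) , (λ _ → refl)
      ; sym   = λ (p , q) → (λ a → sym (p a)) , (λ a → sym (q a))
      ; trans = λ (p , q) (p′ , q′) →
                  (λ a → trans (p a) (p′ a)) , (λ a → trans (q a) (q′ a))
      }
    ; _≟_ = λ (π , c) (π′ , c′) →
        Fin.all? (λ a → (π ⟨$⟩ʳ a) Fin.≟ (π′ ⟨$⟩ʳ a)) ×-dec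
        Fin.all? (λ a → c a ℕ.≟ c′ a)
    }
  }

IsColouredPattern : ∀ {j m} → (Fin j → Fin m) → ColouredPerm m → ColouredPerm j → Set
IsColouredPattern ι (σ , c) (π , c′) = IsPattern ι σ π × (c′ ≗ c ∘ ι)

-- y = be_j(x)
IsBeginning : ∀ {j m} → ColouredPerm m → ColouredPerm j → Set
IsBeginning {j} {m} x y =
  Σ[ le ∈ 0 ℕ.+ j ℕ.≤ m ] IsColouredPattern (window 0 j le) x y

-- y = en_j(x)
IsEnd : ∀ {j m} → ColouredPerm m → ColouredPerm j → Set
IsEnd {j} {m} x y =
  Σ[ le ∈ (m ∸ j) ℕ.+ j ℕ.≤ m ] IsColouredPattern (window (m ∸ j) j le) x y

Free : ∀ {m} → Colouring m → Fin m → ℕ → Set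
Free col i c = ∀ j → j Fin.< i → col j ≢ c

free? : ∀ {m} (col : Colouring m) i c → Dec (Free col i c)
free? col i c = Fin.all? λ j → (j Fin.<? i) →-dec ¬? (col j ℕ.≟ c)

-- The smallest c ≥ 1 with Free col i c.  Fewer than m indices precede i, so
-- one of the m candidates 1, …, m is free and the fuel does not run out.
leastFree : ∀ {m} → Colouring m → Fin m → ℕ
leastFree {m} col i = search m 1
  where
  search : ℕ → ℕ → ℕ
  search zero    c = c
  search (suc f) c = if does (free? col i c) then c else search f (suc c)

-- Values are processed from the largest to the smallest.
ℂ : ∀ {m} → Permutation′ m → Colouring m
ℂ {m} σ = List.foldl colourNext (λ _ → 0) (List.reverse (List.allFin m))
  where
  colourNext : Colouring m → Fin m → Colouring m
  colourNext col v = Vector.updateAt col i (λ _ → leastFree col i)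
    where i = σ ⟨$⟩ˡ v

𝕊 : ∀ {m} → Permutation′ m → ColouredPerm m
𝕊 σ = σ , ℂ σ

-- Membership in 𝒞_{n-1}(k).
IsInherited : ∀ n {k} → ColouredPerm k → Set
IsInherited n {k} x =
  Avoids (proj₁ x) (↘ n) ×
  Σ[ σ ∈ Av (↘ n) ] (k ℕ.≤ size σ) × IsEnd (𝕊 (perm σ)) x

𝒞 : ℕ → ℕ → Set
𝒞 n k = Σ (ColouredPerm k) (IsInherited n)

------------------------------------------------------------------------

record Graph : Set₁ where
  field
    vertices : Setoid 0ℓ 0ℓ
    edges    : DecSetoid 0ℓ 0ℓ

  open Setoid vertices public using () renaming (Carrier to Vertex; _≈_ to _≈ⱽ_)
  open DecSetoid edges public using () renaming (Carrier to Edge; _≈_ to _≈ᴱ_; _≟_ to _≟ᴱ_)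

  field
    -- e goes from u to w
    _from_to_ : Edge → Vertex → Vertex → Set

module _ (G : Graph) where
  open Graph G

  -- A nonempty simple cycle, of length suc len-1.
  record SimpleCycle : Set where
    field
      len-1  : ℕ
      vertex : Fin (suc (suc len-1)) → Vertex
      edge   : Fin (suc len-1) → Edge
      walk   : ∀ i → edge i from vertex (inject₁ i) to vertex (suc i)
      closed : vertex (fromℕ (suc len-1)) ≈ⱽ vertex zero
      distinct-vertices : Injective _≡_ _≈ⱽ_ (vertex ∘ inject₁)
      distinct-edges    : Injective _≡_ _≈ᴱ_ edge

  cycleVector : SimpleCycle → Edge → ℚ
  cycleVector C e =
    (+ List.length (List.filter (λ i → edge i ≟ᴱ e) (List.allFin (suc len-1)))) ℚ./ suc len-1
    where open SimpleCycle C

  CyclePolytope : (Edge → ℝ) → Set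
  CyclePolytope p =
    Σ[ r ∈ ℕ ] Σ[ C ∈ Vector SimpleCycle r ] Σ[ w ∈ Vector ℝ r ]
      (∀ i → 0ℝ ≤ w i) × (∑ w ≈ 1ℝ) ×
      (∀ e → p e ≈ ∑ (λ i → w i * fromℚ (cycleVector (C i) e)))

-- The coloured overlap graph 𝒪v_c(k, ↘_n).
𝒪v : ℕ → ℕ → Graph
𝒪v n k = record
  { vertices  = DecSetoid.setoid (On.decSetoid (colouredPerm (k ∸ 1)) (proj₁ {B = IsInherited n}))
  ; edges     = On.decSetoid (colouredPerm k) (proj₁ {B = IsInherited n})
  ; _from_to_ = λ e u w → IsBeginning (proj₁ e) (proj₁ u) × IsEnd (proj₁ e) (proj₁ w)
  }

------------------------------------------------------------------------

-- All colourings of k indices with colours in {1, …, q}.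
allColourings : ∀ q k → List (Colouring k)
allColourings q zero    = Vector.[] ∷ []
allColourings q (suc k) =
  List.concatMap (λ c → List.map (c Vector.∷_) (allColourings q k))
                 (List.map suc (List.upTo q))

-- u = Π p.  Colours of inherited colourings lie in [n-1], so
-- u_π = Σ_{(π,c) ∈ 𝒞_{n-1}(k)} p_(π,c) is the sum of the zero extension of p
-- over all colourings c : [k] → [n-1].
IsΠ : ∀ n k → (𝒞 n k → ℝ) →
      (Σ[ π ∈ Permutation′ k ] Avoids π (↘ n) → ℝ) → Set
IsΠ n k p u =
  Σ[ p̃ ∈ (ColouredPerm k → ℝ) ] IsZeroExtension p p̃ ×
  (∀ x → u x ≈ ∑ₗ (allColourings (n ∸ 1) k) (λ c → p̃ (proj₁ x , c)))

-- Π(P(𝒪v_c(k, ↘_n))), as a subset of ℝ^{S_k}.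
ProjectedCyclePolytope : ∀ n k → (Permutation′ k → ℝ) → Set
ProjectedCyclePolytope n k v =
  ∃[ p ] CyclePolytope (𝒪v n k) p × ∃[ u ] IsΠ n k p u × IsZeroExtension u v

{-# OPTIONS --safe #-}
-- The RITMO colour of an entry is the length of the longest decreasing
-- subsequence ending there.  Equivalently, the RITMO colouring is the only one
-- in which colours increase along descents and every entry of colour c is
-- preceded by larger entries of all the colours 1, …, c - 1.  A consequence is
-- an intrinsic, decidable description of the inherited colourings: a coloured
-- pattern can follow *any* word using all the colours 1, …, n - 1, because the
-- bounds imposed on the value of a new entry by the window and by the colours
-- never contradict each other.  So every walk in the coloured overlap graph is
-- realised, up to boundedly many windows, by a permutation avoiding ↘ n, and
-- going round the cycles C_i in the proportions w_i realises Π (∑ w_i e_{C_i})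
-- in the limit.
--
-- Conversely the windows of a permutation form a walk, and erasing its loops
-- writes its pattern frequencies, up to a bounded error, as a convex combination
-- of those of the simple cycles.  The weights need not converge along the
-- sequence, and compactness is not available constructively; but
-- Fourier–Motzkin elimination turns convergent values into convergent weights,
-- since it picks each unknown as a maximum or minimum of affine bounds.

module Submission where

open import Defs
open import Data.Bool using (true; false; if_then_else_)
open import Data.Empty using (⊥)
open import Data.Fin as Fin using (Fin; zero; suc; toℕ; fromℕ; fromℕ<; inject₁)
open import Data.Fin.Permutation as Perm using (Permutation′; _⟨$⟩ʳ_; _⟨$⟩ˡ_)
import Data.Fin.Properties as Fin
open import Data.List as List using (List; []; _∷_)
open import Data.List.Membership.Propositional using (_∈_; _∉_; find)
open import Data.List.Membership.Propositional.Properties using (∈-allFin; ∈-upTo⁻; ∈-lookup)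
import Data.List.Properties as List
open import Data.List.Relation.Unary.All as All using (All; []; _∷_)
open import Data.List.Relation.Unary.AllPairs as AllPairs using (AllPairs; []; _∷_)
import Data.List.Relation.Unary.All.Properties as All
import Data.List.Relation.Unary.AllPairs.Properties as AllPairs
open import Data.List.Relation.Unary.Any as Any using (Any; here; there)
import Data.List.Relation.Unary.Any.Properties as Any
open import Data.List.Relation.Unary.Any.Properties using (lookup-index)
open import Data.Nat as ℕ using (ℕ; zero; suc; NonZero; _∸_; z≤n; s≤s; z<s; s<s)
import Data.Nat.DivMod as ℕ
open import Data.Nat.ListAction using (sum)
import Data.Nat.Properties as ℕ
open import Data.Product using (Σ; Σ-syntax; ∃-syntax; _×_; _,_; proj₁; proj₂)
open import Data.Rational as ℚ using (ℚ; 0ℚ; 1ℚ; ½)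
import Data.Rational.Properties as ℚ
open import Data.Sum using (_⊎_; inj₁; inj₂; [_,_]′)
open import Data.Unit using (⊤; tt)
open import Data.Vec.Functional as Vector using (Vector)
import Data.Vec.Functional.Properties as Vector
open import Function using (_∘_; id)
open import Function.Bundles using (_⇔_; mk⇔)
open import Function.Definitions using (Injective)
open import Relation.Binary using (DecSetoid; tri<; tri≈; tri>)
open import Relation.Binary.PropositionalEquality
  using (_≡_; _≢_; refl; sym; trans; cong; cong₂; subst; subst₂; _≗_; ≢-sym; module ≡-Reasoning)
open import Relation.Nullary using (¬_; Dec; yes; no; does; ¬?; _×-dec_; _→-dec_; contradiction)
open import Relation.Nullary.Decidable using (map′; _⊎-dec_)
open import Relation.Unary using (Decidable)
open import Data.Integer as ℤ using (ℤ; +_; -[1+_])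
import Data.Integer.Properties as ℤ
open import Data.Rational.Unnormalised as ℚᵘ using (ℚᵘ; mkℚᵘ; *≡*; *≤*; *<*)
import Data.Rational.Unnormalised.Properties as ℚᵘ
import Data.Rational.Solver as ℚ
open import Data.Nat.Tactic.RingSolver using (solve-∀)

-- Counting and permutations

-- A new entry of colour `C` must exceed every entry of colour `C` and stay below some entry of
-- colour `C - 1`, while the window prescribes its place among the last few entries. The delicate
-- conflict is a window entry that must lie below the new one against the highest entry of colour
-- `C - 1`: the second alternative of `witness` in `Consistent` settles it when no entry of that
-- colour in the window helps. Values are rationals, so a new entry is inserted by density and the
-- old ones are never renumbered.
--
-- For the converse, the coefficients of the linear system are the pattern frequencies of the simple
-- cycles, hence rational: the signs on which elimination branches are decidable and do not depend
-- on the term of the sequence. The constants are not the coordinates of the limit but the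
-- combinations produced by loop erasure. This makes the system exactly solvable for every term, and
-- these constants still converge to the coordinates, because the error in the number of windows is
-- bounded and the sizes grow.

count : ∀ {A : Set} {P : A → Set} → Decidable P → List A → ℕ
count P? xs = List.length (List.filter P? xs)

indicator : ∀ {P : Set} → Dec P → ℕ
indicator (yes _) = 1
indicator (no  _) = 0

count-∷ : ∀ {A : Set} {P : A → Set} (P? : Decidable P) x xs →
          count P? (x ∷ xs) ≡ indicator (P? x) ℕ.+ count P? xs
count-∷ P? x xs with P? x
... | yes _ = refl
... | no  _ = refl

count-mono-≤ : ∀ {A : Set} {P Q : A → Set} (P? : Decidable P) (Q? : Decidable Q) xs →
               (∀ x → x ∈ xs → P x → Q x) → count P? xs ℕ.≤ count Q? xs
count-mono-≤ P? Q? []       P⇒Q = z≤n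
count-mono-≤ P? Q? (x ∷ xs) P⇒Q with P? x | Q? x
... | yes _ | yes _ = s≤s (count-mono-≤ P? Q? xs λ y y∈ → P⇒Q y (there y∈))
... | yes p | no ¬q = contradiction (P⇒Q x (here refl) p) ¬q
... | no  _ | yes _ = ℕ.m≤n⇒m≤1+n (count-mono-≤ P? Q? xs λ y y∈ → P⇒Q y (there y∈))
... | no  _ | no  _ = count-mono-≤ P? Q? xs λ y y∈ → P⇒Q y (there y∈)

count-cong : ∀ {A : Set} {P Q : A → Set} (P? : Decidable P) (Q? : Decidable Q) xs →
             (∀ x → x ∈ xs → P x → Q x) → (∀ x → x ∈ xs → Q x → P x) →
             count P? xs ≡ count Q? xs
count-cong P? Q? xs P⇒Q Q⇒P =
  ℕ.≤-antisym (count-mono-≤ P? Q? xs P⇒Q) (count-mono-≤ Q? P? xs Q⇒P)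

count-mono-< : ∀ {A : Set} {P Q : A → Set} (P? : Decidable P) (Q? : Decidable Q) {xs} →
               (∀ x → P x → Q x) → ∀ {y} → y ∈ xs → Q y → ¬ P y →
               count P? xs ℕ.< count Q? xs
count-mono-< P? Q? {x ∷ xs} P⇒Q (here refl) q ¬p with P? x | Q? x
... | yes p | _     = contradiction p ¬p
... | no  _ | yes _ = s≤s (count-mono-≤ P? Q? xs λ y _ → P⇒Q y)
... | no  _ | no ¬q = contradiction q ¬q
count-mono-< P? Q? {x ∷ xs} P⇒Q (there y∈) q ¬p with P? x | Q? x
... | yes _ | yes _ = s≤s (count-mono-< P? Q? P⇒Q y∈ q ¬p)
... | yes p | no ¬q = contradiction (P⇒Q x p) ¬q
... | no  _ | yes _ = ℕ.m≤n⇒m≤1+n (count-mono-< P? Q? P⇒Q y∈ q ¬p)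
... | no  _ | no  _ = count-mono-< P? Q? P⇒Q y∈ q ¬p

count≡0 : ∀ {A : Set} {P : A → Set} (P? : Decidable P) xs → (∀ x → x ∈ xs → ¬ P x) → count P? xs ≡ 0
count≡0 P? []       ¬P = refl
count≡0 P? (x ∷ xs) ¬P with P? x
... | yes p = contradiction p (¬P x (here refl))
... | no  _ = count≡0 P? xs λ y y∈ → ¬P y (there y∈)

injective⇒surjective : ∀ {m} (f : Fin m → Fin m) → Injective _≡_ _≡_ f → ∀ y → ∃[ x ] f x ≡ y
injective⇒surjective {suc m} f inj y with Fin.any? (λ x → f x Fin.≟ y)
... | yes hit = hit
... | no miss = contradiction
  (Fin.injective⇒≤ {f = λ x → Fin.punchOut (avoid x)}
    λ {a} {b} eq → inj (Fin.punchOut-injective (avoid a) (avoid b) eq))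
  ℕ.1+n≰n
  where
  avoid : ∀ x → y ≢ f x
  avoid x y≡fx = miss (x , sym y≡fx)

fromInjection : ∀ {m} (f : Fin m → Fin m) → Injective _≡_ _≡_ f → Permutation′ m
fromInjection f inj = Perm.permutation f (proj₁ ∘ onto) (proj₂ ∘ onto) (λ x → inj (proj₂ (onto (f x))))
  where onto = injective⇒surjective f inj

perm-injective : ∀ {m} (π : Permutation′ m) → Injective _≡_ _≡_ (π ⟨$⟩ʳ_)
perm-injective π {a} {b} eq = trans (sym (Perm.inverseˡ π)) (trans (cong (π ⟨$⟩ˡ_) eq) (Perm.inverseˡ π))

module _ {m} (f : Fin m → ℚ) (inj : Injective _≡_ _≡_ f) where

  private
    below? : ∀ a → Decidable (λ b → f b ℚ.< f a)
    below? a b = f b ℚ.<? f a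

    rank : Fin m → ℕ
    rank a = count (below? a) (List.allFin m)

    rank<m : ∀ a → rank a ℕ.< m
    rank<m a = ℕ.<-≤-trans
      (count-mono-< (below? a) (λ _ → yes tt) (λ _ _ → tt) (∈-allFin a) tt (ℚ.<-irrefl refl))
      (ℕ.≤-trans (List.length-filter (λ _ → yes tt) (List.allFin m))
                 (ℕ.≤-reflexive (List.length-tabulate {n = m} id)))

    rank-mono : ∀ {a b} → f a ℚ.< f b → rank a ℕ.< rank b
    rank-mono {a} {b} fa<fb = count-mono-< (below? a) (below? b)
      (λ x fx<fa → ℚ.<-trans fx<fa fa<fb) (∈-allFin a) fa<fb (ℚ.<-irrefl refl)

    to : Fin m → Fin m
    to a = fromℕ< (rank<m a)

    to-mono : ∀ a b → f a ℚ.< f b → to a Fin.< to b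
    to-mono a b fa<fb = ℕ.≤-trans (s≤s (ℕ.≤-reflexive (Fin.toℕ-fromℕ< (rank<m a))))
      (ℕ.≤-trans (rank-mono fa<fb) (ℕ.≤-reflexive (sym (Fin.toℕ-fromℕ< (rank<m b)))))

    to-injective : Injective _≡_ _≡_ to
    to-injective {a} {b} eq with ℚ.<-cmp (f a) (f b)
    ... | tri≈ _ fa≡fb _ = inj fa≡fb
    ... | tri< fa<fb _ _ = contradiction (cong toℕ eq) (ℕ.<⇒≢ (to-mono a b fa<fb))
    ... | tri> _ _ fb<fa = contradiction (cong toℕ (sym eq)) (ℕ.<⇒≢ (to-mono b a fb<fa))

  std : Permutation′ m
  std = fromInjection to to-injective

  std-mono : ∀ a b → f a ℚ.< f b → std ⟨$⟩ʳ a Fin.< std ⟨$⟩ʳ b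
  std-mono = to-mono

  std-cancel : ∀ a b → std ⟨$⟩ʳ a Fin.< std ⟨$⟩ʳ b → f a ℚ.< f b
  std-cancel a b lt with ℚ.<-cmp (f a) (f b)
  ... | tri< fa<fb _ _ = fa<fb
  ... | tri≈ _ fa≡fb _ = contradiction (cong (toℕ ∘ to) (inj fa≡fb)) (ℕ.<⇒≢ lt)
  ... | tri> _ _ fb<fa = contradiction (to-mono b a fb<fa) (ℕ.<-asym lt)

strictMono-expanding : ∀ {m} (g : Fin m → Fin m) → (∀ u v → u Fin.< v → g u Fin.< g v) →
                       ∀ t v → toℕ v ≡ t → t ℕ.≤ toℕ (g v)
strictMono-expanding g mono zero    v eq = z≤n
strictMono-expanding g mono (suc t) v eq =
  ℕ.≤-trans (s≤s (strictMono-expanding g mono t u (Fin.toℕ-fromℕ< t<m))) (mono u v u<v)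
  where
  t<m = ℕ.<-trans (ℕ.≤-reflexive (sym eq)) (Fin.toℕ<n v)
  u = fromℕ< t<m
  u<v : u Fin.< v
  u<v = ℕ.≤-reflexive (trans (cong suc (Fin.toℕ-fromℕ< t<m)) (sym eq))

-- The composite of `ρ` with the inverse of `π` is strictly increasing on `Fin m`, so it sends no
-- value below itself; the same holds with `π` and `ρ` exchanged.
orderIso-unique : ∀ {m} (π ρ : Permutation′ m) →
  (∀ a b → π ⟨$⟩ʳ a Fin.< π ⟨$⟩ʳ b → ρ ⟨$⟩ʳ a Fin.< ρ ⟨$⟩ʳ b) → π Perm.≈ ρ
orderIso-unique π ρ mono a = Fin.toℕ-injective (ℕ.≤-antisym
  (expand π ρ mono) (expand ρ π mono⁻¹))
  where
  expand : ∀ (π ρ : Permutation′ _) →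
    (∀ a b → π ⟨$⟩ʳ a Fin.< π ⟨$⟩ʳ b → ρ ⟨$⟩ʳ a Fin.< ρ ⟨$⟩ʳ b) → toℕ (π ⟨$⟩ʳ a) ℕ.≤ toℕ (ρ ⟨$⟩ʳ a)
  expand π ρ mono = subst (λ b → toℕ (π ⟨$⟩ʳ a) ℕ.≤ toℕ (ρ ⟨$⟩ʳ b)) (Perm.inverseˡ π)
    (strictMono-expanding (λ v → ρ ⟨$⟩ʳ (π ⟨$⟩ˡ v))
      (λ u v u<v → mono _ _ (subst (Fin._< π ⟨$⟩ʳ (π ⟨$⟩ˡ v)) (sym (Perm.inverseʳ π))
                              (subst (u Fin.<_) (sym (Perm.inverseʳ π)) u<v)))
      _ (π ⟨$⟩ʳ a) refl)
  mono⁻¹ : ∀ a b → ρ ⟨$⟩ʳ a Fin.< ρ ⟨$⟩ʳ b → π ⟨$⟩ʳ a Fin.< π ⟨$⟩ʳ b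
  mono⁻¹ a b lt with Fin.<-cmp (π ⟨$⟩ʳ a) (π ⟨$⟩ʳ b)
  ... | tri< πa<πb _ _ = πa<πb
  ... | tri≈ _ πa≡πb _ = contradiction (cong (λ x → toℕ (ρ ⟨$⟩ʳ x)) (perm-injective π πa≡πb)) (ℕ.<⇒≢ lt)
  ... | tri> _ _ πb<πa = contradiction (mono b a πb<πa) (ℕ.<-asym lt)

-- The RITMO colouring

-- The local function of leastFree has no name outside Defs; the
-- metavariable is solved by unification with its unfolding.
mutual
  search : ∀ m → Colouring m → Fin m → ℕ → ℕ → ℕ
  search = _

  leastFree-unfold : ∀ {m} (col : Colouring (suc m)) i → leastFree col i ≡
    (if does (free? col i 1) then 1 else search (suc m) col i m 2)
  leastFree-unfold {m} col i with does (free? col i 1)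
  ... | true  = refl
  ... | false with suc m | 2
  ...   | _ | _ = refl

occupied : ∀ {m} {col : Colouring m} {i c} → ¬ Free col i c → ∃[ j ] (j Fin.< i × col j ≡ c)
occupied {col = col} {i} {c} ¬free with Fin.any? (λ j → (j Fin.<? i) ×-dec (col j ℕ.≟ c))
... | yes found = found
... | no ¬found = contradiction (λ j j<i eq → ¬found (j , j<i , eq)) ¬free

-- `r` is the colour returned when the search starts at candidate `c` with fuel `f`. The alternative
-- `r ≡ f ℕ.+ c` records exhausted fuel, which `some-free` later excludes.
SearchResult : ∀ {m} (col : Colouring m) (i : Fin m) (f c r : ℕ) → Set
SearchResult col i f c r =
  c ℕ.≤ r × (∀ d → c ℕ.≤ d → d ℕ.< r → ¬ Free col i d) × (Free col i r ⊎ r ≡ f ℕ.+ c)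

search-spec : ∀ {m} (col : Colouring m) i f c → SearchResult col i f c (search m col i f c)
search-spec     col i zero    c = ℕ.≤-refl , (λ d c≤d d<c → contradiction c≤d (ℕ.<⇒≱ d<c)) , inj₂ refl
search-spec {m} col i (suc f) c = step (free? col i c)
  where
  step : (free : Dec (Free col i c)) →
         SearchResult col i (suc f) c (if does free then c else search m col i f (suc c))
  step (yes free) = ℕ.≤-refl , (λ d c≤d d<c → contradiction c≤d (ℕ.<⇒≱ d<c)) , inj₁ free
  step (no ¬free) with search-spec col i f (suc c)
  ... | c<r , least , end = ℕ.<⇒≤ c<r , least′ ,
    [ inj₁ , (λ eq → inj₂ (trans eq (ℕ.+-suc f c))) ]′ end
    where
    least′ : ∀ d → c ℕ.≤ d → d ℕ.< search m col i f (suc c) → ¬ Free col i d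
    least′ d c≤d d<r with ℕ.m≤n⇒m<n∨m≡n c≤d
    ... | inj₁ c<d  = least d c<d d<r
    ... | inj₂ refl = ¬free

-- Only i < m indices can block colours at i, so the m candidates are not all blocked.
some-free : ∀ {m} (col : Colouring m) i → ¬ (∀ d → 1 ℕ.≤ d → d ℕ.≤ m → ¬ Free col i d)
some-free {m} col i blocked = ℕ.<⇒≱ (Fin.toℕ<n i) (Fin.injective⇒≤ {f = g} λ {a} {b} eq →
  Fin.toℕ-injective (ℕ.suc-injective (begin
    suc (toℕ a)          ≡⟨ proj₂ (proj₂ (blocker a)) ⟨
    col (proj₁ (blocker a))  ≡⟨ cong col (g-injective a b eq) ⟩
    col (proj₁ (blocker b))  ≡⟨ proj₂ (proj₂ (blocker b)) ⟩
    suc (toℕ b)          ∎)))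
  where
  open ≡-Reasoning
  blocker : ∀ (d : Fin m) → ∃[ j ] (j Fin.< i × col j ≡ suc (toℕ d))
  blocker d = occupied (blocked (suc (toℕ d)) (s≤s z≤n) (Fin.toℕ<n d))
  g : Fin m → Fin (toℕ i)
  g d = fromℕ< (proj₁ (proj₂ (blocker d)))
  g-injective : ∀ a b → g a ≡ g b → proj₁ (blocker a) ≡ proj₁ (blocker b)
  g-injective a b eq = Fin.toℕ-injective (trans
    (sym (Fin.toℕ-fromℕ< (proj₁ (proj₂ (blocker a)))))
    (trans (cong toℕ eq) (Fin.toℕ-fromℕ< (proj₁ (proj₂ (blocker b))))))

leastFree-spec : ∀ {m} (col : Colouring m) i → let c = leastFree col i in
  1 ℕ.≤ c × Free col i c × (∀ d → 1 ℕ.≤ d → d ℕ.< c → ∃[ j ] (j Fin.< i × col j ≡ d))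
leastFree-spec {m} col i with search-spec col i m 1
... | 1≤c , least , inj₁ free = 1≤c , free , λ d 1≤d d<c → occupied (least d 1≤d d<c)
... | 1≤c , least , inj₂ eq   = contradiction
  (λ d 1≤d d≤m → least d 1≤d (subst (d ℕ.<_) (sym (trans eq (ℕ.+-comm m 1))) (s≤s d≤m)))
  (some-free col i)

-- A description of the RITMO colouring that does not mention the order of processing. The colouring
-- is computed by decreasing value, whereas permutations are grown below from left to right; this
-- form suits both.
record Greedy {m} (σ : Permutation′ m) (c : Colouring m) : Set where
  field
    positive  : ∀ i → 1 ℕ.≤ c i
    clashFree : ∀ {i j} → j Fin.< i → σ ⟨$⟩ʳ i Fin.< σ ⟨$⟩ʳ j → c j ≢ c i
    witness   : ∀ i d → 1 ℕ.≤ d → d ℕ.< c i →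
                ∃[ j ] (j Fin.< i × σ ⟨$⟩ʳ i Fin.< σ ⟨$⟩ʳ j × c j ≡ d)

  -- If `c i` were smaller than `c j`, then `j` would have a witness of colour `c i`; that witness
  -- precedes and exceeds `i` as well, so it clashes with `i`.
  increasing : ∀ {i j} → j Fin.< i → σ ⟨$⟩ʳ i Fin.< σ ⟨$⟩ʳ j → c j ℕ.< c i
  increasing {i} {j} j<i σi<σj with ℕ.<-cmp (c j) (c i)
  ... | tri< cj<ci _ _ = cj<ci
  ... | tri≈ _ cj≡ci _ = contradiction cj≡ci (clashFree j<i σi<σj)
  ... | tri> _ _ ci<cj with witness j (c i) (positive i) ci<cj
  ...   | j′ , j′<j , σj<σj′ , eq =
    contradiction eq (clashFree (ℕ.<-trans j′<j j<i) (ℕ.<-trans σi<σj σj<σj′))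

opposite-reflects-< : ∀ {n} {a b : Fin n} → a Fin.< b → Fin.opposite b Fin.< Fin.opposite a
opposite-reflects-< {n} {a} {b} a<b =
  ℕ.≤-trans (s≤s (ℕ.≤-reflexive (Fin.opposite-prop b)))
    (ℕ.≤-trans (ℕ.∸-monoʳ-< (s≤s a<b) (Fin.toℕ<n b)) (ℕ.≤-reflexive (sym (Fin.opposite-prop a))))

module _ {m} (σ : Permutation′ m) where

  colourNext : Fin m → Colouring m → Colouring m
  colourNext v col = Vector.updateAt col i (λ _ → leastFree col i)
    where i = σ ⟨$⟩ˡ v

  ℂ-foldr : ℂ σ ≡ List.foldr colourNext (λ _ → 0) (List.allFin m)
  ℂ-foldr = List.reverse-foldl (λ col v → colourNext v col) (λ _ → 0) (List.allFin m)

  -- The invariant after the values in `vs` have been coloured. Values arrive in decreasing order,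
  -- so every index that can block a colour carries a larger value; this is why `witness` can ask
  -- for it.
  record PartiallyGreedy (vs : List (Fin m)) (c : Colouring m) : Set where
    field
      uncoloured : ∀ i → σ ⟨$⟩ʳ i ∉ vs → c i ≡ 0
      positive   : ∀ i → σ ⟨$⟩ʳ i ∈ vs → 1 ℕ.≤ c i
      clashFree  : ∀ {i j} → σ ⟨$⟩ʳ i ∈ vs → σ ⟨$⟩ʳ j ∈ vs →
                   j Fin.< i → σ ⟨$⟩ʳ i Fin.< σ ⟨$⟩ʳ j → c j ≢ c i
      witness    : ∀ i → σ ⟨$⟩ʳ i ∈ vs → ∀ d → 1 ℕ.≤ d → d ℕ.< c i →
                   ∃[ j ] (j Fin.< i × σ ⟨$⟩ʳ i Fin.< σ ⟨$⟩ʳ j × c j ≡ d)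

  module _ {v : Fin m} {vs : List (Fin m)} {c : Colouring m} (v<vs : All (v Fin.<_) vs) (G : PartiallyGreedy vs c) where
    private
      module G = PartiallyGreedy G
      i₀ = σ ⟨$⟩ˡ v
      new = leastFree c i₀
      c′ = colourNext v c
      spec = leastFree-spec c i₀

      σi₀ : σ ⟨$⟩ʳ i₀ ≡ v
      σi₀ = Perm.inverseʳ σ

      at-new : c′ i₀ ≡ new
      at-new = Vector.updateAt-updates i₀ c

      at-old : ∀ {i} → i ≢ i₀ → c′ i ≡ c i
      at-old {i} i≢i₀ = Vector.updateAt-minimal i i₀ c i≢i₀

      isNew : ∀ {i} → σ ⟨$⟩ʳ i ≡ v → i ≡ i₀
      isNew eq = perm-injective σ (trans eq (sym σi₀))

      v≢ : ∀ {i} → σ ⟨$⟩ʳ i ∈ vs → i ≢ i₀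
      v≢ i∈vs refl = ℕ.<-irrefl (cong toℕ (sym σi₀)) (All.lookup v<vs i∈vs)

      -- Colour 0 marks the indices still to be coloured, so an index that blocks a candidate colour
      -- has already been processed, and its value is above `v`.
      coloured : ∀ {j d} → 1 ℕ.≤ d → c j ≡ d → σ ⟨$⟩ʳ j ∈ vs
      coloured {j} {d} 1≤d cj≡d with Any.any? (σ ⟨$⟩ʳ j Fin.≟_) vs
      ... | yes j∈vs = j∈vs
      ... | no  j∉vs = contradiction (subst (1 ℕ.≤_) (trans (sym cj≡d) (G.uncoloured j j∉vs)) 1≤d) λ ()

    colourNext-greedy : PartiallyGreedy (v ∷ vs) c′
    colourNext-greedy = record
      { uncoloured = λ i i∉ → trans
          (at-old λ { refl → i∉ (here σi₀) }) (G.uncoloured i (i∉ ∘ there))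
      ; positive = pos
      ; clashFree = clash
      ; witness = wit
      }
      where
      pos : ∀ i → σ ⟨$⟩ʳ i ∈ v ∷ vs → 1 ℕ.≤ c′ i
      pos i (here eq) rewrite isNew eq = subst (1 ℕ.≤_) (sym at-new) (proj₁ spec)
      pos i (there i∈) = subst (1 ℕ.≤_) (sym (at-old (v≢ i∈))) (G.positive i i∈)

      clash : ∀ {i j} → σ ⟨$⟩ʳ i ∈ v ∷ vs → σ ⟨$⟩ʳ j ∈ v ∷ vs →
              j Fin.< i → σ ⟨$⟩ʳ i Fin.< σ ⟨$⟩ʳ j → c′ j ≢ c′ i
      clash {i} {j} (here i≡v) (here j≡v) j<i σi<σj _ =
        ℕ.<-irrefl (cong toℕ (trans i≡v (sym j≡v))) σi<σj
      clash {i} {j} (here i≡v) (there j∈) j<i σi<σj eq with isNew i≡v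
      ... | refl = proj₁ (proj₂ spec) j j<i (trans (sym (at-old (v≢ j∈))) (trans eq at-new))
      clash {i} {j} (there i∈) (here j≡v) j<i σi<σj eq =
        ℕ.<-asym σi<σj (subst (Fin._< σ ⟨$⟩ʳ i) (sym j≡v) (All.lookup v<vs i∈))
      clash {i} {j} (there i∈) (there j∈) j<i σi<σj eq =
        G.clashFree i∈ j∈ j<i σi<σj (trans (sym (at-old (v≢ j∈))) (trans eq (at-old (v≢ i∈))))

      wit : ∀ i → σ ⟨$⟩ʳ i ∈ v ∷ vs → ∀ d → 1 ℕ.≤ d → d ℕ.< c′ i →
            ∃[ j ] (j Fin.< i × σ ⟨$⟩ʳ i Fin.< σ ⟨$⟩ʳ j × c′ j ≡ d)
      wit i (here i≡v) d 1≤d d<c with isNew i≡v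
      ... | refl with proj₂ (proj₂ spec) d 1≤d (subst (d ℕ.<_) at-new d<c)
      ...   | j , j<i , cj≡d = j , j<i ,
        subst (Fin._< σ ⟨$⟩ʳ j) (sym i≡v) (All.lookup v<vs (coloured 1≤d cj≡d)) ,
        trans (at-old (v≢ (coloured 1≤d cj≡d))) cj≡d
      wit i (there i∈) d 1≤d d<c with G.witness i i∈ d 1≤d (subst (d ℕ.<_) (at-old (v≢ i∈)) d<c)
      ... | j , j<i , σi<σj , cj≡d = j , j<i , σi<σj ,
        trans (at-old (v≢ (coloured 1≤d cj≡d))) cj≡d

  foldr-greedy : ∀ vs → AllPairs Fin._<_ vs → PartiallyGreedy vs (List.foldr colourNext (λ _ → 0) vs)
  foldr-greedy []       []         = record
    { uncoloured = λ _ _ → refl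
    ; positive   = λ _ ()
    ; clashFree  = λ ()
    ; witness    = λ _ ()
    }
  foldr-greedy (v ∷ vs) (v<vs ∷ sorted) = colourNext-greedy v<vs (foldr-greedy vs sorted)

  ℂ-greedy : Greedy σ (ℂ σ)
  ℂ-greedy = subst (Greedy σ) (sym ℂ-foldr) record
    { positive  = λ i → G.positive i (∈-allFin _)
    ; clashFree = G.clashFree (∈-allFin _) (∈-allFin _)
    ; witness   = λ i → G.witness i (∈-allFin _)
    }
    where module G = PartiallyGreedy (foldr-greedy (List.allFin m) (AllPairs.tabulate⁺-< id))

  private
    greedy-≮ : ∀ {c c′} → Greedy σ c → Greedy σ c′ → ∀ i →
               (∀ j → j Fin.< i → c j ≡ c′ j) → ¬ c i ℕ.< c′ i
    greedy-≮ {c} G G′ i ih ci<c′i with Greedy.witness G′ i (c i) (Greedy.positive G i) ci<c′i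
    ... | j , j<i , σi<σj , eq = Greedy.clashFree G j<i σi<σj (trans (ih j j<i) eq)

  -- At the first index where two such colourings differ, the one with the larger colour has a
  -- witness for the smaller colour. Both agree on that earlier entry, and in the other colouring it
  -- clashes.
  greedy-unique : ∀ {c c′} → Greedy σ c → Greedy σ c′ → c ≗ c′
  greedy-unique {c} {c′} G G′ i = go (toℕ i) i ℕ.≤-refl
    where
    go : ∀ t i → toℕ i ℕ.≤ t → c i ≡ c′ i
    ih : ∀ t i → toℕ i ℕ.≤ t → ∀ j → j Fin.< i → c j ≡ c′ j
    go t i i≤t with ℕ.<-cmp (c i) (c′ i)
    ... | tri< lt _ _ = contradiction lt (greedy-≮ G G′ i (ih t i i≤t))
    ... | tri≈ _ eq _ = eq
    ... | tri> _ _ gt = contradiction gt (greedy-≮ G′ G i λ j j<i → sym (ih t i i≤t j j<i))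
    ih zero    i i≤0 j j<i = contradiction (ℕ.<-≤-trans j<i i≤0) λ ()
    ih (suc t) i i≤t j j<i = go t j (ℕ.≤-pred (ℕ.≤-trans j<i i≤t))

  -- Along an occurrence of `↘ n` the colours climb from at least 1 to at least `n`. Stated for any
  -- colouring that increases along descents, so that it also covers windows, whose colourings need
  -- not be `Greedy`.
  colours<⇒avoids : ∀ {n} (c : Colouring m) → 1 ℕ.≤ n →
    (∀ {i j} → j Fin.< i → σ ⟨$⟩ʳ i Fin.< σ ⟨$⟩ʳ j → c j ℕ.< c i) →
    (∀ i → 1 ℕ.≤ c i) → (∀ i → c i ℕ.< n) → Avoids σ (↘ n)
  colours<⇒avoids {suc n} c _ incr pos bound (ι , ι-incr , pat) =
    ℕ.<⇒≱ (bound (ι (fromℕ n)))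
      (ℕ.≤-trans (s≤s (ℕ.≤-reflexive (sym (Fin.toℕ-fromℕ n)))) (climb n (fromℕ n) (Fin.toℕ-fromℕ n)))
    where
    climb : ∀ t (a : Fin (suc n)) → toℕ a ≡ t → suc (toℕ a) ℕ.≤ c (ι a)
    climb zero    a eq = subst (λ x → suc x ℕ.≤ c (ι a)) (sym eq) (pos (ι a))
    climb (suc t) a eq = subst (λ x → suc x ℕ.≤ c (ι a)) (trans (cong suc (Fin.toℕ-fromℕ< t<n)) (sym eq))
      (ℕ.≤-trans (s≤s (climb t b (Fin.toℕ-fromℕ< t<n)))
        (incr (ι-incr b a b<a) (proj₁ (pat a b) (opposite-reflects-< b<a))))
      where
      t<n = ℕ.<-trans (ℕ.≤-reflexive (sym eq)) (Fin.toℕ<n a)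
      b = fromℕ< t<n
      b<a : b Fin.< a
      b<a = ℕ.≤-reflexive (trans (cong suc (Fin.toℕ-fromℕ< t<n)) (sym eq))

module _ {m} {σ : Permutation′ m} {c : Colouring m} (G : Greedy σ c) where
  open Greedy G

  -- Witnesses of the next smaller colour are followed back to colour 1. The positions come from
  -- right to left, which is why `avoids⇒colours<` composes `τ` with `Fin.opposite`.
  descent : ∀ d i → c i ≡ suc d → Σ[ τ ∈ (Fin (suc d) → Fin m) ] τ zero ≡ i ×
    (∀ a b → a Fin.< b → τ b Fin.< τ a × σ ⟨$⟩ʳ τ a Fin.< σ ⟨$⟩ʳ τ b)
  descent zero    i eq = (λ _ → i) , refl , λ { zero zero () }
  descent (suc d) i eq with witness i (suc d) (s≤s z≤n) (ℕ.≤-reflexive (sym eq))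
  ... | j , j<i , σi<σj , cj≡ with descent d j cj≡
  ...   | τ , τ0≡j , desc = i Vector.∷ τ , refl , desc′
    where
    first : ∀ b → τ b Fin.< i × σ ⟨$⟩ʳ i Fin.< σ ⟨$⟩ʳ τ b
    first zero    rewrite τ0≡j = j<i , σi<σj
    first (suc b) with desc zero (suc b) z<s
    ... | lt , gt rewrite τ0≡j = ℕ.<-trans lt j<i , ℕ.<-trans σi<σj gt
    desc′ : ∀ a b → a Fin.< b → (i Vector.∷ τ) b Fin.< (i Vector.∷ τ) a ×
            σ ⟨$⟩ʳ (i Vector.∷ τ) a Fin.< σ ⟨$⟩ʳ (i Vector.∷ τ) b
    desc′ zero    (suc b) _         = first b
    desc′ (suc a) (suc b) (s<s a<b) = desc a b a<b

  avoids⇒colours< : ∀ {n} → 1 ℕ.≤ n → Avoids σ (↘ n) → ∀ i → c i ℕ.< n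
  avoids⇒colours< {suc n} _ av i with c i ℕ.<? suc n
  ... | yes ci<n = ci<n
  ... | no  ci≮n = contradiction occurrence av
    where
    -- If the colour of `i` exceeds `suc n`, one of its witnesses has colour exactly `suc n`, so
    -- that the descent has the length of the pattern.
    start : ∃[ j ] c j ≡ suc n
    start with ℕ.m≤n⇒m<n∨m≡n (ℕ.≮⇒≥ ci≮n)
    ... | inj₂ eq = i , sym eq
    ... | inj₁ lt = let j , _ , _ , eq = witness i (suc n) (s≤s z≤n) lt in j , eq
    occurrence : Σ[ ι ∈ (Fin (suc n) → Fin m) ] Increasing ι × IsPattern ι σ (↘ (suc n))
    occurrence with descent n (proj₁ start) (proj₂ start)
    ... | τ , _ , desc = τ ∘ Fin.opposite ,
      (λ a b a<b → proj₁ (desc _ _ (opposite-reflects-< a<b))) ,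
      λ a b → (λ lt → proj₂ (desc _ _ lt)) , cancel _ _
      where
      cancel : ∀ a b → σ ⟨$⟩ʳ τ a Fin.< σ ⟨$⟩ʳ τ b → a Fin.< b
      cancel a b lt with Fin.<-cmp a b
      ... | tri< a<b _ _    = a<b
      ... | tri≈ _ refl _   = contradiction lt (ℕ.<-irrefl refl)
      ... | tri> _ _ b<a    = contradiction (proj₂ (desc b a b<a)) (ℕ.<-asym lt)

-- The bound on the colours replaces a search through all increasing maps.
avoids? : ∀ {n m} → 1 ℕ.≤ n → (σ : Permutation′ m) → Dec (Avoids σ (↘ n))
avoids? {n} 1≤n σ = map′
  (colours<⇒avoids σ (ℂ σ) 1≤n (Greedy.increasing G) (Greedy.positive G))
  (avoids⇒colours< G 1≤n)
  (Fin.all? λ i → ℂ σ i ℕ.<? n)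
  where G = ℂ-greedy σ

-- Natural numbers as rationals

-- Opaque, so that n can be inferred from ι n.
opaque
  ι : ℕ → ℚ
  ι n = (+ n) ℚ./ 1

  ι-0 : ι 0 ≡ 0ℚ
  ι-0 = refl

  ι-1 : ι 1 ≡ 1ℚ
  ι-1 = refl

  toℚᵘ-ι : ∀ n → ℚ.toℚᵘ (ι n) ℚᵘ.≃ mkℚᵘ (+ n) 0
  toℚᵘ-ι n = ℚ.toℚᵘ-fromℚᵘ (mkℚᵘ (+ n) 0)

ι-+ : ∀ a b → ι (a ℕ.+ b) ≡ ι a ℚ.+ ι b
ι-+ a b = ℚ.toℚᵘ-injective (begin-equality
  ℚ.toℚᵘ (ι (a ℕ.+ b))                 ≃⟨ toℚᵘ-ι (a ℕ.+ b) ⟩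
  mkℚᵘ (+ (a ℕ.+ b)) 0                 ≃⟨ *≡* (cong (ℤ._* (+ 1)) (trans (ℤ.pos-+ a b) (sym (cong₂ ℤ._+_ (ℤ.*-identityʳ (+ a)) (ℤ.*-identityʳ (+ b)))))) ⟩
  mkℚᵘ (+ a) 0 ℚᵘ.+ mkℚᵘ (+ b) 0       ≃⟨ ℚᵘ.+-cong (toℚᵘ-ι a) (toℚᵘ-ι b) ⟨
  ℚ.toℚᵘ (ι a) ℚᵘ.+ ℚ.toℚᵘ (ι b)       ≃⟨ ℚ.toℚᵘ-homo-+ (ι a) (ι b) ⟨
  ℚ.toℚᵘ (ι a ℚ.+ ι b)                 ∎)
  where open ℚᵘ.≤-Reasoning

ι-* : ∀ a b → ι (a ℕ.* b) ≡ ι a ℚ.* ι b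
ι-* a b = ℚ.toℚᵘ-injective (begin-equality
  ℚ.toℚᵘ (ι (a ℕ.* b))                 ≃⟨ toℚᵘ-ι (a ℕ.* b) ⟩
  mkℚᵘ (+ (a ℕ.* b)) 0                 ≃⟨ *≡* (cong (ℤ._* (+ 1)) (ℤ.pos-* a b)) ⟩
  mkℚᵘ (+ a) 0 ℚᵘ.* mkℚᵘ (+ b) 0       ≃⟨ ℚᵘ.*-cong (toℚᵘ-ι a) (toℚᵘ-ι b) ⟨
  ℚ.toℚᵘ (ι a) ℚᵘ.* ℚ.toℚᵘ (ι b)       ≃⟨ ℚ.toℚᵘ-homo-* (ι a) (ι b) ⟨
  ℚ.toℚᵘ (ι a ℚ.* ι b)                 ∎)
  where open ℚᵘ.≤-Reasoning

ι-mono-≤ : ∀ {a b} → a ℕ.≤ b → ι a ℚ.≤ ι b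
ι-mono-≤ {a} {b} a≤b = ℚ.toℚᵘ-cancel-≤ (begin
  ℚ.toℚᵘ (ι a)    ≃⟨ toℚᵘ-ι a ⟩
  mkℚᵘ (+ a) 0    ≤⟨ *≤* (ℤ.*-monoʳ-≤-nonNeg (+ 1) (ℤ.+≤+ a≤b)) ⟩
  mkℚᵘ (+ b) 0    ≃⟨ toℚᵘ-ι b ⟨
  ℚ.toℚᵘ (ι b)    ∎)
  where open ℚᵘ.≤-Reasoning

ι-mono-< : ∀ {a b} → a ℕ.< b → ι a ℚ.< ι b
ι-mono-< {a} {b} a<b = ℚ.toℚᵘ-cancel-< (begin-strict
  ℚ.toℚᵘ (ι a)    ≃⟨ toℚᵘ-ι a ⟩
  mkℚᵘ (+ a) 0    <⟨ *<* (ℤ.*-monoʳ-<-pos (+ 1) (ℤ.+<+ a<b)) ⟩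
  mkℚᵘ (+ b) 0    ≃⟨ toℚᵘ-ι b ⟨
  ℚ.toℚᵘ (ι b)    ∎)
  where open ℚᵘ.≤-Reasoning

0≤ι : ∀ n → 0ℚ ℚ.≤ ι n
0≤ι n = subst (ℚ._≤ ι n) ι-0 (ι-mono-≤ z≤n)

fraction-cancel : ∀ a m .{{_ : NonZero m}} → ((+ a) ℚ./ m) ℚ.* ι m ≡ ι a
fraction-cancel a (suc m) = ℚ.toℚᵘ-injective (begin-equality
  ℚ.toℚᵘ (((+ a) ℚ./ suc m) ℚ.* ι (suc m))            ≃⟨ ℚ.toℚᵘ-homo-* ((+ a) ℚ./ suc m) (ι (suc m)) ⟩
  ℚ.toℚᵘ ((+ a) ℚ./ suc m) ℚᵘ.* ℚ.toℚᵘ (ι (suc m))   ≃⟨ ℚᵘ.*-cong (ℚ.toℚᵘ-fromℚᵘ (mkℚᵘ (+ a) m)) (toℚᵘ-ι (suc m)) ⟩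
  mkℚᵘ (+ a) m ℚᵘ.* mkℚᵘ (+ suc m) 0                  ≃⟨ *≡* (trans (ℤ.*-identityʳ _) (cong (λ d → + a ℤ.* + suc d) (sym (ℕ.*-identityʳ m)))) ⟩
  mkℚᵘ (+ a) 0                                        ≃⟨ toℚᵘ-ι a ⟨
  ℚ.toℚᵘ (ι a)                                        ∎)
  where open ℚᵘ.≤-Reasoning

archimedean : ∀ q → ∃[ N ] q ℚ.< ι N
archimedean q@(ℚ.mkℚ (+ p) d _) = suc p , ℚ.toℚᵘ-cancel-< (begin-strict
  ℚ.toℚᵘ q            <⟨ *<* (subst (ℤ._< + suc p ℤ.* + suc d) (sym (ℤ.*-identityʳ (+ p)))
                              (subst (+ p ℤ.<_) (ℤ.pos-* (suc p) (suc d)) (ℤ.+<+ (ℕ.m≤m*n (suc p) (suc d))))) ⟩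
  mkℚᵘ (+ suc p) 0    ≃⟨ toℚᵘ-ι (suc p) ⟨
  ℚ.toℚᵘ (ι (suc p))  ∎)
  where open ℚᵘ.≤-Reasoning
archimedean q@(ℚ.mkℚ -[1+ p ] d _) = 0 , subst (q ℚ.<_) (sym ι-0) (ℚ.negative⁻¹ q)

-- Locally consistent coloured permutations

toℕ-window : ∀ {m} i j .(le : i ℕ.+ j ℕ.≤ m) a → toℕ (window i j le a) ≡ i ℕ.+ toℕ a
toℕ-window i j le a = Fin.toℕ-fromℕ< (ℕ.<-≤-trans (ℕ.+-monoʳ-< i (Fin.toℕ<n a)) le)

-- The intrinsic description of inherited colourings: if the element that forces
-- the entry b to avoid the colour d is not in the window, then it precedes the
-- whole window and forces all entries below b to have colours above d.
record Consistent (n : ℕ) {k : ℕ} (x : ColouredPerm k) : Set where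
  private
    π = proj₁ x
    c = proj₂ x
  field
    positive   : ∀ a → 1 ℕ.≤ c a
    bounded    : ∀ a → c a ℕ.< n
    increasing : ∀ a b → a Fin.< b → π ⟨$⟩ʳ b Fin.< π ⟨$⟩ʳ a → c a ℕ.< c b
    witness    : ∀ b {d} → d ℕ.< c b → 1 ℕ.≤ d →
                 (∃[ a ] (a Fin.< b × π ⟨$⟩ʳ b Fin.< π ⟨$⟩ʳ a × c a ≡ d)) ⊎
                 (∀ a → π ⟨$⟩ʳ a Fin.< π ⟨$⟩ʳ b → d ℕ.< c a)

consistent? : ∀ n {k} (x : ColouredPerm k) → Dec (Consistent n x)
consistent? n (π , c) = map′
  (λ (p , q , r , s) → record { positive = p ; bounded = q ; increasing = r ; witness = s })
  (λ C → let open Consistent C in positive , bounded , increasing , witness)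
  ((Fin.all? λ a → 1 ℕ.≤? c a) ×-dec
   (Fin.all? λ a → c a ℕ.<? n) ×-dec
   (Fin.all? λ a → Fin.all? λ b → (a Fin.<? b) →-dec ((π ⟨$⟩ʳ b) Fin.<? (π ⟨$⟩ʳ a)) →-dec (c a ℕ.<? c b)) ×-dec
   (Fin.all? λ b → ℕ.allUpTo? (λ d → (1 ℕ.≤? d) →-dec
     ((Fin.any? λ a → (a Fin.<? b) ×-dec ((π ⟨$⟩ʳ b) Fin.<? (π ⟨$⟩ʳ a)) ×-dec (c a ℕ.≟ d)) ⊎-dec
      (Fin.all? λ a → ((π ⟨$⟩ʳ a) Fin.<? (π ⟨$⟩ʳ b)) →-dec (d ℕ.<? c a)))) (c b)))

consistent-resp : ∀ {n k} {x y : ColouredPerm k} → x ≈ᶜ y → Consistent n x → Consistent n y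
consistent-resp {n} {k} {π , c} {ρ , e} (π≈ρ , c≗e) C = record
  { positive   = λ a → subst (1 ℕ.≤_) (c≗e a) (positive a)
  ; bounded    = λ a → subst (ℕ._< n) (c≗e a) (bounded a)
  ; increasing = λ a b a<b lt → colour< (increasing a b a<b (back lt))
  ; witness    = λ b d<eb 1≤d → wit b (subst (_ ℕ.<_) (sym (c≗e b)) d<eb) 1≤d
  }
  where
  open Consistent C
  back : ∀ {a b} → ρ ⟨$⟩ʳ a Fin.< ρ ⟨$⟩ʳ b → π ⟨$⟩ʳ a Fin.< π ⟨$⟩ʳ b
  back {a} {b} lt rewrite π≈ρ a | π≈ρ b = lt
  forth : ∀ {a b} → π ⟨$⟩ʳ a Fin.< π ⟨$⟩ʳ b → ρ ⟨$⟩ʳ a Fin.< ρ ⟨$⟩ʳ b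
  forth {a} {b} lt rewrite π≈ρ a | π≈ρ b = lt
  colour< : ∀ {a b} → c a ℕ.< c b → e a ℕ.< e b
  colour< {a} {b} lt rewrite c≗e a | c≗e b = lt
  wit : ∀ b {d} → d ℕ.< c b → 1 ℕ.≤ d →
        (∃[ a ] (a Fin.< b × ρ ⟨$⟩ʳ b Fin.< ρ ⟨$⟩ʳ a × e a ≡ d)) ⊎
        (∀ a → ρ ⟨$⟩ʳ a Fin.< ρ ⟨$⟩ʳ b → d ℕ.< e a)
  wit b d<cb 1≤d with witness b d<cb 1≤d
  ... | inj₁ (a , a<b , lt , eq) = inj₁ (a , a<b , forth lt , trans (sym (c≗e a)) eq)
  ... | inj₂ all = inj₂ λ a lt → subst (_ ℕ.<_) (c≗e a) (all a (back lt))

consistent⇒avoids : ∀ {n k} {x : ColouredPerm k} → 1 ℕ.≤ n → Consistent n x → Avoids (proj₁ x) (↘ n)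
consistent⇒avoids {x = π , c} 1≤n C =
  colours<⇒avoids π c 1≤n (λ j<i lt → increasing _ _ j<i lt) positive bounded
  where open Consistent C

module _ {n m k i} {σ : Permutation′ m} {c : Colouring m} (G : Greedy σ c) (c<n : ∀ i → c i ℕ.< n)
         .(le : i ℕ.+ k ℕ.≤ m) {x : ColouredPerm k} where

  private
    module G = Greedy G
    w = window i k le

    w≡ : ∀ a → toℕ (w a) ≡ i ℕ.+ toℕ a
    w≡ = toℕ-window i k le

    w-mono : ∀ {a b} → a Fin.< b → w a Fin.< w b
    w-mono {a} {b} a<b rewrite w≡ a | w≡ b = ℕ.+-monoʳ-< i a<b

  window-consistent : IsColouredPattern w (σ , c) x → Consistent n x
  window-consistent (pat , col) = record
    { positive   = λ a → subst (1 ℕ.≤_) (sym (col a)) (G.positive (w a))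
    ; bounded    = λ a → subst (ℕ._< n) (sym (col a)) (c<n (w a))
    ; increasing = incr
    ; witness    = wit
    }
    where
    π = proj₁ x
    e = proj₂ x
    incr : ∀ a b → a Fin.< b → π ⟨$⟩ʳ b Fin.< π ⟨$⟩ʳ a → e a ℕ.< e b
    incr a b a<b lt rewrite col a | col b = G.increasing (w-mono a<b) (proj₁ (pat b a) lt)
    wit : ∀ b {d} → d ℕ.< e b → 1 ℕ.≤ d →
          (∃[ a ] (a Fin.< b × π ⟨$⟩ʳ b Fin.< π ⟨$⟩ʳ a × e a ≡ d)) ⊎
          (∀ a → π ⟨$⟩ʳ a Fin.< π ⟨$⟩ʳ b → d ℕ.< e a)
    wit b {d} d<eb 1≤d with G.witness (w b) d 1≤d (subst (d ℕ.<_) (col b) d<eb)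
    ... | j , j<wb , σwb<σj , cj≡d with toℕ j ℕ.<? i
    ...   | yes j<i = inj₂ λ a lt → subst (ℕ._< e a) cj≡d (subst (c j ℕ.<_) (sym (col a))
            (G.increasing (ℕ.<-≤-trans j<i (subst (i ℕ.≤_) (sym (w≡ a)) (ℕ.m≤m+n i _)))
                          (ℕ.<-trans (proj₁ (pat a b) lt) σwb<σj)))
    ...   | no  j≮i = inj₁ (a , a<b , proj₂ (pat b a) (subst (λ z → σ ⟨$⟩ʳ w b Fin.< σ ⟨$⟩ʳ z) (sym wa≡j) σwb<σj) ,
                            trans (col a) (trans (cong c wa≡j) cj≡d))
      where
      i≤j = ℕ.≮⇒≥ j≮i
      off<b : toℕ j ∸ i ℕ.< toℕ b
      off<b = ℕ.+-cancelˡ-< i _ _ (subst (ℕ._< i ℕ.+ toℕ b) (sym (ℕ.m+[n∸m]≡n i≤j))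
                (subst (toℕ j ℕ.<_) (w≡ b) j<wb))
      a = fromℕ< (ℕ.<-trans off<b (Fin.toℕ<n b))
      a≡ : toℕ a ≡ toℕ j ∸ i
      a≡ = Fin.toℕ-fromℕ< _
      a<b : a Fin.< b
      a<b = subst (ℕ._< toℕ b) (sym a≡) off<b
      wa≡j : w a ≡ j
      wa≡j = Fin.toℕ-injective (trans (w≡ a) (trans (cong (i ℕ.+_) a≡) (ℕ.m+[n∸m]≡n i≤j)))

-- Points between finite sets of rationals

module _ (f : ℕ → ℚ) {P : ℕ → Set} (P? : Decidable P) where

  -- A point that fails to lie below `f t` is replaced by one between `z` and `f t`; since `f t` is
  -- at most the old point, the new one stays below all earlier values.
  pointAbove : ∀ t z → (∀ i → i ℕ.< t → P i → z ℚ.< f i) →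
               ∃[ y ] (z ℚ.< y × (∀ i → i ℕ.< t → P i → y ℚ.< f i))
  pointAbove zero    z _  = z ℚ.+ 1ℚ ,
    subst (ℚ._< z ℚ.+ 1ℚ) (ℚ.+-identityʳ z) (ℚ.+-monoʳ-< z (ℚ.positive⁻¹ 1ℚ)) , λ _ ()
  pointAbove (suc t) z z< with pointAbove t z (λ i i<t → z< i (ℕ.m≤n⇒m≤1+n i<t)) | P? t
  ... | y , z<y , y< | no ¬Pt = y , z<y , below
    where
    below : ∀ i → i ℕ.< suc t → P i → y ℚ.< f i
    below i i<1+t Pi with ℕ.m<1+n⇒m<n∨m≡n i<1+t
    ... | inj₁ i<t  = y< i i<t Pi
    ... | inj₂ refl = contradiction Pi ¬Pt
  ... | y , z<y , y< | yes Pt with y ℚ.<? f t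
  ...   | yes y<ft = y , z<y , below
    where
    below : ∀ i → i ℕ.< suc t → P i → y ℚ.< f i
    below i i<1+t Pi with ℕ.m<1+n⇒m<n∨m≡n i<1+t
    ... | inj₁ i<t  = y< i i<t Pi
    ... | inj₂ refl = y<ft
  ...   | no y≮ft with ℚ.<-dense (z< t (ℕ.n<1+n t) Pt)
  ...     | y′ , z<y′ , y′<ft = y′ , z<y′ , below
    where
    below : ∀ i → i ℕ.< suc t → P i → y′ ℚ.< f i
    below i i<1+t Pi with ℕ.m<1+n⇒m<n∨m≡n i<1+t
    ... | inj₁ i<t  = ℚ.<-trans y′<ft (ℚ.≤-<-trans (ℚ.≮⇒≥ y≮ft) (y< i i<t Pi))
    ... | inj₂ refl = y′<ft

pointBelow : ∀ (f : ℕ → ℚ) {P : ℕ → Set} (P? : Decidable P) t z → (∀ i → i ℕ.< t → P i → f i ℚ.< z) →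
             ∃[ y ] (y ℚ.< z × (∀ i → i ℕ.< t → P i → f i ℚ.< y))
pointBelow f P? t z <z with pointAbove (ℚ.-_ ∘ f) P? t (ℚ.- z) (λ i i<t Pi → ℚ.neg-antimono-< (<z i i<t Pi))
... | y , z<y , y< = ℚ.- y , subst (ℚ.- y ℚ.<_) (neg-neg z) (ℚ.neg-antimono-< z<y) ,
  λ i i<t Pi → subst (ℚ._< ℚ.- y) (neg-neg (f i)) (ℚ.neg-antimono-< (y< i i<t Pi))
  where
  neg-neg : ∀ q → ℚ.- (ℚ.- q) ≡ q
  neg-neg = solve 1 (λ q → :- (:- q) := q) refl where open ℚ.+-*-Solver

-- The point moves only if the new value is on the wrong side, and then just past that value but not
-- past any value of the opposite side; the earlier separations persist because the move goes away
-- from the values already passed.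
cut : ∀ (f : ℕ → ℚ) {D : ℕ → Set} (D? : Decidable D) t →
      (∀ i j → i ℕ.< t → j ℕ.< t → D i → ¬ D j → f i ℚ.< f j) →
      ∃[ y ] (∀ i → i ℕ.< t → (D i → f i ℚ.< y) × (¬ D i → y ℚ.< f i))
cut f     D? zero    sep = 0ℚ , λ _ ()
cut f {D} D? (suc t) sep
  with cut f D? t (λ i j i<t j<t → sep i j (ℕ.m≤n⇒m≤1+n i<t) (ℕ.m≤n⇒m≤1+n j<t)) | D? t
... | y , split | yes Dt with f t ℚ.<? y
...   | yes ft<y = y , split′
  where
  split′ : ∀ i → i ℕ.< suc t → (D i → f i ℚ.< y) × (¬ D i → y ℚ.< f i)
  split′ i i<1+t with ℕ.m<1+n⇒m<n∨m≡n i<1+t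
  ... | inj₁ i<t  = split i i<t
  ... | inj₂ refl = (λ _ → ft<y) , contradiction Dt
...   | no ft≮y with pointAbove f (¬? ∘ D?) t (f t) (λ i i<t → sep t i (ℕ.n<1+n t) (ℕ.m≤n⇒m≤1+n i<t) Dt)
...     | y′ , ft<y′ , y′< = y′ , split′
  where
  split′ : ∀ i → i ℕ.< suc t → (D i → f i ℚ.< y′) × (¬ D i → y′ ℚ.< f i)
  split′ i i<1+t with ℕ.m<1+n⇒m<n∨m≡n i<1+t
  ... | inj₁ i<t  = (λ Di → ℚ.<-trans (proj₁ (split i i<t) Di) (ℚ.≤-<-trans (ℚ.≮⇒≥ ft≮y) ft<y′)) , y′< i i<t
  ... | inj₂ refl = (λ _ → ft<y′) , contradiction Dt
cut f {D} D? (suc t) sep | y , split | no ¬Dt with y ℚ.<? f t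
...   | yes y<ft = y , split′
  where
  split′ : ∀ i → i ℕ.< suc t → (D i → f i ℚ.< y) × (¬ D i → y ℚ.< f i)
  split′ i i<1+t with ℕ.m<1+n⇒m<n∨m≡n i<1+t
  ... | inj₁ i<t  = split i i<t
  ... | inj₂ refl = (λ Dt → contradiction Dt ¬Dt) , (λ _ → y<ft)
...   | no y≮ft with pointBelow f D? t (f t) (λ i i<t Di → sep i t (ℕ.m≤n⇒m≤1+n i<t) (ℕ.n<1+n t) Di ¬Dt)
...     | y′ , y′<ft , <y′ = y′ , split′
  where
  split′ : ∀ i → i ℕ.< suc t → (D i → f i ℚ.< y′) × (¬ D i → y′ ℚ.< f i)
  split′ i i<1+t with ℕ.m<1+n⇒m<n∨m≡n i<1+t
  ... | inj₁ i<t  = <y′ i i<t , (λ ¬Di → ℚ.<-trans y′<ft (ℚ.≤-<-trans (ℚ.≮⇒≥ y≮ft) (proj₂ (split i i<t) ¬Di)))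
  ... | inj₂ refl = (λ Dt → contradiction Dt ¬Dt) , (λ _ → y′<ft)

-- `cut` wants every index on one of two sides, but an index may be neither low nor up. `Down`
-- closes the low indices under smaller values and leaves all others above; as every index is then
-- strictly on one side, `y` also misses all values.
separate : ∀ (f : ℕ → ℚ) {lo up : ℕ → Set} → Decidable lo → ∀ m →
           (∀ i j → i ℕ.< m → j ℕ.< m → lo i → up j → f i ℚ.< f j) →
           ∃[ y ] (∀ i → i ℕ.< m → y ≢ f i × (lo i → f i ℚ.< y) × (up i → y ℚ.< f i))
separate f {lo} {up} lo? m sep with cut f down? m downClosed
  where
  Down : ℕ → Set
  Down i = ∃[ j ] (j ℕ.< m × lo j × f i ℚ.≤ f j)
  down? : Decidable Down
  down? i = ℕ.anyUpTo? (λ j → lo? j ×-dec (f i ℚ.≤? f j)) m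
  downClosed : ∀ i j → i ℕ.< m → j ℕ.< m → Down i → ¬ Down j → f i ℚ.< f j
  downClosed i j _ _ (l , l<m , lo-l , fi≤fl) ¬Dj =
    ℚ.≰⇒> λ fj≤fi → ¬Dj (l , l<m , lo-l , ℚ.≤-trans fj≤fi fi≤fl)
... | y , split = y , λ i i<m → offValues i i<m ,
  (λ lo-i → proj₁ (split i i<m) (i , i<m , lo-i , ℚ.≤-refl)) ,
  (λ up-i → proj₂ (split i i<m) λ (l , l<m , lo-l , fi≤fl) →
    ℚ.<-irrefl refl (ℚ.<-≤-trans (sep l i l<m i<m lo-l up-i) fi≤fl))
  where
  offValues : ∀ i → i ℕ.< m → y ≢ f i
  offValues i i<m refl = ℚ.<-irrefl refl (proj₂ (split i i<m) λ D → ℚ.<-irrefl refl (proj₁ (split i i<m) D))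

maximiser : ∀ (f : ℕ → ℚ) {P : ℕ → Set} → Decidable P → ∀ t → ∃[ i ] (i ℕ.< t × P i) →
            ∃[ i ] (i ℕ.< t × P i × (∀ j → j ℕ.< t → P j → f j ℚ.≤ f i))
maximiser f P? zero    (_ , () , _)
maximiser f {P} P? (suc t) (i , i<1+t , Pi) with ℕ.anyUpTo? P? t
... | no none = i , i<1+t , Pi , λ j j<1+t Pj → ℚ.≤-reflexive (cong f (trans (last j<1+t Pj) (sym (last i<1+t Pi))))
  where
  last : ∀ {j} → j ℕ.< suc t → P j → j ≡ t
  last {j} j<1+t Pj with ℕ.m<1+n⇒m<n∨m≡n j<1+t
  ... | inj₁ j<t  = contradiction (j , j<t , Pj) none
  ... | inj₂ refl = refl
... | yes some with maximiser f P? t some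
...   | l , l<t , Pl , max with P? t ×-dec (f l ℚ.<? f t)
...     | yes (Pt , fl<ft) = t , ℕ.n<1+n t , Pt , max′
  where
  max′ : ∀ j → j ℕ.< suc t → P j → f j ℚ.≤ f t
  max′ j j<1+t Pj with ℕ.m<1+n⇒m<n∨m≡n j<1+t
  ... | inj₁ j<t  = ℚ.<⇒≤ (ℚ.≤-<-trans (max j j<t Pj) fl<ft)
  ... | inj₂ refl = ℚ.≤-refl
...     | no ¬better = l , ℕ.m≤n⇒m≤1+n l<t , Pl , max′
  where
  max′ : ∀ j → j ℕ.< suc t → P j → f j ℚ.≤ f l
  max′ j j<1+t Pj with ℕ.m<1+n⇒m<n∨m≡n j<1+t
  ... | inj₁ j<t  = max j j<t Pj
  ... | inj₂ refl = ℚ.≮⇒≥ λ fl<ft → ¬better (Pj , fl<ft)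

-- Coloured words

-- A permutation under construction together with its RITMO colouring. `val` and `col` are total on
-- ℕ, only the first `m` places being meaningful, so that words of different lengths are compared
-- without casts.
record Word (n m : ℕ) : Set where
  field
    val        : ℕ → ℚ
    col        : ℕ → ℕ
    distinct   : ∀ {i j} → i ℕ.< j → j ℕ.< m → val i ≢ val j
    positive   : ∀ {i} → i ℕ.< m → 1 ℕ.≤ col i
    bounded    : ∀ {i} → i ℕ.< m → col i ℕ.< n
    increasing : ∀ {i j} → j ℕ.< i → i ℕ.< m → val i ℚ.< val j → col j ℕ.< col i
    witness    : ∀ {i} → i ℕ.< m → ∀ d → 1 ℕ.≤ d → d ℕ.< col i →
                 ∃[ j ] (j ℕ.< i × val i ℚ.< val j × col j ≡ d)

  val-injective : ∀ {i j} → i ℕ.< m → j ℕ.< m → val i ≡ val j → i ≡ j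
  val-injective {i} {j} i<m j<m eq with ℕ.<-cmp i j
  ... | tri< i<j _ _ = contradiction eq (distinct i<j j<m)
  ... | tri≈ _ i≡j _ = i≡j
  ... | tri> _ _ j<i = contradiction (sym eq) (distinct j<i i<m)

  val-<-resp : ∀ {i j i′ j′} → i ≡ i′ → j ≡ j′ → val i ℚ.< val j → val i′ ℚ.< val j′
  val-<-resp refl refl lt = lt

  -- The condition under which any consistent pattern can be appended: an entry of colour `C > 1`
  -- can then be placed below an existing entry of colour `C - 1`.
  Rainbow : Set
  Rainbow = ∀ d → 1 ℕ.≤ d → d ℕ.< n → ∃[ i ] (i ℕ.< m × col i ≡ d)

open Word public using (Rainbow)

-- Only the first `j` entries of `x` are compared, with the positions from `p` on: the window is
-- still being filled.
record Matches {n m k} (W : Word n m) (p j : ℕ) (x : ColouredPerm k) : Set where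
  open Word W
  private
    π = proj₁ x
  field
    order⇒ : ∀ a b → toℕ a ℕ.< j → toℕ b ℕ.< j → π ⟨$⟩ʳ a Fin.< π ⟨$⟩ʳ b → val (p ℕ.+ toℕ a) ℚ.< val (p ℕ.+ toℕ b)
    order⇐ : ∀ a b → toℕ a ℕ.< j → toℕ b ℕ.< j → val (p ℕ.+ toℕ a) ℚ.< val (p ℕ.+ toℕ b) → π ⟨$⟩ʳ a Fin.< π ⟨$⟩ʳ b
    colour : ∀ a → toℕ a ℕ.< j → proj₂ x a ≡ col (p ℕ.+ toℕ a)

record _≼_ {n m m′} (W : Word n m) (W′ : Word n m′) : Set where
  private
    module W  = Word W
    module W′ = Word W′
  field
    val≡ : ∀ {i} → i ℕ.< m → W′.val i ≡ W.val i
    col≡ : ∀ {i} → i ℕ.< m → W′.col i ≡ W.col i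

rainbow-≼ : ∀ {n m m′} {W : Word n m} {W′ : Word n m′} → m ℕ.≤ m′ → W ≼ W′ → Rainbow W → Rainbow W′
rainbow-≼ m≤m′ W≼W′ rb d 1≤d d<n with rb d 1≤d d<n
... | i , i<m , eq = i , ℕ.<-≤-trans i<m m≤m′ , trans (_≼_.col≡ W≼W′ i<m) eq

update : ∀ {A : Set} → (ℕ → A) → ℕ → A → ℕ → A
update f m y i with i ℕ.≟ m
... | yes _ = y
... | no  _ = f i

update-new : ∀ {A : Set} (f : ℕ → A) m y → update f m y m ≡ y
update-new f m y with m ℕ.≟ m
... | yes _   = refl
... | no  m≢m = contradiction refl m≢m

update-old : ∀ {A : Set} (f : ℕ → A) {m} y {i} → i ℕ.< m → update f m y i ≡ f i
update-old f {m} y {i} i<m with i ℕ.≟ m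
... | yes i≡m = contradiction i≡m (ℕ.<⇒≢ i<m)
... | no  _   = refl

module _ {n m} (W : Word n m) (y : ℚ) (C : ℕ)
         (1≤C : 1 ℕ.≤ C) (C<n : C ℕ.< n)
         (y-new : ∀ i → i ℕ.< m → y ≢ Word.val W i)
         (y-clashFree : ∀ i → i ℕ.< m → y ℚ.< Word.val W i → Word.col W i ≢ C)
         (y-witness : ∀ d → 1 ℕ.≤ d → d ℕ.< C → ∃[ i ] (i ℕ.< m × y ℚ.< Word.val W i × Word.col W i ≡ d))
  where
  open Word W

  private
    val′ = update val m y
    col′ = update col m C

    v-new : val′ m ≡ y
    v-new = update-new val m y
    c-new : col′ m ≡ C
    c-new = update-new col m C
    v-old : ∀ {i} → i ℕ.< m → val′ i ≡ val i
    v-old = update-old val y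
    c-old : ∀ {i} → i ℕ.< m → col′ i ≡ col i
    c-old = update-old col C

    y-increasing : ∀ {j} → j ℕ.< m → y ℚ.< val j → col j ℕ.< C
    y-increasing {j} j<m y<vj with ℕ.<-cmp (col j) C
    ... | tri< lt _ _ = lt
    ... | tri≈ _ eq _ = contradiction eq (y-clashFree j j<m y<vj)
    ... | tri> _ _ gt with witness j<m C 1≤C gt
    ...   | l , l<j , vj<vl , eq = contradiction eq (y-clashFree l (ℕ.<-trans l<j j<m) (ℚ.<-trans y<vj vj<vl))

    dist : ∀ {i j} → i ℕ.< j → j ℕ.< suc m → val′ i ≢ val′ j
    dist {i} {j} i<j j<1+m with ℕ.m<1+n⇒m<n∨m≡n j<1+m
    ... | inj₁ j<m rewrite v-old (ℕ.<-trans i<j j<m) | v-old j<m = distinct i<j j<m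
    ... | inj₂ refl rewrite v-old i<j | v-new = ≢-sym (y-new i i<j)

    pos : ∀ {i} → i ℕ.< suc m → 1 ℕ.≤ col′ i
    pos i<1+m with ℕ.m<1+n⇒m<n∨m≡n i<1+m
    ... | inj₁ i<m rewrite c-old i<m = positive i<m
    ... | inj₂ refl rewrite c-new = 1≤C

    bnd : ∀ {i} → i ℕ.< suc m → col′ i ℕ.< n
    bnd i<1+m with ℕ.m<1+n⇒m<n∨m≡n i<1+m
    ... | inj₁ i<m rewrite c-old i<m = bounded i<m
    ... | inj₂ refl rewrite c-new = C<n

    incr : ∀ {i j} → j ℕ.< i → i ℕ.< suc m → val′ i ℚ.< val′ j → col′ j ℕ.< col′ i
    incr {i} {j} j<i i<1+m with ℕ.m<1+n⇒m<n∨m≡n i<1+m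
    ... | inj₁ i<m rewrite v-old (ℕ.<-trans j<i i<m) | v-old i<m | c-old (ℕ.<-trans j<i i<m) | c-old i<m =
      increasing j<i i<m
    ... | inj₂ refl rewrite v-old j<i | v-new | c-old j<i | c-new = y-increasing j<i

    wit : ∀ {i} → i ℕ.< suc m → ∀ d → 1 ℕ.≤ d → d ℕ.< col′ i →
          ∃[ j ] (j ℕ.< i × val′ i ℚ.< val′ j × col′ j ≡ d)
    wit {i} i<1+m d 1≤d d<c with ℕ.m<1+n⇒m<n∨m≡n i<1+m
    wit {i} i<1+m d 1≤d d<c | inj₁ i<m rewrite v-old i<m | c-old i<m with witness i<m d 1≤d d<c
    ... | j , j<i , lt , eq = j , j<i , subst (val i ℚ.<_) (sym (v-old (ℕ.<-trans j<i i<m))) lt ,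
                              trans (c-old (ℕ.<-trans j<i i<m)) eq
    wit {i} i<1+m d 1≤d d<c | inj₂ refl rewrite v-new | c-new with y-witness d 1≤d d<c
    ... | j , j<m , lt , eq = j , j<m , subst (y ℚ.<_) (sym (v-old j<m)) lt , trans (c-old j<m) eq

  snoc : Word n (suc m)
  snoc = record
    { val = val′ ; col = col′ ; distinct = dist ; positive = pos ; bounded = bnd
    ; increasing = incr ; witness = wit }

  snoc-≼ : W ≼ snoc
  snoc-≼ = record { val≡ = v-old ; col≡ = c-old }

  snoc-val : Word.val snoc m ≡ y
  snoc-val = v-new

  snoc-col : Word.col snoc m ≡ C
  snoc-col = c-new

module _ {n p j k} (W : Word n (p ℕ.+ j)) (rainbow : Rainbow W) {x : ColouredPerm k} (cons : Consistent n x)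
         (b : Fin k) (b≡j : toℕ b ≡ j) (M : Matches W p j x) where
  private
    open Word W
    module C = Consistent cons
    module M = Matches M
    π = proj₁ x
    C = proj₂ x b

    m = p ℕ.+ j

    at : Fin k → ℕ
    at a = p ℕ.+ toℕ a

    at<m : ∀ {a} → toℕ a ℕ.< j → at a ℕ.< m
    at<m = ℕ.+-monoʳ-< p

    before : ∀ {a : Fin k} → toℕ a ℕ.< j → a Fin.< b
    before {a} = subst (toℕ a ℕ.<_) (sym b≡j)

    -- The bounds from above by colour: the highest entry whose colour is one less.
    Top : ℕ → Set
    Top i = i ℕ.< m × suc (col i) ≡ C × (∀ l → l ℕ.< m → suc (col l) ≡ C → val l ℚ.≤ val i)

    top : ∀ {d} → 1 ℕ.≤ d → d ℕ.< C → ∃[ i ] Top i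
    top {d} 1≤d d<C with rainbow (ℕ.pred C) (ℕ.≤-trans 1≤d (ℕ.≤-pred (subst (suc d ℕ.≤_) C≡ d<C)))
                                 (ℕ.<-trans (ℕ.≤-reflexive (sym C≡)) (C.bounded b))
      where
      C≡ : C ≡ suc (ℕ.pred C)
      C≡ = sym (ℕ.suc-pred C {{ℕ.>-nonZero (C.positive b)}})
    ... | i , i<m , eq = maximiser val (λ l → suc (col l) ℕ.≟ C) m
      (i , i<m , trans (cong suc eq) (ℕ.suc-pred C {{ℕ.>-nonZero (C.positive b)}}))

    -- The bounds on the new value. By colour, it must exceed all entries of colour `C`, lest it
    -- clash, and lie below the highest entry of colour `C - 1`, which then serves as witness. For
    -- `C = 1` there is no `Top`, since colours are positive.
    Lo Up : ℕ → Set
    Lo i = (∃[ a ] (toℕ a ℕ.< j × π ⟨$⟩ʳ a Fin.< π ⟨$⟩ʳ b × i ≡ at a)) ⊎ col i ≡ C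
    Up i = (∃[ a ] (toℕ a ℕ.< j × π ⟨$⟩ʳ b Fin.< π ⟨$⟩ʳ a × i ≡ at a)) ⊎ Top i

    lo? : Decidable Lo
    lo? i = (Fin.any? λ a → (toℕ a ℕ.<? j) ×-dec (π ⟨$⟩ʳ a Fin.<? π ⟨$⟩ʳ b) ×-dec (i ℕ.≟ at a)) ⊎-dec (col i ℕ.≟ C)

    Lo<Up : ∀ i l → i ℕ.< m → l ℕ.< m → Lo i → Up l → val i ℚ.< val l
    Lo<Up i l i<m l<m (inj₁ (a , a<j , πa<πb , refl)) (inj₁ (a′ , a′<j , πb<πa′ , refl)) =
      M.order⇒ a a′ a<j a′<j (ℕ.<-trans πa<πb πb<πa′)
    -- Either the window has an entry of colour `C - 1` above `b`, hence above `a` and at most the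
    -- top one; or the colour of `a` exceeds `C - 1`, and `a` has a witness of that colour in the
    -- word.
    Lo<Up i l i<m l<m (inj₁ (a , a<j , πa<πb , refl)) (inj₂ (_ , l-col , l-max))
      with C.witness b {col l} (ℕ.≤-reflexive l-col) (positive l<m)
    ... | inj₁ (a′ , a′<b , πb<πa′ , a′-col) = ℚ.<-≤-trans
      (M.order⇒ a a′ a<j a′<j (ℕ.<-trans πa<πb πb<πa′))
      (l-max (at a′) (at<m a′<j) (trans (cong suc (trans (sym (M.colour a′ a′<j)) a′-col)) l-col))
      where a′<j = subst (toℕ a′ ℕ.<_) b≡j a′<b
    ... | inj₂ all with witness (at<m a<j) (col l) (positive l<m) (subst (col l ℕ.<_) (M.colour a a<j) (all a πa<πb))
    ...   | i′ , i′<i , lt , eq = ℚ.<-≤-trans lt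
      (l-max i′ (ℕ.<-trans i′<i (at<m a<j)) (trans (cong suc eq) l-col))
    -- Suppose `i` had the larger value. To the left of `a′` it would force the colour of `a′` above
    -- `C`; to the right it would itself be a window entry above `b` of colour `C`. But in `x` the
    -- entries before and above `b` have colours below `C`.
    Lo<Up i l i<m l<m (inj₂ ci≡C) (inj₁ (a′ , a′<j , πb<πa′ , refl)) with ℚ.<-cmp (val i) (val (at a′))
    ... | tri< lt _ _ = lt
    ... | tri≈ _ eq _ = contradiction (trans (trans (M.colour a′ a′<j) (cong col (sym (val-injective i<m l<m eq)))) ci≡C)
                                      (ℕ.<⇒≢ (C.increasing a′ b (before a′<j) πb<πa′))
    ... | tri> _ _ gt with ℕ.<-cmp i (at a′)
    ...   | tri< i<a′ _ _ = contradiction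
      (subst (C ℕ.<_) (sym (M.colour a′ a′<j)) (subst (ℕ._< col (at a′)) ci≡C (increasing i<a′ l<m gt)))
      (ℕ.<-asym (C.increasing a′ b (before a′<j) πb<πa′))
    ...   | tri≈ _ refl _ = contradiction gt (ℚ.<-irrefl refl)
    ...   | tri> _ _ a′<i = contradiction (trans (M.colour a″ a″<j) (trans (cong col (sym i≡)) ci≡C))
      (ℕ.<⇒≢ (C.increasing a″ b (before a″<j) (ℕ.<-trans πb<πa′ (M.order⇐ a′ a″ a′<j a″<j (subst (λ z → val (at a′) ℚ.< val z) i≡ gt)))))
      where
      p≤i = ℕ.≤-trans (ℕ.m≤m+n p (toℕ a′)) (ℕ.<⇒≤ a′<i)
      off<j : i ∸ p ℕ.< j
      off<j = ℕ.+-cancelˡ-< p _ _ (subst (ℕ._< m) (sym (ℕ.m+[n∸m]≡n p≤i)) i<m)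
      off<k = ℕ.<-trans (subst (i ∸ p ℕ.<_) (sym b≡j) off<j) (Fin.toℕ<n b)
      a″ = fromℕ< off<k
      a″<j : toℕ a″ ℕ.< j
      a″<j = subst (ℕ._< j) (sym (Fin.toℕ-fromℕ< off<k)) off<j
      i≡ : i ≡ at a″
      i≡ = sym (trans (cong (p ℕ.+_) (Fin.toℕ-fromℕ< off<k)) (ℕ.m+[n∸m]≡n p≤i))
    -- An entry of colour `C` has its own witness of colour `C - 1`, which is at most the top one.
    Lo<Up i l i<m l<m (inj₂ ci≡C) (inj₂ (_ , l-col , l-max))
      with witness i<m (col l) (positive l<m) (ℕ.≤-reflexive (trans l-col (sym ci≡C)))
    ... | i′ , i′<i , lt , eq = ℚ.<-≤-trans lt (l-max i′ (ℕ.<-trans i′<i i<m) (trans (cong suc eq) l-col))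

    sep : ∃[ y ] (∀ i → i ℕ.< m → y ≢ val i × (Lo i → val i ℚ.< y) × (Up i → y ℚ.< val i))
    sep = separate val lo? m Lo<Up

    y = proj₁ sep

    y-new : ∀ i → i ℕ.< m → y ≢ val i
    y-new i i<m = proj₁ (proj₂ sep i i<m)
    above : ∀ i → i ℕ.< m → Lo i → val i ℚ.< y
    above i i<m = proj₁ (proj₂ (proj₂ sep i i<m))
    below : ∀ i → i ℕ.< m → Up i → y ℚ.< val i
    below i i<m = proj₂ (proj₂ (proj₂ sep i i<m))

    -- The top entry provides colour `C - 1`; its own witnesses lie above it and provide all smaller
    -- colours.
    y-wit : ∀ d → 1 ℕ.≤ d → d ℕ.< C → ∃[ i ] (i ℕ.< m × y ℚ.< val i × col i ≡ d)
    y-wit d 1≤d d<C with top 1≤d d<C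
    ... | i , is-top@(i<m , i-col , _) with ℕ.m≤n⇒m<n∨m≡n (ℕ.≤-pred (subst (suc d ℕ.≤_) (sym i-col) d<C))
    ...   | inj₂ refl = i , i<m , below i i<m (inj₂ is-top) , refl
    ...   | inj₁ d<ci with witness i<m d 1≤d d<ci
    ...     | l , l<i , lt , eq = l , ℕ.<-trans l<i i<m , ℚ.<-trans (below i i<m (inj₂ is-top)) lt , eq

    y-clash : ∀ i → i ℕ.< m → y ℚ.< val i → col i ≢ C
    y-clash i i<m y<vi ci≡C = ℚ.<-irrefl refl (ℚ.<-trans y<vi (above i i<m (inj₂ ci≡C)))

  extend : Word n (suc m)
  extend = snoc W y C (C.positive b) (C.bounded b) y-new y-clash y-wit

  extend-≼ : W ≼ extend
  extend-≼ = snoc-≼ W y C (C.positive b) (C.bounded b) y-new y-clash y-wit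

  private
    module E = Word extend
    module A = _≼_ extend-≼

    at-b : at b ≡ m
    at-b = cong (p ℕ.+_) b≡j

    val-b : E.val (at b) ≡ y
    val-b = trans (cong E.val at-b) (snoc-val W y C (C.positive b) (C.bounded b) y-new y-clash y-wit)

    col-b : E.col (at b) ≡ C
    col-b = trans (cong E.col at-b) (snoc-col W y C (C.positive b) (C.bounded b) y-new y-clash y-wit)

    position : ∀ a → toℕ a ℕ.< suc j → toℕ a ℕ.< j ⊎ a ≡ b
    position a a<1+j with ℕ.m<1+n⇒m<n∨m≡n a<1+j
    ... | inj₁ a<j = inj₁ a<j
    ... | inj₂ a≡j = inj₂ (Fin.toℕ-injective (trans a≡j (sym b≡j)))

    order⇒ : ∀ a a′ → toℕ a ℕ.< suc j → toℕ a′ ℕ.< suc j →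
             π ⟨$⟩ʳ a Fin.< π ⟨$⟩ʳ a′ → E.val (at a) ℚ.< E.val (at a′)
    order⇒ a a′ a≤j a′≤j lt with position a a≤j | position a′ a′≤j
    ... | inj₁ a<j  | inj₁ a′<j rewrite A.val≡ (at<m a<j) | A.val≡ (at<m a′<j) = M.order⇒ a a′ a<j a′<j lt
    ... | inj₁ a<j  | inj₂ refl rewrite A.val≡ (at<m a<j) | val-b = above (at a) (at<m a<j) (inj₁ (a , a<j , lt , refl))
    ... | inj₂ refl | inj₁ a′<j rewrite A.val≡ (at<m a′<j) | val-b = below (at a′) (at<m a′<j) (inj₁ (a′ , a′<j , lt , refl))
    ... | inj₂ refl | inj₂ refl = contradiction lt (ℕ.<-irrefl refl)

    order⇐ : ∀ a a′ → toℕ a ℕ.< suc j → toℕ a′ ℕ.< suc j →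
             E.val (at a) ℚ.< E.val (at a′) → π ⟨$⟩ʳ a Fin.< π ⟨$⟩ʳ a′
    order⇐ a a′ a≤j a′≤j lt with Fin.<-cmp (π ⟨$⟩ʳ a) (π ⟨$⟩ʳ a′)
    ... | tri< πa<πa′ _ _ = πa<πa′
    ... | tri≈ _ eq _ = contradiction lt (ℚ.<-irrefl (cong (E.val ∘ at) (perm-injective π eq)))
    ... | tri> _ _ gt = contradiction lt (ℚ.<-asym (order⇒ a′ a a′≤j a≤j gt))

    colour : ∀ a → toℕ a ℕ.< suc j → proj₂ x a ≡ E.col (at a)
    colour a a≤j with position a a≤j
    ... | inj₁ a<j  = trans (M.colour a a<j) (sym (A.col≡ (at<m a<j)))
    ... | inj₂ refl = sym col-b

  extend-matches : Matches extend p (suc j) x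
  extend-matches = record { order⇒ = order⇒ ; order⇐ = order⇐ ; colour = colour }

-- The initial rainbow word, and the permutation of a word

bars : ∀ {n} → 1 ℕ.≤ n → Word n (n ∸ 1)
bars {n} 1≤n = record
  -- A descent of length `n - 1`: the colours are forced to be 1, ..., `n - 1`, and `↘ n` does not
  -- yet occur.
  { val        = λ i → ℚ.- ι i
  ; col        = suc
  ; distinct   = λ i<j _ eq → ℚ.<-irrefl (sym eq) (ℚ.neg-antimono-< (ι-mono-< i<j))
  ; positive   = λ _ → s≤s z≤n
  ; bounded    = λ i<n-1 → subst (_ ℕ.≤_) (ℕ.m+[n∸m]≡n 1≤n) (s≤s i<n-1)
  ; increasing = λ j<i _ _ → s≤s j<i
  ; witness    = λ { i<n-1 (suc d) _ (s<s d<i) → d , d<i , ℚ.neg-antimono-< (ι-mono-< d<i) , refl }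
  }

bars-rainbow : ∀ {n} (1≤n : 1 ℕ.≤ n) → Rainbow (bars 1≤n)
bars-rainbow {suc n} 1≤n (suc d) _ (s<s d<n) = d , d<n , refl

-- `IsPattern` on raw values, free of `Fin m` and of the proof that the window fits; occurrences in
-- a word and in its extension become comparable.
OrderedAs : (ℕ → ℚ) → ℕ → ∀ {k} → Permutation′ k → Set
OrderedAs f i π = ∀ a b →
  (π ⟨$⟩ʳ a Fin.< π ⟨$⟩ʳ b → f (i ℕ.+ toℕ a) ℚ.< f (i ℕ.+ toℕ b)) ×
  (f (i ℕ.+ toℕ a) ℚ.< f (i ℕ.+ toℕ b) → π ⟨$⟩ʳ a Fin.< π ⟨$⟩ʳ b)

orderedAs-resp : ∀ (f g : ℕ → ℚ) i {k} (π : Permutation′ k) → (∀ (a : Fin k) → f (i ℕ.+ toℕ a) ≡ g (i ℕ.+ toℕ a)) →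
                 OrderedAs f i π → OrderedAs g i π
orderedAs-resp f g i π f≡g ord a b rewrite sym (f≡g a) | sym (f≡g b) = ord a b

matches-0 : ∀ {n m k} (W : Word n m) p (x : ColouredPerm k) → Matches W p 0 x
matches-0 W p x = record { order⇒ = λ _ _ () ; order⇐ = λ _ _ () ; colour = λ _ () }

module _ {n m} (W : Word n m) where
  open Word W

  private
    vals : Fin m → ℚ
    vals a = val (toℕ a)

    vals-injective : Injective _≡_ _≡_ vals
    vals-injective eq = Fin.toℕ-injective (val-injective (Fin.toℕ<n _) (Fin.toℕ<n _) eq)

  toPerm : Permutation′ m
  toPerm = std vals vals-injective

  toPerm-mono : ∀ a b → val (toℕ a) ℚ.< val (toℕ b) → toPerm ⟨$⟩ʳ a Fin.< toPerm ⟨$⟩ʳ b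
  toPerm-mono = std-mono vals vals-injective

  toPerm-cancel : ∀ a b → toPerm ⟨$⟩ʳ a Fin.< toPerm ⟨$⟩ʳ b → val (toℕ a) ℚ.< val (toℕ b)
  toPerm-cancel = std-cancel vals vals-injective

  -- With `greedy-unique` this identifies the colours carried by the word with the RITMO colours of
  -- its permutation.
  toPerm-greedy : Greedy toPerm (col ∘ toℕ)
  toPerm-greedy = record
    { positive  = λ i → positive (Fin.toℕ<n i)
    ; clashFree = λ {i} {j} j<i lt → ℕ.<⇒≢ (increasing j<i (Fin.toℕ<n i) (toPerm-cancel i j lt))
    ; witness   = wit
    }
    where
    wit : ∀ i d → 1 ℕ.≤ d → d ℕ.< col (toℕ i) →
          ∃[ j ] (j Fin.< i × toPerm ⟨$⟩ʳ i Fin.< toPerm ⟨$⟩ʳ j × col (toℕ j) ≡ d)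
    wit i d 1≤d d<c with witness (Fin.toℕ<n i) d 1≤d d<c
    ... | j , j<i , lt , eq = fromℕ< j<m , subst (ℕ._< toℕ i) (sym j≡) j<i ,
      toPerm-mono i (fromℕ< j<m) (subst (λ z → val (toℕ i) ℚ.< val z) (sym j≡) lt) , trans (cong col j≡) eq
      where
      j<m = ℕ.<-trans j<i (Fin.toℕ<n i)
      j≡ : toℕ (fromℕ< j<m) ≡ j
      j≡ = Fin.toℕ-fromℕ< j<m

  toPerm-avoids : 1 ℕ.≤ n → Avoids toPerm (↘ n)
  toPerm-avoids 1≤n = colours<⇒avoids toPerm (col ∘ toℕ) 1≤n
    (Greedy.increasing toPerm-greedy) (Greedy.positive toPerm-greedy) (λ i → bounded (Fin.toℕ<n i))

  toAv : 1 ℕ.≤ n → 1 ℕ.≤ m → Av (↘ n)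
  toAv 1≤n 1≤m = record
    { size = m ; nonEmpty = ℕ.>-nonZero 1≤m ; perm = toPerm ; avoids = toPerm-avoids 1≤n }

  module _ {k i} .(le : i ℕ.+ k ℕ.≤ m) (π : Permutation′ k) where
    private
      w = window i k le
      w≡ = toℕ-window i k le

    pattern⇒order : IsPattern w toPerm π → OrderedAs val i π
    pattern⇒order pat a b =
      (λ lt → val-<-resp (w≡ a) (w≡ b) (toPerm-cancel (w a) (w b) (proj₁ (pat a b) lt))) ,
      (λ lt → proj₂ (pat a b) (toPerm-mono (w a) (w b) (val-<-resp (sym (w≡ a)) (sym (w≡ b)) lt)))

    order⇒pattern : OrderedAs val i π → IsPattern w toPerm π
    order⇒pattern ord a b =
      (λ lt → toPerm-mono (w a) (w b) (val-<-resp (sym (w≡ a)) (sym (w≡ b)) (proj₁ (ord a b) lt))) ,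
      (λ lt → proj₂ (ord a b) (val-<-resp (w≡ a) (w≡ b) (toPerm-cancel (w a) (w b) lt)))

  module _ {k i} .(le : i ℕ.+ k ℕ.≤ m) {x : ColouredPerm k} (M : Matches W i k x) where
    private module M = Matches M

    matches⇒pattern : IsPattern (window i k le) toPerm (proj₁ x)
    matches⇒pattern = order⇒pattern le (proj₁ x) λ a b →
      M.order⇒ a b (Fin.toℕ<n a) (Fin.toℕ<n b) , M.order⇐ a b (Fin.toℕ<n a) (Fin.toℕ<n b)

    matches⇒colouredPattern : IsColouredPattern (window i k le) (𝕊 toPerm) x
    matches⇒colouredPattern = matches⇒pattern , λ a →
      trans (M.colour a (Fin.toℕ<n a)) (trans (cong col (sym (toℕ-window i k le a)))
        (greedy-unique toPerm toPerm-greedy (ℂ-greedy toPerm) (window i k le a)))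

record Extended {n m k} (W : Word n m) (p j : ℕ) (x : ColouredPerm k) : Set where
  field
    word    : Word n (suc m)
    rainbow : Rainbow word
    extends : W ≼ word
    matches : Matches word p (suc j) x

opaque
  -- The equation on `m` lets each caller split the length of its word in its own way.
  extended : ∀ {n m p j k} (W : Word n m) → m ≡ p ℕ.+ j → Rainbow W → {x : ColouredPerm k} → Consistent n x →
             j ℕ.< k → Matches W p j x → Extended W p j x
  extended {p = p} {j} {k} W refl rb cons j<k M = record
    { word    = extend W rb cons b b≡j M
    ; rainbow = rainbow-≼ (ℕ.n≤1+n _) (extend-≼ W rb cons b b≡j M) rb
    ; extends = extend-≼ W rb cons b b≡j M
    ; matches = extend-matches W rb cons b b≡j M
    }
    where
    b : Fin k
    b = fromℕ< j<k
    b≡j : toℕ b ≡ j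
    b≡j = Fin.toℕ-fromℕ< j<k

-- Occurrences in growing words

opaque
  occurrences : ∀ {n m k} → Permutation′ k → Word n m → ℕ
  occurrences {m = m} π W = count (occursAt? π (toPerm W)) (List.upTo m)

  occurrences≡count : ∀ {n m k} (π : Permutation′ k) (W : Word n m) →
                      occurrences π W ≡ count (occursAt? π (toPerm W)) (List.upTo m)
  occurrences≡count π W = refl

count-++ : ∀ {A : Set} {P : A → Set} (P? : Decidable P) xs ys →
           count P? (xs List.++ ys) ≡ count P? xs ℕ.+ count P? ys
count-++ P? xs ys = trans (cong List.length (List.filter-++ P? xs ys)) (List.length-++ (List.filter P? xs))

count-upTo-suc : ∀ {P : ℕ → Set} (P? : Decidable P) m →
                 count P? (List.upTo (suc m)) ≡ count P? (List.upTo m) ℕ.+ indicator (P? m)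
count-upTo-suc P? m = begin
  count P? (List.upTo (suc m))                       ≡⟨ cong (count P?) (List.upTo-∷ʳ m) ⟨
  count P? (List.upTo m List.++ m ∷ [])              ≡⟨ count-++ P? (List.upTo m) (m ∷ []) ⟩
  count P? (List.upTo m) ℕ.+ count P? (m ∷ [])
    ≡⟨ cong (count P? (List.upTo m) ℕ.+_) (trans (count-∷ P? m []) (ℕ.+-identityʳ _)) ⟩
  count P? (List.upTo m) ℕ.+ indicator (P? m)        ∎
  where open ≡-Reasoning

indicator-yes : ∀ {P : Set} (P? : Dec P) → P → indicator P? ≡ 1
indicator-yes (yes _) p = refl
indicator-yes (no ¬p) p = contradiction p ¬p

indicator-no : ∀ {P : Set} (P? : Dec P) → ¬ P → indicator P? ≡ 0
indicator-no (yes p) ¬p = contradiction p ¬p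
indicator-no (no _)  ¬p = refl

indicator-cong : ∀ {P Q : Set} (P? : Dec P) (Q? : Dec Q) → (P → Q) → (Q → P) → indicator P? ≡ indicator Q?
indicator-cong (yes p) Q? P⇒Q Q⇒P = sym (indicator-yes Q? (P⇒Q p))
indicator-cong (no ¬p) Q? P⇒Q Q⇒P = sym (indicator-no Q? (¬p ∘ Q⇒P))

indicator≤1 : ∀ {P : Set} (P? : Dec P) → indicator P? ℕ.≤ 1
indicator≤1 (yes _) = ℕ.≤-refl
indicator≤1 (no  _) = z≤n

count-upTo-≤ : ∀ {P : ℕ → Set} (P? : Decidable P) {q m} → q ℕ.≤ m → (∀ i → P i → i ℕ.< q) →
               count P? (List.upTo m) ≡ count P? (List.upTo q)
count-upTo-≤ P? {q} {m} q≤m P<q with ℕ.m≤n⇒m<n∨m≡n q≤m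
... | inj₂ refl = refl
count-upTo-≤ P? {q} {suc m} q≤1+m P<q | inj₁ (s≤s q≤m) = begin
  count P? (List.upTo (suc m))                  ≡⟨ count-upTo-suc P? m ⟩
  count P? (List.upTo m) ℕ.+ indicator (P? m)
    ≡⟨ cong (count P? (List.upTo m) ℕ.+_) (indicator-no (P? m) λ Pm → ℕ.<⇒≱ (P<q m Pm) q≤m) ⟩
  count P? (List.upTo m) ℕ.+ 0                  ≡⟨ ℕ.+-identityʳ _ ⟩
  count P? (List.upTo m)                        ≡⟨ count-upTo-≤ P? q≤m P<q ⟩
  count P? (List.upTo q)                        ∎
  where open ≡-Reasoning

module _ {n m k′} {W : Word n m} {W′ : Word n (suc m)} (W≼W′ : W ≼ W′) (π : Permutation′ (suc k′)) where
  private
    k = suc k′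
    q = suc m ∸ k
    P? = occursAt? π (toPerm W)
    Q? = occursAt? π (toPerm W′)
    module W = Word W
    module W′ = Word W′

    room : ∀ {i} → i ℕ.< q → i ℕ.+ k ℕ.≤ m
    room {i} i<q = subst (ℕ._≤ m) (sym (ℕ.+-suc i k′))
      (ℕ.≤-trans (ℕ.+-monoˡ-≤ k′ i<q) (ℕ.≤-reflexive (ℕ.m∸n+n≡m k′≤m)))
      where
      k′≤m : k′ ℕ.≤ m
      k′≤m = ℕ.<⇒≤ (ℕ.m∸n≢0⇒n<m λ q≡0 → contradiction (subst (i ℕ.<_) q≡0 i<q) λ ())

    inWindow : ∀ {i} → i ℕ.+ k ℕ.≤ m → ∀ (a : Fin k) → i ℕ.+ toℕ a ℕ.< m
    inWindow {i} le a = ℕ.<-≤-trans (ℕ.+-monoʳ-< i (Fin.toℕ<n a)) le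

    forth : ∀ i → i ℕ.+ k ℕ.≤ m → OccursAt π (toPerm W) i → OccursAt π (toPerm W′) i
    forth i le (le′ , pat) = ℕ.m≤n⇒m≤1+n le′ , order⇒pattern W′ (ℕ.m≤n⇒m≤1+n le′) π
      (orderedAs-resp W.val W′.val i π (λ a → sym (_≼_.val≡ W≼W′ (inWindow le a))) (pattern⇒order W le′ π pat))

    back : ∀ i → i ℕ.+ k ℕ.≤ m → OccursAt π (toPerm W′) i → OccursAt π (toPerm W) i
    back i le (le′ , pat) = le , order⇒pattern W le π
      (orderedAs-resp W′.val W.val i π (λ a → _≼_.val≡ W≼W′ (inWindow le a)) (pattern⇒order W′ le′ π pat))

  -- The old entries keep their relative order, so the only new window is the one that ends at the
  -- new entry; it starts at `q`. If the word is still shorter than the pattern, truncated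
  -- subtraction makes `q` zero, where nothing fits.
  occurrences-snoc : occurrences π W′ ≡ occurrences π W ℕ.+ indicator (occursAt? π (toPerm W′) q)
  occurrences-snoc = trans (occurrences≡count π W′) (trans (begin
    count Q? (List.upTo (suc m))
      ≡⟨ count-upTo-≤ Q? (s≤s (ℕ.m∸n≤m m k′)) (λ i (le , _) → s≤s (ℕ.m+n≤o⇒m≤o∸n i le)) ⟩
    count Q? (List.upTo (suc q))                      ≡⟨ count-upTo-suc Q? q ⟩
    count Q? (List.upTo q) ℕ.+ indicator (Q? q)       ≡⟨ cong (ℕ._+ indicator (Q? q)) (count-cong Q? P? (List.upTo q)
                                                           (λ i i∈ → back i (room (∈-upTo⁻ i∈))) (λ i i∈ → forth i (room (∈-upTo⁻ i∈)))) ⟩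
    count P? (List.upTo q) ℕ.+ indicator (Q? q)       ≡⟨ cong (ℕ._+ indicator (Q? q)) (count-upTo-≤ P? (ℕ.m∸n≤m m k′)
                                                           (λ i (le , _) → ℕ.m+n≤o⇒m≤o∸n (suc i) (subst (ℕ._≤ m) (ℕ.+-suc i k′) le))) ⟨
    count P? (List.upTo m) ℕ.+ indicator (Q? q)       ∎) (cong (ℕ._+ indicator (Q? q)) (sym (occurrences≡count π W))))
    where open ≡-Reasoning

_≟ₚ_ : ∀ {k} (π ρ : Permutation′ k) → Dec (π Perm.≈ ρ)
π ≟ₚ ρ = Fin.all? λ a → (π ⟨$⟩ʳ a) Fin.≟ (ρ ⟨$⟩ʳ a)

pattern-unique : ∀ {k m} (ι : Fin k → Fin m) (σ : Permutation′ m) (π ρ : Permutation′ k) →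
                 IsPattern ι σ π → IsPattern ι σ ρ → π Perm.≈ ρ
pattern-unique ι σ π ρ p r = orderIso-unique π ρ λ a b lt → proj₂ (r a b) (proj₁ (p a b) lt)

pattern-resp : ∀ {k m} (ι : Fin k → Fin m) (σ : Permutation′ m) (π ρ : Permutation′ k) →
               π Perm.≈ ρ → IsPattern ι σ π → IsPattern ι σ ρ
pattern-resp ι σ π ρ π≈ρ p a b rewrite sym (π≈ρ a) | sym (π≈ρ b) = p a b

occursAt-indicator : ∀ {k m} (π ρ : Permutation′ k) (σ : Permutation′ m) i (le : i ℕ.+ k ℕ.≤ m) →
                     IsPattern (window i k le) σ ρ → indicator (occursAt? π σ i) ≡ indicator (π ≟ₚ ρ)
occursAt-indicator π ρ σ i le ρ-pat = indicator-cong (occursAt? π σ i) (π ≟ₚ ρ)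
  (λ (_ , π-pat) → pattern-unique (window i _ le) σ π ρ π-pat ρ-pat)
  (λ π≈ρ → le , pattern-resp (window i _ le) σ ρ π (λ a → sym (π≈ρ a)) ρ-pat)

record Linked {k′} (e f : ColouredPerm (suc k′)) : Set where
  field
    vertex    : ColouredPerm k′
    end       : IsEnd e vertex
    beginning : IsBeginning f vertex

-- The last `k′` entries of `e` and the first `k′` of `f` have the same coloured pattern, the common
-- vertex. So once `e` is in place, all of `f` but its last entry is in place one position further
-- on.
shift-matches : ∀ {n m p k′} {W : Word n m} {e f : ColouredPerm (suc k′)} →
                Linked e f → Matches W p (suc k′) e → Matches W (suc p) k′ f
shift-matches {p = p} {k′} {W} {e} {f} L M = record
  { order⇒ = λ a b a<k′ b<k′ lt → W.val-<-resp (shift a a<k′) (shift b b<k′)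
      (M.order⇒ _ _ (Fin.toℕ<n _) (Fin.toℕ<n _)
        (proj₁ (proj₁ end-pat (lower a a<k′) (lower b b<k′))
          (proj₂ (proj₁ beg-pat (lower a a<k′) (lower b b<k′)) (entry-<-resp (sym (raise a a<k′)) (sym (raise b b<k′)) lt))))
  ; order⇐ = λ a b a<k′ b<k′ lt → entry-<-resp (raise a a<k′) (raise b b<k′)
      (proj₁ (proj₁ beg-pat (lower a a<k′) (lower b b<k′))
        (proj₂ (proj₁ end-pat (lower a a<k′) (lower b b<k′))
          (M.order⇐ _ _ (Fin.toℕ<n _) (Fin.toℕ<n _) (W.val-<-resp (sym (shift a a<k′)) (sym (shift b b<k′)) lt))))
  ; colour = λ a a<k′ → begin
      proj₂ f a                                  ≡⟨ cong (proj₂ f) (raise a a<k′) ⟨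
      proj₂ f (window 0 k′ beg-le (lower a a<k′)) ≡⟨ proj₂ beg-pat (lower a a<k′) ⟨
      proj₂ vertex (lower a a<k′)                ≡⟨ proj₂ end-pat (lower a a<k′) ⟩
      proj₂ e (w (lower a a<k′))                 ≡⟨ M.colour _ (Fin.toℕ<n _) ⟩
      W.col (p ℕ.+ toℕ (w (lower a a<k′)))       ≡⟨ cong W.col (shift a a<k′) ⟩
      W.col (suc p ℕ.+ toℕ a)                    ∎
  }
  where
  open ≡-Reasoning
  open Linked L
  module M = Matches M
  module W = Word W
  end-le = proj₁ end
  end-pat = proj₂ end
  beg-le = proj₁ beginning
  beg-pat = proj₂ beginning
  w = window (suc k′ ∸ k′) k′ end-le

  lower : ∀ (a : Fin (suc k′)) → toℕ a ℕ.< k′ → Fin k′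
  lower a a<k′ = fromℕ< a<k′

  raise : ∀ a a<k′ → window 0 k′ beg-le (lower a a<k′) ≡ a
  raise a a<k′ = Fin.toℕ-injective (trans (toℕ-window 0 k′ beg-le _) (Fin.toℕ-fromℕ< a<k′))

  shift : ∀ a a<k′ → p ℕ.+ toℕ (w (lower a a<k′)) ≡ suc p ℕ.+ toℕ a
  shift a a<k′ = begin
    p ℕ.+ toℕ (w (lower a a<k′))                      ≡⟨ cong (p ℕ.+_) (toℕ-window _ k′ end-le _) ⟩
    p ℕ.+ (suc k′ ∸ k′ ℕ.+ toℕ (lower a a<k′))
      ≡⟨ cong₂ (λ s t → p ℕ.+ (s ℕ.+ t)) (ℕ.m+n∸n≡m 1 k′) (Fin.toℕ-fromℕ< a<k′) ⟩
    p ℕ.+ suc (toℕ a)                                 ≡⟨ ℕ.+-suc p (toℕ a) ⟩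
    suc p ℕ.+ toℕ a                                   ∎

  entry-<-resp : ∀ {a b a′ b′} → a ≡ a′ → b ≡ b′ →
                 proj₁ f ⟨$⟩ʳ a Fin.< proj₁ f ⟨$⟩ʳ b → proj₁ f ⟨$⟩ʳ a′ Fin.< proj₁ f ⟨$⟩ʳ b′
  entry-<-resp refl refl lt = lt

-- The pattern is entered in a fresh window at position `m`, with no overlap to respect. Each of the
-- `j` new entries completes one window and so adds at most one occurrence.
record Started {n m k} (W : Word n m) (j : ℕ) (x : ColouredPerm k) : Set where
  field
    word    : Word n (j ℕ.+ m)
    rainbow : Rainbow word
    matches : Matches word m j x
    lower   : ∀ {k′} (π : Permutation′ (suc k′)) → occurrences π W ℕ.≤ occurrences π word
    upper   : ∀ {k′} (π : Permutation′ (suc k′)) → occurrences π word ℕ.≤ j ℕ.+ occurrences π W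

started : ∀ {n m k} (W : Word n m) → Rainbow W → {x : ColouredPerm k} → Consistent n x →
          ∀ j → j ℕ.≤ k → Started W j x
started W rb {x} cons zero    _   = record
  { word = W ; rainbow = rb ; matches = matches-0 W _ x ; lower = λ _ → ℕ.≤-refl ; upper = λ _ → ℕ.≤-refl }
started {m = m} W rb {x} cons (suc j) j<k = next (started W rb cons j (ℕ.<⇒≤ j<k))
  where
  next : Started W j x → Started W (suc j) x
  next S = record
    { word = E.word ; rainbow = E.rainbow ; matches = E.matches
    ; lower = λ π → ℕ.≤-trans (S.lower π) (ℕ.≤-trans (ℕ.m≤m+n _ _) (ℕ.≤-reflexive (sym (occurrences-snoc E.extends π))))
    ; upper = λ π → ℕ.≤-trans (ℕ.≤-reflexive (trans (occurrences-snoc E.extends π) (ℕ.+-comm (occurrences π S.word) _)))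
        (ℕ.+-mono-≤ (indicator≤1 (occursAt? π (toPerm E.word) _)) (S.upper π))
    }
    where
    module S = Started S
    module E = Extended (extended S.word (ℕ.+-comm j m) S.rainbow cons j<k S.matches)

opaque
  consistent⇒inherited : ∀ {n k} → 2 ℕ.≤ n → (x : ColouredPerm k) → Consistent n x → IsInherited n x
  consistent⇒inherited {n} {k} 2≤n x cons = consistent⇒avoids 1≤n cons ,
    -- The `n - 1` initial entries keep the size positive even for `k = 0`, the case of the vertices
    -- of the graph for windows of length 1.
    toAv word 1≤n (ℕ.≤-trans (ℕ.∸-monoˡ-≤ 1 2≤n) (ℕ.m≤n+m _ k)) , ℕ.m≤m+n k _ ,
    le , matches⇒colouredPattern word le (subst (λ p → Matches word p k x) (sym (ℕ.m+n∸m≡n k (n ∸ 1))) matches)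
    where
    1≤n : 1 ℕ.≤ n
    1≤n = ℕ.<⇒≤ 2≤n
    open Started (started (bars 1≤n) (bars-rainbow 1≤n) cons k ℕ.≤-refl)
    le : (k ℕ.+ (n ∸ 1) ∸ k) ℕ.+ k ℕ.≤ k ℕ.+ (n ∸ 1)
    le = ℕ.≤-reflexive (ℕ.m∸n+n≡m (ℕ.m≤m+n k _))

  inherited⇒consistent : ∀ {n k} → 1 ℕ.≤ n → (x : ColouredPerm k) → IsInherited n x → Consistent n x
  inherited⇒consistent 1≤n x (_ , σ , _ , le , pat) = window-consistent (ℂ-greedy (perm σ))
    (avoids⇒colours< (ℂ-greedy (perm σ)) 1≤n (avoids σ)) le pat

inherited? : ∀ {n k} → 2 ℕ.≤ n → (x : ColouredPerm k) → Dec (IsInherited n x)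
inherited? {n} 2≤n x = map′ (consistent⇒inherited 2≤n x) (inherited⇒consistent (ℕ.<⇒≤ 2≤n) x) (consistent? n x)

-- Words following closed walks

hits : ∀ {k} → Permutation′ k → (ℕ → ColouredPerm k) → ℕ → ℕ
hits π E zero    = 0
hits π E (suc u) = hits π E u ℕ.+ indicator (π ≟ₚ proj₁ (E u))

-- Entering the walk takes `suc k′` entries; the first `k′` of them complete windows of unknown
-- pattern, hence `k′` in `upper`. The last one completes `E 0`, and each further edge costs one
-- entry and adds one known window, so `suc u` windows are counted.
record Run {n m k′} (W : Word n m) (E : ℕ → ColouredPerm (suc k′)) (u : ℕ) : Set where
  field
    word    : Word n (u ℕ.+ (suc k′ ℕ.+ m))
    rainbow : Rainbow word
    matches : Matches word (u ℕ.+ m) (suc k′) (E u)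
    lower   : ∀ π → hits π E (suc u) ℕ.+ occurrences π W ℕ.≤ occurrences π word
    upper   : ∀ π → occurrences π word ℕ.≤ hits π E (suc u) ℕ.+ (k′ ℕ.+ occurrences π W)

occurrences-last : ∀ {n m k′} {W : Word n m} {W′ : Word n (suc m)} {e : ColouredPerm (suc k′)} → W ≼ W′ →
  ∀ {p} → suc m ≡ p ℕ.+ suc k′ → Matches W′ p (suc k′) e → (π : Permutation′ (suc k′)) →
  occurrences π W′ ≡ indicator (π ≟ₚ proj₁ e) ℕ.+ occurrences π W
occurrences-last {m = m} {k′} {W} {W′} {e} W≼W′ {p} eq M π = begin
  occurrences π W′                                                   ≡⟨ occurrences-snoc W≼W′ π ⟩
  occurrences π W ℕ.+ indicator (occursAt? π (toPerm W′) (m ∸ k′))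
    ≡⟨ cong (λ i → occurrences π W ℕ.+ indicator (occursAt? π (toPerm W′) i)) p≡ ⟩
  occurrences π W ℕ.+ indicator (occursAt? π (toPerm W′) p)
    ≡⟨ cong (occurrences π W ℕ.+_) (occursAt-indicator π (proj₁ e) (toPerm W′) p le (matches⇒pattern W′ le M)) ⟩
  occurrences π W ℕ.+ indicator (π ≟ₚ proj₁ e)                       ≡⟨ ℕ.+-comm (occurrences π W) _ ⟩
  indicator (π ≟ₚ proj₁ e) ℕ.+ occurrences π W                       ∎
  where
  open ≡-Reasoning
  p≡ : m ∸ k′ ≡ p
  p≡ = trans (cong (_∸ suc k′) eq) (ℕ.m+n∸n≡m p (suc k′))
  le : p ℕ.+ suc k′ ℕ.≤ suc m
  le = ℕ.≤-reflexive (sym eq)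

module _ {n m k′} (W : Word n m) (rb : Rainbow W) (E : ℕ → ColouredPerm (suc k′))
         (cons : ∀ t → Consistent n (E t)) (linked : ∀ t → Linked (E t) (E (suc t))) where

  private
    first : Started W k′ (E 0) → Run W E 0
    first S = record
      { word = X.word ; rainbow = X.rainbow ; matches = X.matches
      ; lower = λ π → ℕ.≤-trans (ℕ.+-monoʳ-≤ (hits π E 1) (S.lower π)) (ℕ.≤-reflexive (sym (last π)))
      ; upper = λ π → ℕ.≤-trans (ℕ.≤-reflexive (last π)) (ℕ.+-monoʳ-≤ (hits π E 1) (S.upper π))
      }
      where
      module S = Started S
      module X = Extended (extended S.word (ℕ.+-comm k′ m) S.rainbow (cons 0) (ℕ.n<1+n k′) S.matches)
      last : ∀ π → occurrences π X.word ≡ hits π E 1 ℕ.+ occurrences π S.word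
      last = occurrences-last X.extends (ℕ.+-comm (suc k′) m) X.matches

    next : ∀ u → Run W E u → Run W E (suc u)
    next u R = record
      { word = X.word ; rainbow = X.rainbow ; matches = X.matches
      ; lower = λ π → ℕ.≤-trans (ℕ.≤-reflexive (swap (hits π E (suc u)) (hit π) _))
          (ℕ.≤-trans (ℕ.+-monoʳ-≤ (hit π) (R.lower π)) (ℕ.≤-reflexive (sym (last π))))
      ; upper = λ π → ℕ.≤-trans (ℕ.≤-reflexive (last π))
          (ℕ.≤-trans (ℕ.+-monoʳ-≤ (hit π) (R.upper π)) (ℕ.≤-reflexive (sym (swap (hits π E (suc u)) (hit π) _))))
      }
      where
      module R = Run R
      hit : Permutation′ (suc k′) → ℕ
      hit π = indicator (π ≟ₚ proj₁ (E (suc u)))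
      split : ∀ u k′ m → u ℕ.+ (suc k′ ℕ.+ m) ≡ suc (u ℕ.+ m) ℕ.+ k′
      split = solve-∀
      split′ : ∀ u k′ m → suc (u ℕ.+ (suc k′ ℕ.+ m)) ≡ suc (u ℕ.+ m) ℕ.+ suc k′
      split′ = solve-∀
      swap : ∀ a b c → a ℕ.+ b ℕ.+ c ≡ b ℕ.+ (a ℕ.+ c)
      swap = solve-∀
      module X = Extended (extended R.word (split u k′ m) R.rainbow (cons (suc u)) (ℕ.n<1+n k′) (shift-matches (linked u) R.matches))
      last : ∀ π → occurrences π X.word ≡ hit π ℕ.+ occurrences π R.word
      last = occurrences-last X.extends (split′ u k′ m) X.matches

  run : ∀ u → Run W E u
  run zero    = first (started W rb (cons 0) k′ (ℕ.n≤1+n k′))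
  run (suc u) = next u (run u)

total : ∀ {r} → Vector ℕ r → ℕ
total = Vector.foldr ℕ._+_ 0

-- Each walk contributes `suc k′` entries before its `u i` further steps. `Run` counts one hit more
-- than `hits π (E i) (u i)`; the surplus and the `k′` unknown windows together are the `suc k′` in
-- `upper`, and `n ∸ 1` accounts for the initial word.
record Concatenation (n : ℕ) {r k′} (E : Fin r → ℕ → ColouredPerm (suc k′)) (u : Fin r → ℕ) : Set where
  field
    size    : ℕ
    size≡   : size ≡ total (λ i → u i ℕ.+ suc k′) ℕ.+ (n ∸ 1)
    word    : Word n size
    rainbow : Rainbow word
    lower   : ∀ π → total (λ i → hits π (E i) (u i)) ℕ.≤ occurrences π word
    upper   : ∀ π → occurrences π word ℕ.≤ total (λ i → hits π (E i) (u i) ℕ.+ suc k′) ℕ.+ (n ∸ 1)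

concatenation : ∀ {n r k′} → 1 ℕ.≤ n → (E : Fin r → ℕ → ColouredPerm (suc k′)) →
  (∀ i t → Consistent n (E i t)) → (∀ i t → Linked (E i t) (E i (suc t))) →
  (u : Fin r → ℕ) → Concatenation n E u
concatenation {n} {zero} 1≤n E cons linked u = record
  { size    = n ∸ 1
  ; size≡   = refl
  ; word    = bars 1≤n
  ; rainbow = bars-rainbow 1≤n
  ; lower   = λ _ → z≤n
  ; upper   = λ π → ℕ.≤-trans (ℕ.≤-reflexive (occurrences≡count π (bars 1≤n)))
      (ℕ.≤-trans (List.length-filter _ (List.upTo (n ∸ 1))) (ℕ.≤-reflexive (List.length-upTo (n ∸ 1))))
  }
concatenation {n} {suc r} {k′} 1≤n E cons linked u = record
  { size    = u₀ ℕ.+ (suc k′ ℕ.+ C.size)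
  ; size≡   = trans (cong (λ s → u₀ ℕ.+ (suc k′ ℕ.+ s)) C.size≡) (assoc u₀ (suc k′) _ (n ∸ 1))
  ; word    = R.word
  ; rainbow = R.rainbow
  ; lower   = λ π → ℕ.≤-trans (ℕ.+-mono-≤ (ℕ.m≤m+n (hits π E₀ u₀) _) (C.lower π)) (R.lower π)
  ; upper   = λ π → ℕ.≤-trans (R.upper π) (ℕ.≤-trans
      (ℕ.+-mono-≤ (ℕ.+-monoʳ-≤ (hits π E₀ u₀) (indicator≤1 (π ≟ₚ proj₁ (E₀ u₀)))) (ℕ.+-monoʳ-≤ k′ (C.upper π)))
      (ℕ.≤-reflexive (reorder (hits π E₀ u₀) k′ _ (n ∸ 1))))
  }
  where
  E₀ = E zero
  u₀ = u zero
  module C = Concatenation (concatenation 1≤n (E ∘ suc) (cons ∘ suc) (linked ∘ suc) (u ∘ suc))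
  module R = Run (run C.word C.rainbow E₀ (cons zero) (linked zero) u₀)
  assoc : ∀ a b c d → a ℕ.+ (b ℕ.+ (c ℕ.+ d)) ≡ a ℕ.+ b ℕ.+ c ℕ.+ d
  assoc = solve-∀
  reorder : ∀ h k′ t d → h ℕ.+ 1 ℕ.+ (k′ ℕ.+ (t ℕ.+ d)) ≡ h ℕ.+ suc k′ ℕ.+ t ℕ.+ d
  reorder = solve-∀

-- Null sequences and Fourier–Motzkin elimination over Cauchy sequences

infix 4 _≋_
-- For real numbers, `x ≈ y` unfolds to `approx x ≋ approx y`, so the lemmas below serve both for
-- equality of reals and for limits of rational sequences.
_≋_ : (ℕ → ℚ) → (ℕ → ℚ) → Set
a ≋ b = ∀ ε → 0ℚ ℚ.< ε → ∃[ N ] ∀ n → N ℕ.≤ n → ℚ.∣ a n ℚ.- b n ∣ ℚ.≤ ε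

0≤q-p : ∀ {p q} → p ℚ.≤ q → 0ℚ ℚ.≤ q ℚ.- p
0≤q-p {p} {q} p≤q = subst (ℚ._≤ q ℚ.- p) (ℚ.+-inverseʳ p) (ℚ.+-monoˡ-≤ (ℚ.- p) p≤q)

p≤q-by : ∀ {p q} → 0ℚ ℚ.≤ q ℚ.- p → p ℚ.≤ q
p≤q-by {p} {q} 0≤ = subst₂ ℚ._≤_ (ℚ.+-identityˡ p) (cancel q p) (ℚ.+-monoˡ-≤ p 0≤)
  where
  cancel : ∀ q p → q ℚ.- p ℚ.+ p ≡ q
  cancel = solve 2 (λ q p → q :- p :+ p := q) refl where open ℚ.+-*-Solver

dist≤ : ∀ {x y ε} → x ℚ.≤ y ℚ.+ ε → y ℚ.≤ x ℚ.+ ε → ℚ.∣ x ℚ.- y ∣ ℚ.≤ ε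
dist≤ {x} {y} {ε} x≤ y≤ with ℚ.∣p∣≡p∨∣p∣≡-p (x ℚ.- y)
... | inj₁ eq rewrite eq = p≤q-by (subst (0ℚ ℚ.≤_) (move x y ε) (0≤q-p x≤))
  where
  move : ∀ x y ε → y ℚ.+ ε ℚ.- x ≡ ε ℚ.- (x ℚ.- y)
  move = solve 3 (λ x y ε → y :+ ε :- x := ε :- (x :- y)) refl where open ℚ.+-*-Solver
... | inj₂ eq rewrite eq = p≤q-by (subst (0ℚ ℚ.≤_) (move x y ε) (0≤q-p y≤))
  where
  move : ∀ x y ε → x ℚ.+ ε ℚ.- y ≡ ε ℚ.- (ℚ.- (x ℚ.- y))
  move = solve 3 (λ x y ε → x :+ ε :- y := ε :- (:- (x :- y))) refl where open ℚ.+-*-Solver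

p≤∣p∣ : ∀ p → p ℚ.≤ ℚ.∣ p ∣
p≤∣p∣ p with ℚ.≤-total 0ℚ p
... | inj₁ 0≤p = ℚ.≤-reflexive (sym (ℚ.0≤p⇒∣p∣≡p 0≤p))
... | inj₂ p≤0 = ℚ.≤-trans p≤0 (ℚ.0≤∣p∣ p)

dist-sym : ∀ x y → ℚ.∣ x ℚ.- y ∣ ≡ ℚ.∣ y ℚ.- x ∣
dist-sym x y = trans (cong ℚ.∣_∣ (flip x y)) (ℚ.∣-p∣≡∣p∣ (y ℚ.- x))
  where
  flip : ∀ x y → x ℚ.- y ≡ ℚ.- (y ℚ.- x)
  flip = solve 2 (λ x y → x :- y := :- (y :- x)) refl where open ℚ.+-*-Solver

dist≤⇒≤ : ∀ {x y ε} → ℚ.∣ x ℚ.- y ∣ ℚ.≤ ε → x ℚ.≤ y ℚ.+ ε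
dist≤⇒≤ {x} {y} {ε} d = p≤q-by (subst (0ℚ ℚ.≤_) (move x y ε) (0≤q-p (ℚ.≤-trans (p≤∣p∣ (x ℚ.- y)) d)))
  where
  move : ∀ x y ε → ε ℚ.- (x ℚ.- y) ≡ y ℚ.+ ε ℚ.- x
  move = solve 3 (λ x y ε → ε :- (x :- y) := y :+ ε :- x) refl where open ℚ.+-*-Solver

dist-triangle : ∀ x y z {δ ε} → ℚ.∣ x ℚ.- y ∣ ℚ.≤ δ → ℚ.∣ y ℚ.- z ∣ ℚ.≤ ε → ℚ.∣ x ℚ.- z ∣ ℚ.≤ δ ℚ.+ ε
dist-triangle x y z {δ} {ε} xy yz = begin
  ℚ.∣ x ℚ.- z ∣                        ≡⟨ cong ℚ.∣_∣ (insert x y z) ⟩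
  ℚ.∣ (x ℚ.- y) ℚ.+ (y ℚ.- z) ∣        ≤⟨ ℚ.∣p+q∣≤∣p∣+∣q∣ (x ℚ.- y) (y ℚ.- z) ⟩
  ℚ.∣ x ℚ.- y ∣ ℚ.+ ℚ.∣ y ℚ.- z ∣      ≤⟨ ℚ.+-mono-≤ xy yz ⟩
  δ ℚ.+ ε                              ∎
  where
  open ℚ.≤-Reasoning
  insert : ∀ x y z → x ℚ.- z ≡ (x ℚ.- y) ℚ.+ (y ℚ.- z)
  insert = solve 3 (λ x y z → x :- z := (x :- y) :+ (y :- z)) refl where open ℚ.+-*-Solver

½-pos : ∀ {ε} → 0ℚ ℚ.< ε → 0ℚ ℚ.< ½ ℚ.* ε
½-pos 0<ε = ℚ.*-monoʳ-<-pos ½ 0<ε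

½+½ : ∀ ε → ½ ℚ.* ε ℚ.+ ½ ℚ.* ε ≡ ε
½+½ ε = trans (sym (ℚ.*-distribʳ-+ ε ½ ½)) (ℚ.*-identityˡ ε)

≋-≡ : ∀ {a b} → a ≗ b → a ≋ b
≋-≡ {a} {b} a≗b ε 0<ε = 0 , λ n _ → ℚ.≤-trans
  (ℚ.≤-reflexive (cong ℚ.∣_∣ (trans (cong (ℚ._- b n) (a≗b n)) (ℚ.+-inverseʳ (b n))))) (ℚ.<⇒≤ 0<ε)

≋-sym : ∀ {a b} → a ≋ b → b ≋ a
≋-sym {a} {b} a≋b ε 0<ε with a≋b ε 0<ε
... | N , close = N , λ n N≤n → subst (ℚ._≤ ε) (dist-sym (a n) (b n)) (close n N≤n)

≋-trans : ∀ {a b c} → a ≋ b → b ≋ c → a ≋ c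
≋-trans {a} {b} {c} a≋b b≋c ε 0<ε with a≋b (½ ℚ.* ε) (½-pos 0<ε) | b≋c (½ ℚ.* ε) (½-pos 0<ε)
... | N₁ , h₁ | N₂ , h₂ = N₁ ℕ.⊔ N₂ , λ n N≤n → subst (ℚ.∣ a n ℚ.- c n ∣ ℚ.≤_) (½+½ ε)
  (dist-triangle (a n) (b n) (c n) (h₁ n (ℕ.m⊔n≤o⇒m≤o N₁ N₂ N≤n)) (h₂ n (ℕ.m⊔n≤o⇒n≤o N₁ N₂ N≤n)))

≋-+ : ∀ {a b c d} → a ≋ b → c ≋ d → (λ n → a n ℚ.+ c n) ≋ (λ n → b n ℚ.+ d n)
≋-+ {a} {b} {c} {d} a≋b c≋d ε 0<ε with a≋b (½ ℚ.* ε) (½-pos 0<ε) | c≋d (½ ℚ.* ε) (½-pos 0<ε)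
... | N₁ , h₁ | N₂ , h₂ = N₁ ℕ.⊔ N₂ , λ n N≤n → begin
  ℚ.∣ (a n ℚ.+ c n) ℚ.- (b n ℚ.+ d n) ∣          ≡⟨ cong ℚ.∣_∣ (regroup (a n) (b n) (c n) (d n)) ⟩
  ℚ.∣ (a n ℚ.- b n) ℚ.+ (c n ℚ.- d n) ∣          ≤⟨ ℚ.∣p+q∣≤∣p∣+∣q∣ (a n ℚ.- b n) (c n ℚ.- d n) ⟩
  ℚ.∣ a n ℚ.- b n ∣ ℚ.+ ℚ.∣ c n ℚ.- d n ∣
    ≤⟨ ℚ.+-mono-≤ (h₁ n (ℕ.m⊔n≤o⇒m≤o N₁ N₂ N≤n)) (h₂ n (ℕ.m⊔n≤o⇒n≤o N₁ N₂ N≤n)) ⟩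
  ½ ℚ.* ε ℚ.+ ½ ℚ.* ε                            ≡⟨ ½+½ ε ⟩
  ε                                              ∎
  where
  open ℚ.≤-Reasoning
  regroup : ∀ a b c d → (a ℚ.+ c) ℚ.- (b ℚ.+ d) ≡ (a ℚ.- b) ℚ.+ (c ℚ.- d)
  regroup = solve 4 (λ a b c d → (a :+ c) :- (b :+ d) := (a :- b) :+ (c :- d)) refl where open ℚ.+-*-Solver

cauchy-resp : ∀ {a} (x : ℝ) → a ≋ approx x →
  ∀ ε → 0ℚ ℚ.< ε → ∃[ N ] ∀ m n → N ℕ.≤ m → N ℕ.≤ n → ℚ.∣ a m ℚ.- a n ∣ ℚ.≤ ε
cauchy-resp {a} x a≋x ε 0<ε
  with a≋x (½ ℚ.* (½ ℚ.* ε)) (½-pos (½-pos 0<ε)) | cauchy x (½ ℚ.* ε) (½-pos 0<ε)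
... | N₁ , h₁ | N₂ , h₂ = N₁ ℕ.⊔ N₂ , λ m n N≤m N≤n →
  subst (ℚ.∣ a m ℚ.- a n ∣ ℚ.≤_) (quarters ε)
    (dist-triangle (a m) (approx x m) (a n) (h₁ m (ℕ.m⊔n≤o⇒m≤o N₁ N₂ N≤m))
      (dist-triangle (approx x m) (approx x n) (a n)
        (h₂ m n (ℕ.m⊔n≤o⇒n≤o N₁ N₂ N≤m) (ℕ.m⊔n≤o⇒n≤o N₁ N₂ N≤n))
        (subst (ℚ._≤ ½ ℚ.* (½ ℚ.* ε)) (dist-sym (a n) (approx x n)) (h₁ n (ℕ.m⊔n≤o⇒m≤o N₁ N₂ N≤n)))))
  where
  reorder : ∀ q h → q ℚ.+ (h ℚ.+ q) ≡ (q ℚ.+ q) ℚ.+ h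
  reorder = solve 2 (λ q h → q :+ (h :+ q) := (q :+ q) :+ h) refl where open ℚ.+-*-Solver
  quarters : ∀ ε → ½ ℚ.* (½ ℚ.* ε) ℚ.+ (½ ℚ.* ε ℚ.+ ½ ℚ.* (½ ℚ.* ε)) ≡ ε
  quarters ε = trans (reorder (½ ℚ.* (½ ℚ.* ε)) (½ ℚ.* ε)) (trans (cong (ℚ._+ ½ ℚ.* ε) (½+½ (½ ℚ.* ε))) (½+½ ε))

-- The index of the sequence and that of the approximations to the limit are made to coincide: `a i`
-- is compared with a late term of `x`, and the Cauchy property leads from there back to term `i`.
-- Half of `ε` goes to each comparison, the first half being shared by `⟶` and `≤`.
tends⇒≋ : ∀ {a x} → (λ i → fromℚ (a i)) ⟶ x → a ≋ approx x
tends⇒≋ {a} {x} a⟶x ε 0<ε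
  with a⟶x (½ ℚ.* (½ ℚ.* ε)) (½-pos (½-pos 0<ε)) | cauchy x (½ ℚ.* ε) (½-pos 0<ε)
... | N₁ , h₁ | N₂ , h₂ = N₁ ℕ.⊔ N₂ , close
  where
  q = ½ ℚ.* (½ ℚ.* ε)
  close : ∀ i → N₁ ℕ.⊔ N₂ ℕ.≤ i → ℚ.∣ a i ℚ.- approx x i ∣ ℚ.≤ ε
  close i N≤i with proj₁ (h₁ i (ℕ.m⊔n≤o⇒m≤o N₁ N₂ N≤i)) q (½-pos (½-pos 0<ε)) | proj₂ (h₁ i (ℕ.m⊔n≤o⇒m≤o N₁ N₂ N≤i)) q (½-pos (½-pos 0<ε))
  ... | M₁ , g₁ | M₂ , g₂ = subst (ℚ.∣ a i ℚ.- approx x i ∣ ℚ.≤_) (½+½ ε)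
    (dist-triangle (a i) (approx x n) (approx x i)
      (dist≤ (subst (λ t → a i ℚ.≤ approx x n ℚ.+ t) (½+½ (½ ℚ.* ε)) (subst (a i ℚ.≤_) (ℚ.+-assoc (approx x n) q q) (g₁ n M₁≤n)))
             (subst (λ t → approx x n ℚ.≤ a i ℚ.+ t) (½+½ (½ ℚ.* ε)) (subst (approx x n ℚ.≤_) (ℚ.+-assoc (a i) q q) (g₂ n M₂≤n))))
      (h₂ n i N₂≤n (ℕ.m⊔n≤o⇒n≤o N₁ N₂ N≤i)))
    where
    n = M₁ ℕ.⊔ M₂ ℕ.⊔ N₂
    M₁≤n = ℕ.≤-trans (ℕ.m≤m⊔n M₁ M₂) (ℕ.m≤m⊔n (M₁ ℕ.⊔ M₂) N₂)
    M₂≤n = ℕ.≤-trans (ℕ.m≤n⊔m M₁ M₂) (ℕ.m≤m⊔n (M₁ ℕ.⊔ M₂) N₂)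
    N₂≤n = ℕ.m≤n⊔m (M₁ ℕ.⊔ M₂) N₂

≋⇒tends : ∀ {a} x → a ≋ approx x → (λ i → fromℚ (a i)) ⟶ x
≋⇒tends {a} x a≋x ε 0<ε with a≋x (½ ℚ.* ε) (½-pos 0<ε) | cauchy x (½ ℚ.* ε) (½-pos 0<ε)
... | N₁ , h₁ | N₂ , h₂ = N₁ ℕ.⊔ N₂ , λ i N≤i →
  (λ ε′ 0<ε′ → N₂ , λ n N₂≤n → weaken 0<ε′ (dist≤⇒≤ (close i n N≤i N₂≤n))) ,
  (λ ε′ 0<ε′ → N₂ , λ n N₂≤n → weaken 0<ε′ (dist≤⇒≤ (subst (ℚ._≤ ε) (dist-sym (a i) (approx x n)) (close i n N≤i N₂≤n))))
  where
  close : ∀ i n → N₁ ℕ.⊔ N₂ ℕ.≤ i → N₂ ℕ.≤ n → ℚ.∣ a i ℚ.- approx x n ∣ ℚ.≤ ε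
  close i n N≤i N₂≤n = subst (ℚ.∣ a i ℚ.- approx x n ∣ ℚ.≤_) (½+½ ε)
    (dist-triangle (a i) (approx x i) (approx x n) (h₁ i (ℕ.m⊔n≤o⇒m≤o N₁ N₂ N≤i))
                   (h₂ i n (ℕ.m⊔n≤o⇒n≤o N₁ N₂ N≤i) N₂≤n))
  weaken : ∀ {p q ε′} → 0ℚ ℚ.< ε′ → p ℚ.≤ q → p ℚ.≤ q ℚ.+ ε′
  weaken {p} {q} 0<ε′ p≤q = ℚ.≤-trans p≤q (subst (ℚ._≤ q ℚ.+ _) (ℚ.+-identityʳ q) (ℚ.+-monoʳ-≤ q (ℚ.<⇒≤ 0<ε′)))

-- Finite sums, maxima and minima, affine forms

∑ℚ : ∀ {r} → Vector ℚ r → ℚ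
∑ℚ = Vector.foldr ℚ._+_ 0ℚ

approx-∑ : ∀ {r} (x : Vector ℝ r) n → approx (∑ x) n ≡ ∑ℚ (λ i → approx (x i) n)
approx-∑ {zero}  x n = refl
approx-∑ {suc r} x n = cong (approx (x zero) n ℚ.+_) (approx-∑ (x ∘ suc) n)

∑ℚ-cong : ∀ {r} {a b : Vector ℚ r} → a ≗ b → ∑ℚ a ≡ ∑ℚ b
∑ℚ-cong {zero}  a≗b = refl
∑ℚ-cong {suc r} a≗b = cong₂ ℚ._+_ (a≗b zero) (∑ℚ-cong (a≗b ∘ suc))

∑ℚ-*ˡ : ∀ {r} q (a : Vector ℚ r) → ∑ℚ (λ i → q ℚ.* a i) ≡ q ℚ.* ∑ℚ a
∑ℚ-*ˡ {zero}  q a = sym (ℚ.*-zeroʳ q)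
∑ℚ-*ˡ {suc r} q a = trans (cong (q ℚ.* a zero ℚ.+_) (∑ℚ-*ˡ q (a ∘ suc))) (sym (ℚ.*-distribˡ-+ q _ _))

∑ℚ-+ : ∀ {r} (a b : Vector ℚ r) → ∑ℚ (λ i → a i ℚ.+ b i) ≡ ∑ℚ a ℚ.+ ∑ℚ b
∑ℚ-+ {zero}  a b = refl
∑ℚ-+ {suc r} a b = trans (cong (a zero ℚ.+ b zero ℚ.+_) (∑ℚ-+ (a ∘ suc) (b ∘ suc)))
  (swap (a zero) (b zero) _ _)
  where
  swap : ∀ p q s t → p ℚ.+ q ℚ.+ (s ℚ.+ t) ≡ p ℚ.+ s ℚ.+ (q ℚ.+ t)
  swap = solve 4 (λ p q s t → p :+ q :+ (s :+ t) := p :+ s :+ (q :+ t)) refl where open ℚ.+-*-Solver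

-- The hypothesis, used in both directions, makes `op` nonexpansive for the maximum distance;
-- termwise application then preserves Cauchy sequences with the later of the two moduli.
lift₂ : (op : ℚ → ℚ → ℚ) →
        (∀ {a b c d ε} → a ℚ.≤ c ℚ.+ ε → b ℚ.≤ d ℚ.+ ε → op a b ℚ.≤ op c d ℚ.+ ε) → ℝ → ℝ → ℝ
lift₂ op nonexpansive x y = mkℝ (λ n → op (approx x n) (approx y n)) isCauchy
  where
  isCauchy : ∀ ε → 0ℚ ℚ.< ε → ∃[ N ] ∀ m n → N ℕ.≤ m → N ℕ.≤ n →
             ℚ.∣ op (approx x m) (approx y m) ℚ.- op (approx x n) (approx y n) ∣ ℚ.≤ ε
  isCauchy ε 0<ε with cauchy x ε 0<ε | cauchy y ε 0<ε
  ... | N₁ , h₁ | N₂ , h₂ = N₁ ℕ.⊔ N₂ , λ m n N≤m N≤n → dist≤ (half m n N≤m N≤n) (half n m N≤n N≤m)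
    where
    half : ∀ m n → N₁ ℕ.⊔ N₂ ℕ.≤ m → N₁ ℕ.⊔ N₂ ℕ.≤ n →
           op (approx x m) (approx y m) ℚ.≤ op (approx x n) (approx y n) ℚ.+ ε
    half m n N≤m N≤n = nonexpansive
      (dist≤⇒≤ (h₁ m n (ℕ.m⊔n≤o⇒m≤o N₁ N₂ N≤m) (ℕ.m⊔n≤o⇒m≤o N₁ N₂ N≤n)))
      (dist≤⇒≤ (h₂ m n (ℕ.m⊔n≤o⇒n≤o N₁ N₂ N≤m) (ℕ.m⊔n≤o⇒n≤o N₁ N₂ N≤n)))

infixr 6 _⊔_ _⊓_
_⊔_ _⊓_ : ℝ → ℝ → ℝ
_⊔_ = lift₂ ℚ._⊔_ λ {a} {b} {c} {d} {ε} a≤ b≤ → ℚ.⊔-lub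
  (ℚ.≤-trans a≤ (ℚ.+-monoˡ-≤ ε (ℚ.p≤p⊔q c d))) (ℚ.≤-trans b≤ (ℚ.+-monoˡ-≤ ε (ℚ.p≤q⊔p c d)))
_⊓_ = lift₂ ℚ._⊓_ λ {a} {b} {c} {d} {ε} a≤ b≤ → subst (a ℚ.⊓ b ℚ.≤_) (sym (ℚ.mono-≤-distrib-⊓ (ℚ.+-monoˡ-≤ ε) c d))
  (ℚ.⊓-glb (ℚ.≤-trans (ℚ.p⊓q≤p a b) a≤) (ℚ.≤-trans (ℚ.p⊓q≤q a b) b≤))

-- An affine form in r rational unknowns whose constant term is a Cauchy
-- sequence, evaluated at the n-th term of that sequence.
Form : ℕ → Set
Form r = Vector ℚ r × ℝ

opaque
  value : ∀ {r} → Form r → Vector ℚ r → ℕ → ℚ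
  value (c , β) w n = ∑ℚ (λ i → c i ℚ.* w i) ℚ.+ approx β n

  value≡ : ∀ {r} c β (w : Vector ℚ r) n → value (c , β) w n ≡ ∑ℚ (λ i → c i ℚ.* w i) ℚ.+ approx β n
  value≡ c β w n = refl

Holds : ∀ {r} → Vector ℚ r → ℕ → Form r → Set
Holds w n F = 0ℚ ℚ.≤ value F w n

realValue : ∀ {r} → Form r → Vector ℝ r → ℝ
realValue (c , β) w = ∑ (λ i → fromℚ (c i) * w i) + β

opaque
  unfolding value

  approx-realValue : ∀ {r} (F : Form r) w n → approx (realValue F w) n ≡ value F (λ i → approx (w i) n) n
  approx-realValue (c , β) w n = cong (ℚ._+ approx β n) (approx-∑ (λ i → fromℚ (c i) * w i) n)

scale : ∀ {r} → ℚ → Form r → Form r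
scale q (c , β) = (λ i → q ℚ.* c i) , fromℚ q * β

opaque
  unfolding value

  value-scale : ∀ {r} q (F : Form r) w n → value (scale q F) w n ≡ q ℚ.* value F w n
  value-scale q (c , β) w n = trans
    (cong (ℚ._+ q ℚ.* approx β n) (trans (∑ℚ-cong λ i → ℚ.*-assoc q (c i) (w i)) (∑ℚ-*ˡ q (λ i → c i ℚ.* w i))))
    (sym (ℚ.*-distribˡ-+ q _ _))

add : ∀ {r} → Form r → Form r → Form r
add (c , β) (d , γ) = (λ i → c i ℚ.+ d i) , β + γ

opaque
  unfolding value

  value-add : ∀ {r} (F G : Form r) w n → value (add F G) w n ≡ value F w n ℚ.+ value G w n
  value-add (c , β) (d , γ) w n = trans
    (cong (ℚ._+ (approx β n ℚ.+ approx γ n))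
      (trans (∑ℚ-cong λ i → ℚ.*-distribʳ-+ (w i) (c i) (d i)) (∑ℚ-+ (λ i → c i ℚ.* w i) (λ i → d i ℚ.* w i))))
    (swap (∑ℚ λ i → c i ℚ.* w i) (∑ℚ λ i → d i ℚ.* w i) (approx β n) (approx γ n))
    where
    swap : ∀ p q s t → p ℚ.+ q ℚ.+ (s ℚ.+ t) ≡ p ℚ.+ s ℚ.+ (q ℚ.+ t)
    swap = solve 4 (λ p q s t → p :+ q :+ (s :+ t) := p :+ s :+ (q :+ t)) refl where open ℚ.+-*-Solver

gap : ∀ {r} → Form r → Form r → Form r
gap U L = add U (scale (ℚ.- 1ℚ) L)

value-gap : ∀ {r} (U L : Form r) w n → value (gap U L) w n ≡ value U w n ℚ.- value L w n
value-gap U L w n = trans (value-add U (scale (ℚ.- 1ℚ) L) w n)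
  (cong (value U w n ℚ.+_) (trans (value-scale (ℚ.- 1ℚ) L w n) (neg (value L w n))))
  where
  neg : ∀ p → ℚ.- 1ℚ ℚ.* p ≡ ℚ.- p
  neg = solve 1 (λ p → (:- con 1ℚ) :* p := :- p) refl where open ℚ.+-*-Solver

-- Eliminating the unknowns of a system of inequalities

*-nonNeg-cancel : ∀ {c t} → 0ℚ ℚ.< c → 0ℚ ℚ.≤ c ℚ.* t → 0ℚ ℚ.≤ t
*-nonNeg-cancel {c} {t} 0<c 0≤ct = ℚ.≮⇒≥ λ t<0 → ℚ.<-irrefl refl (ℚ.≤-<-trans 0≤ct
  (subst (c ℚ.* t ℚ.<_) (ℚ.*-zeroʳ c) (ℚ.*-monoʳ-<-pos c {{ℚ.positive 0<c}} t<0)))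

*-nonNeg : ∀ {c t} → 0ℚ ℚ.≤ c → 0ℚ ℚ.≤ t → 0ℚ ℚ.≤ c ℚ.* t
*-nonNeg {c} {t} 0≤c 0≤t = subst (ℚ._≤ c ℚ.* t) (ℚ.*-zeroʳ c) (ℚ.*-monoˡ-≤-nonNeg c {{ℚ.nonNegative 0≤c}} 0≤t)

-- The constraints 0 ≤ F of a system, solved for the first unknown.
record Split {r} (S : List (Form (suc r))) : Set where
  field
    lows ups rest : List (Form r)
    to   : ∀ w n → All (Holds w n) S →
           All (λ L → value L (w ∘ suc) n ℚ.≤ w zero) lows ×
           All (λ U → w zero ℚ.≤ value U (w ∘ suc) n) ups ×
           All (Holds (w ∘ suc) n) rest
    from : ∀ w n →
           All (λ L → value L (w ∘ suc) n ℚ.≤ w zero) lows →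
           All (λ U → w zero ℚ.≤ value U (w ∘ suc) n) ups →
           All (Holds (w ∘ suc) n) rest → All (Holds w n) S

module _ {r} (F : Form (suc r)) where
  private
    c₀ = proj₁ F zero
    tail : Form r
    tail = proj₁ F ∘ suc , proj₂ F

    opaque
      unfolding value

      value-suc : ∀ w n → value F w n ≡ c₀ ℚ.* w zero ℚ.+ value tail (w ∘ suc) n
      value-suc w n = ℚ.+-assoc (c₀ ℚ.* w zero) _ (approx (proj₂ F) n)

  module _ (c₀≢0 : c₀ ≢ 0ℚ) where
    private
      instance
        nz : ℚ.NonZero c₀
        nz = ℚ.≢-nonZero c₀≢0

    bound : Form r
    bound = scale (ℚ.- ℚ.1/ c₀) tail

    value-factor : ∀ w n → value F w n ≡ c₀ ℚ.* (w zero ℚ.- value bound (w ∘ suc) n)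
    value-factor w n = begin
      value F w n                                                   ≡⟨ value-suc w n ⟩
      c₀ ℚ.* w zero ℚ.+ t
        ≡⟨ cong (c₀ ℚ.* w zero ℚ.+_) (trans (cong (ℚ._* t) (ℚ.*-inverseʳ c₀)) (ℚ.*-identityˡ t)) ⟨
      c₀ ℚ.* w zero ℚ.+ c₀ ℚ.* (ℚ.1/ c₀) ℚ.* t                      ≡⟨ factor c₀ (w zero) (ℚ.1/ c₀) t ⟩
      c₀ ℚ.* (w zero ℚ.- (ℚ.- ℚ.1/ c₀) ℚ.* t)
        ≡⟨ cong (λ s → c₀ ℚ.* (w zero ℚ.- s)) (value-scale (ℚ.- ℚ.1/ c₀) tail (w ∘ suc) n) ⟨
      c₀ ℚ.* (w zero ℚ.- value bound (w ∘ suc) n)                   ∎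
      where
      open ≡-Reasoning
      t = value tail (w ∘ suc) n
      factor : ∀ c w i t → c ℚ.* w ℚ.+ c ℚ.* i ℚ.* t ≡ c ℚ.* (w ℚ.- (ℚ.- i) ℚ.* t)
      factor = solve 4 (λ c w i t → c :* w :+ c :* i :* t := c :* (w :- (:- i) :* t)) refl where open ℚ.+-*-Solver

    value-factor⁻ : ∀ w n → value F w n ≡ (ℚ.- c₀) ℚ.* (value bound (w ∘ suc) n ℚ.- w zero)
    value-factor⁻ w n = trans (value-factor w n) (flip c₀ (w zero) (value bound (w ∘ suc) n))
      where
      flip : ∀ c w b → c ℚ.* (w ℚ.- b) ≡ (ℚ.- c) ℚ.* (b ℚ.- w)
      flip = solve 3 (λ c w b → c :* (w :- b) := (:- c) :* (b :- w)) refl where open ℚ.+-*-Solver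

  -- The sign of the leading coefficient decides whether the constraint bounds the first unknown
  -- from below, from above, or not at all. It is a test on a rational, independent of `n`.
  split-∷ : ∀ {S} → Split S → Split (F ∷ S)
  split-∷ Sp with ℚ.<-cmp c₀ 0ℚ
  ... | tri< c₀<0 c₀≢0 _ = record
    { lows = Sp.lows ; ups = bound c₀≢0 ∷ Sp.ups ; rest = Sp.rest
    ; to   = λ { w n (h ∷ hs) → let l , u , r = Sp.to w n hs in
        l , p≤q-by (*-nonNeg-cancel 0<-c₀ (subst (0ℚ ℚ.≤_) (value-factor⁻ c₀≢0 w n) h)) ∷ u , r }
    ; from = λ { w n l (b ∷ u) r → subst (0ℚ ℚ.≤_) (sym (value-factor⁻ c₀≢0 w n))
        (*-nonNeg (ℚ.<⇒≤ 0<-c₀) (0≤q-p b)) ∷ Sp.from w n l u r } }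
    where
    module Sp = Split Sp
    0<-c₀ = ℚ.neg-antimono-< c₀<0
  ... | tri> _ c₀≢0 0<c₀ = record
    { lows = bound c₀≢0 ∷ Sp.lows ; ups = Sp.ups ; rest = Sp.rest
    ; to   = λ { w n (h ∷ hs) → let l , u , r = Sp.to w n hs in
        p≤q-by (*-nonNeg-cancel 0<c₀ (subst (0ℚ ℚ.≤_) (value-factor c₀≢0 w n) h)) ∷ l , u , r }
    ; from = λ { w n (b ∷ l) u r → subst (0ℚ ℚ.≤_) (sym (value-factor c₀≢0 w n))
        (*-nonNeg (ℚ.<⇒≤ 0<c₀) (0≤q-p b)) ∷ Sp.from w n l u r } }
    where module Sp = Split Sp
  ... | tri≈ _ c₀≡0 _ = record
    { lows = Sp.lows ; ups = Sp.ups ; rest = tail ∷ Sp.rest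
    ; to   = λ { w n (h ∷ hs) → let l , u , r = Sp.to w n hs in
        l , u , subst (0ℚ ℚ.≤_) (value-tail w n) h ∷ r }
    ; from = λ { w n l u (h ∷ r) → subst (0ℚ ℚ.≤_) (sym (value-tail w n)) h ∷ Sp.from w n l u r } }
    where
    module Sp = Split Sp
    value-tail : ∀ w n → value F w n ≡ value tail (w ∘ suc) n
    value-tail w n = trans (value-suc w n) (trans
      (cong (λ c → c ℚ.* w zero ℚ.+ value tail (w ∘ suc) n) c₀≡0)
      (trans (cong (ℚ._+ value tail (w ∘ suc) n) (ℚ.*-zeroˡ (w zero))) (ℚ.+-identityˡ _)))

splitSystem : ∀ {r} (S : List (Form (suc r))) → Split S
splitSystem []      = record { lows = [] ; ups = [] ; rest = [] ; to = λ _ _ _ → [] , [] , [] ; from = λ _ _ _ _ _ → [] }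
splitSystem (F ∷ S) = split-∷ F (splitSystem S)

-- The largest lower bound if there is one; otherwise a number below all upper bounds, for which
-- starting the minimum at `0ℝ` is harmless. The case distinction is on the lists and never compares
-- two reals.
between : List ℝ → List ℝ → ℝ
between []       us = List.foldr _⊓_ 0ℝ us
between (l ∷ ls) us = List.foldr _⊔_ l ls

between-spec : ∀ ls us n → All (λ l → All (λ u → approx l n ℚ.≤ approx u n) us) ls →
  All (λ l → approx l n ℚ.≤ approx (between ls us) n) ls × All (λ u → approx (between ls us) n ℚ.≤ approx u n) us
between-spec [] us n _ = [] , mins us
  where
  mins : ∀ us → All (λ u → approx (List.foldr _⊓_ 0ℝ us) n ℚ.≤ approx u n) us
  mins []       = []
  mins (u ∷ us) = ℚ.p⊓q≤p _ _ ∷ All.map (ℚ.≤-trans (ℚ.p⊓q≤q (approx u n) _)) (mins us)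
between-spec (l ∷ ls) us n (l≤ ∷ ls≤) = lower ls ∷ lowers ls , below ls ls≤
  where
  m : List ℝ → ℚ
  m ls = approx (List.foldr _⊔_ l ls) n
  lower : ∀ ls → approx l n ℚ.≤ m ls
  lower []        = ℚ.≤-refl
  lower (l′ ∷ ls) = ℚ.≤-trans (lower ls) (ℚ.p≤q⊔p (approx l′ n) (m ls))
  lowers : ∀ ls → All (λ l′ → approx l′ n ℚ.≤ m ls) ls
  lowers []        = []
  lowers (l′ ∷ ls) = ℚ.p≤p⊔q (approx l′ n) (m ls) ∷ All.map (λ le → ℚ.≤-trans le (ℚ.p≤q⊔p (approx l′ n) (m ls))) (lowers ls)
  below : ∀ ls → All (λ l → All (λ u → approx l n ℚ.≤ approx u n) us) ls → All (λ u → m ls ℚ.≤ approx u n) us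
  below []        []           = l≤
  below (l′ ∷ ls) (l′≤ ∷ ls≤) = All.zipWith (λ (p , q) → ℚ.⊔-lub p q) (l′≤ , below ls ls≤)

module _ {r} {S : List (Form (suc r))} (Sp : Split S) where
  open Split Sp

  gaps : List (Form r)
  gaps = List.concatMap (λ L → List.map (λ U → gap U L) ups) lows

  firstUnknown : Vector ℝ r → ℝ
  firstUnknown v = between (List.map (λ L → realValue L v) lows) (List.map (λ U → realValue U v) ups)

  gaps⁺ : ∀ n (u : Vector ℚ r) x → All (λ L → value L u n ℚ.≤ x) lows → All (λ U → x ℚ.≤ value U u n) ups →
          All (Holds u n) gaps
  gaps⁺ n u x l≤ ≤u = All.concat⁺ (All.map⁺ (All.map (λ {L} L≤x → All.map⁺ (All.map (λ {U} x≤U →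
    subst (0ℚ ℚ.≤_) (sym (value-gap U L u n)) (0≤q-p (ℚ.≤-trans L≤x x≤U))) ≤u)) l≤))

  gaps⁻ : ∀ n (u : Vector ℚ r) → All (Holds u n) gaps → All (λ L → All (λ U → value L u n ℚ.≤ value U u n) ups) lows
  gaps⁻ n u h = All.map (λ {L} hL → All.map (λ {U} g → p≤q-by (subst (0ℚ ℚ.≤_) (value-gap U L u n) g)) (All.map⁻ hL))
    (All.map⁻ (All.concat⁻ {xss = List.map (λ L → List.map (λ U → gap U L) ups) lows} h))

  firstUnknown-spec : ∀ v n → let vₙ = λ i → approx (v i) n in All (Holds vₙ n) gaps →
               All (λ L → value L vₙ n ℚ.≤ approx (firstUnknown v) n) lows × All (λ U → approx (firstUnknown v) n ℚ.≤ value U vₙ n) ups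
  firstUnknown-spec v n h =
    All.map (λ {L} L≤ → subst (ℚ._≤ approx (firstUnknown v) n) (approx-realValue L v n) L≤) (All.map⁻ (proj₁ spec)) ,
    All.map (λ {U} ≤U → subst (approx (firstUnknown v) n ℚ.≤_) (approx-realValue U v n) ≤U) (All.map⁻ (proj₂ spec))
    where
    spec : All (λ l → approx l n ℚ.≤ approx (firstUnknown v) n) (List.map (λ L → realValue L v) lows) ×
           All (λ u → approx (firstUnknown v) n ℚ.≤ approx u n) (List.map (λ U → realValue U v) ups)
    spec = between-spec (List.map (λ L → realValue L v) lows) (List.map (λ U → realValue U v) ups) n
      (All.map⁺ (All.map (λ {L} hL → All.map⁺ (All.map (λ {U} L≤U →
        subst₂ ℚ._≤_ (sym (approx-realValue L v n)) (sym (approx-realValue U v n)) L≤U) hL))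
        (gaps⁻ n (λ i → approx (v i) n) h)))

-- The vector `w` is chosen once, before `n`; a rational solution `w′` only testifies that the
-- system is solvable at stage `n`.
Solution : ∀ r → List (Form r) → Set
Solution r S = Σ[ w ∈ Vector ℝ r ]
  (∀ n → ∃[ w′ ] All (Holds w′ n) S → All (Holds (λ i → approx (w i) n) n) S)

-- Wherever `S` has a solution `w′`, its tail solves the reduced system, since `w′ zero` lies
-- between every lower and every upper bound. Conversely, the gaps leave room for `firstUnknown`.
backSubstitute : ∀ {r} {S : List (Form (suc r))} (Sp : Split S) →
                 (∀ S′ → Solution r S′) → Solution (suc r) S
backSubstitute {r} {S} Sp solve = extendBy (solve (gaps Sp List.++ rest))
  where
  open Split Sp
  extendBy : Solution r (gaps Sp List.++ rest) → Solution (suc r) S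
  extendBy (v , v-ok) = w , ok
    where
    w : Vector ℝ (suc r)
    w = firstUnknown Sp v Vector.∷ v
    ok : ∀ n → ∃[ w′ ] All (Holds w′ n) S → All (Holds (λ i → approx (w i) n) n) S
    ok n (w′ , h) = from (λ i → approx (w i) n) n (proj₁ spec) (proj₂ spec) (proj₂ (All.++⁻ (gaps Sp) solved))
      where
      feasible = to w′ n h
      solved : All (Holds (λ i → approx (v i) n) n) (gaps Sp List.++ rest)
      solved = v-ok n (w′ ∘ suc , All.++⁺
        (gaps⁺ Sp n (w′ ∘ suc) (w′ zero) (proj₁ feasible) (proj₁ (proj₂ feasible))) (proj₂ (proj₂ feasible)))
      spec = firstUnknown-spec Sp v n (proj₁ (All.++⁻ (gaps Sp) solved))

opaque
  unfolding value

  -- One continuous choice of a solution, valid for every n at which the system is solvable.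
  solveSystem : ∀ r (S : List (Form r)) → Solution r S
  solveSystem zero    S = (λ ()) , λ n (w′ , h) → All.map id h
  solveSystem (suc r) S = backSubstitute (splitSystem S) (solveSystem r)

-- Patterns and the sources of edges

ι-toℕ-injective : ∀ {m} {a b : Fin m} → ι (toℕ a) ≡ ι (toℕ b) → a ≡ b
ι-toℕ-injective {a = a} {b} eq with Fin.<-cmp a b
... | tri< a<b _ _ = contradiction (ι-mono-< a<b) (ℚ.<-irrefl eq)
... | tri≈ _ a≡b _ = a≡b
... | tri> _ _ b<a = contradiction (ι-mono-< b<a) (ℚ.<-irrefl (sym eq))

module _ {j m} (w : Fin j → Fin m) (w-inj : Injective _≡_ _≡_ w) (σ : Permutation′ m) where
  private
    f : Fin j → ℚ
    f a = ι (toℕ (σ ⟨$⟩ʳ w a))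

    f-injective : Injective _≡_ _≡_ f
    f-injective eq = w-inj (perm-injective σ (ι-toℕ-injective eq))

    reflect : ∀ a b → f a ℚ.< f b → σ ⟨$⟩ʳ w a Fin.< σ ⟨$⟩ʳ w b
    reflect a b fa<fb with Fin.<-cmp (σ ⟨$⟩ʳ w a) (σ ⟨$⟩ʳ w b)
    ... | tri< lt _ _ = lt
    ... | tri≈ _ eq _ = contradiction fa<fb (ℚ.<-irrefl (cong (ι ∘ toℕ) eq))
    ... | tri> _ _ gt = contradiction fa<fb (ℚ.<-asym (ι-mono-< gt))

  opaque
    pat : Permutation′ j
    pat = std f f-injective

    pat-isPattern : IsPattern w σ pat
    pat-isPattern a b = (λ lt → reflect a b (std-cancel f f-injective a b lt)) ,
                        (λ lt → std-mono f f-injective a b (ι-mono-< lt))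

window-injective : ∀ {m} i j .(le : i ℕ.+ j ℕ.≤ m) → Injective _≡_ _≡_ (window i j le)
window-injective i j le {a} {b} eq = Fin.toℕ-injective (ℕ.+-cancelˡ-≡ i _ _
  (trans (sym (toℕ-window i j le a)) (trans (cong toℕ eq) (toℕ-window i j le b))))

module _ {k : ℕ} where

  private
    init : Fin k → Fin (suc k)
    init = window 0 k (ℕ.n≤1+n k)

    init≡ : ∀ a → toℕ (init a) ≡ toℕ a
    init≡ = toℕ-window 0 k (ℕ.n≤1+n k)

  source : ColouredPerm (suc k) → ColouredPerm k
  source (π , c) = pat init (window-injective 0 k (ℕ.n≤1+n k)) π , c ∘ init

  source-isBeginning : ∀ x → IsBeginning x (source x)
  source-isBeginning (π , c) = ℕ.n≤1+n k , pat-isPattern init (window-injective 0 k (ℕ.n≤1+n k)) π , λ _ → refl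

  source-cong : ∀ x y → x ≈ᶜ y → source x ≈ᶜ source y
  source-cong x@(π , c) y@(ρ , e) (π≈ρ , c≗e) = pattern-unique init ρ (proj₁ (source x)) (proj₁ (source y))
    (λ a b → subst₂ (λ p q → (proj₁ (source x) ⟨$⟩ʳ a Fin.< proj₁ (source x) ⟨$⟩ʳ b → p Fin.< q) ×
                             (p Fin.< q → proj₁ (source x) ⟨$⟩ʳ a Fin.< proj₁ (source x) ⟨$⟩ʳ b))
                    (π≈ρ (init a)) (π≈ρ (init b)) (proj₁ (proj₂ (source-isBeginning x)) a b))
    (proj₁ (proj₂ (source-isBeginning y))) , λ a → c≗e (init a)

  -- A witness inside the window precedes `b`, so it survives when the last entry is removed. Hence
  -- sources of edges are vertices, with no need to exhibit a permutation.
  source-consistent : ∀ {n} x → Consistent n x → Consistent n (source x)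
  source-consistent {n} x@(π , c) C = record
    { positive   = λ a → positive (init a)
    ; bounded    = λ a → bounded (init a)
    ; increasing = λ a b a<b lt → increasing (init a) (init b) (init-< a<b) (proj₁ (p b a) lt)
    ; witness    = wit
    }
    where
    open Consistent C
    ρ = proj₁ (source x)
    p : IsPattern init π ρ
    p = proj₁ (proj₂ (source-isBeginning x))
    init-< : ∀ {a b : Fin k} → a Fin.< b → init a Fin.< init b
    init-< {a} {b} = subst₂ ℕ._<_ (sym (init≡ a)) (sym (init≡ b))
    wit : ∀ b {d} → d ℕ.< c (init b) → 1 ℕ.≤ d →
          (∃[ a ] (a Fin.< b × ρ ⟨$⟩ʳ b Fin.< ρ ⟨$⟩ʳ a × c (init a) ≡ d)) ⊎
          (∀ a → ρ ⟨$⟩ʳ a Fin.< ρ ⟨$⟩ʳ b → d ℕ.< c (init a))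
    wit b {d} d<c 1≤d with witness (init b) d<c 1≤d
    ... | inj₂ all = inj₂ λ a lt → all (init a) (proj₁ (p a b) lt)
    ... | inj₁ (a , a<b , lt , ca≡d) = inj₁ (a′ , a′<b , proj₂ (p b a′) (subst (λ z → π ⟨$⟩ʳ init b Fin.< π ⟨$⟩ʳ z) (sym init-a′) lt) ,
                                             trans (cong c init-a′) ca≡d)
      where
      toℕa<b : toℕ a ℕ.< toℕ b
      toℕa<b = subst (toℕ a ℕ.<_) (init≡ b) a<b
      a′ : Fin k
      a′ = fromℕ< (ℕ.<-trans toℕa<b (Fin.toℕ<n b))
      a′≡ : toℕ a′ ≡ toℕ a
      a′≡ = Fin.toℕ-fromℕ< (ℕ.<-trans toℕa<b (Fin.toℕ<n b))
      a′<b : a′ Fin.< b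
      a′<b = subst (ℕ._< toℕ b) (sym a′≡) toℕa<b
      init-a′ : init a′ ≡ a
      init-a′ = Fin.toℕ-injective (trans (init≡ a′) a′≡)

isEnd-resp : ∀ {j m} (x : ColouredPerm m) (y z : ColouredPerm j) → y ≈ᶜ z → IsEnd x y → IsEnd x z
isEnd-resp {j} {m} x y z (π≈ρ , c≗e) (le , p , col) = le ,
  pattern-resp (window (m ∸ j) j le) (proj₁ x) (proj₁ y) (proj₁ z) π≈ρ p , λ a → trans (sym (c≗e a)) (col a)

isEnd? : ∀ {j m} → j ℕ.≤ m → (x : ColouredPerm m) (y : ColouredPerm j) → Dec (IsEnd x y)
isEnd? {j} {m} j≤m x y = map′ (λ (p , col) → le , p , col) (λ (_ , p , col) → p , col)
  (isPattern? (window (m ∸ j) j le) (proj₁ x) (proj₁ y) ×-dec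
   (Fin.all? λ a → proj₂ y a ℕ.≟ proj₂ x (window (m ∸ j) j le a)))
  where
  le : (m ∸ j) ℕ.+ j ℕ.≤ m
  le = ℕ.≤-reflexive (ℕ.m∸n+n≡m j≤m)

-- Enumeration

functions : ∀ {A : Set} → List A → ∀ k → List (Fin k → A)
functions xs zero    = Vector.[] ∷ []
functions xs (suc k) = List.concatMap (λ x → List.map (x Vector.∷_) (functions xs k)) xs

-- Up to pointwise equality, as functions with equal values are not provably equal here; the
-- enumerations of permutations and edges inherit this.
functions-complete : ∀ {A : Set} (xs : List A) k (g : Fin k → A) → (∀ i → g i ∈ xs) → Any (_≗ g) (functions xs k)
functions-complete xs zero    g g∈ = here λ ()
functions-complete xs (suc k) g g∈ = Any.concat⁺ (Any.map⁺ (Any.map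
  (λ { refl → Any.map⁺ (Any.map (λ h≗ → λ { zero → refl ; (suc i) → h≗ i }) (functions-complete xs k (g ∘ suc) (g∈ ∘ suc))) })
  (g∈ zero)))

filterΣ : ∀ {A : Set} {P : A → Set} → Decidable P → List A → List (Σ A P)
filterΣ P? []       = []
filterΣ P? (x ∷ xs) with P? x
... | yes p = (x , p) ∷ filterΣ P? xs
... | no  _ = filterΣ P? xs

filterΣ-complete : ∀ {A : Set} {P Q : A → Set} (P? : Decidable P) {xs} → (∀ x → Q x → P x) →
                   Any Q xs → Any (Q ∘ proj₁) (filterΣ P? xs)
filterΣ-complete P? {x ∷ xs} Q⇒P q with P? x
filterΣ-complete P? {x ∷ xs} Q⇒P (here qx)  | yes p = here qx
filterΣ-complete P? {x ∷ xs} Q⇒P (there q)  | yes p = there (filterΣ-complete P? Q⇒P q)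
filterΣ-complete P? {x ∷ xs} Q⇒P (here qx)  | no ¬p = contradiction (Q⇒P x qx) ¬p
filterΣ-complete P? {x ∷ xs} Q⇒P (there q)  | no ¬p = filterΣ-complete P? Q⇒P q

permutations : ∀ k → List (Permutation′ k)
permutations k = List.map (λ (f , inj) → fromInjection f (λ {a} {b} → inj a b))
  (filterΣ (λ f → Fin.all? λ a → Fin.all? λ b → (f a Fin.≟ f b) →-dec (a Fin.≟ b)) (functions (List.allFin k) k))

permutations-complete : ∀ {k} (π : Permutation′ k) → Any (Perm._≈ π) (permutations k)
permutations-complete {k} π = Any.map⁺ (filterΣ-complete _
  (λ f f≗π a b eq → perm-injective π (trans (sym (f≗π a)) (trans eq (f≗π b))))
  (functions-complete (List.allFin k) k (π ⟨$⟩ʳ_) (λ i → ∈-allFin _)))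

count-concatMap : ∀ {A B : Set} {P : B → Set} {Q : A → Set} (P? : Decidable P) (Q? : Decidable Q) (f : A → List B) xs →
                  (∀ x → count P? (f x) ≡ indicator (Q? x)) → count P? (List.concatMap f xs) ≡ count Q? xs
count-concatMap P? Q? f []       h = refl
count-concatMap P? Q? f (x ∷ xs) h = begin
  count P? (f x List.++ List.concatMap f xs)               ≡⟨ count-++ P? (f x) _ ⟩
  count P? (f x) ℕ.+ count P? (List.concatMap f xs)        ≡⟨ cong₂ ℕ._+_ (h x) (count-concatMap P? Q? f xs h) ⟩
  indicator (Q? x) ℕ.+ count Q? xs                         ≡⟨ count-∷ Q? x xs ⟨
  count Q? (x ∷ xs)                                        ∎
  where open ≡-Reasoning

count-map : ∀ {A B : Set} {P : B → Set} (P? : Decidable P) (f : A → B) xs →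
            count P? (List.map f xs) ≡ count (P? ∘ f) xs
count-map P? f []       = refl
count-map P? f (x ∷ xs) with P? (f x)
... | yes _ = cong suc (count-map P? f xs)
... | no  _ = count-map P? f xs

count-upTo-≟ : ∀ {d} q → d ℕ.< q → count (ℕ._≟ d) (List.upTo q) ≡ 1
count-upTo-≟ {d} (suc q) d<1+q with ℕ.m<1+n⇒m<n∨m≡n d<1+q
... | inj₁ d<q = trans (count-upTo-suc (ℕ._≟ d) q)
  (cong₂ ℕ._+_ (count-upTo-≟ q d<q) (indicator-no (q ℕ.≟ d) λ q≡d → ℕ.<⇒≢ d<q (sym q≡d)))
... | inj₂ refl = trans (count-upTo-suc (ℕ._≟ d) d)
  (cong₂ ℕ._+_ (count≡0 (ℕ._≟ d) (List.upTo d) λ x x∈ x≡d → ℕ.<⇒≢ (∈-upTo⁻ x∈) x≡d) (indicator-yes (d ℕ.≟ d) refl))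

_≗?_ : ∀ {k} (c e : Colouring k) → Dec (c ≗ e)
c ≗? e = Fin.all? λ a → c a ℕ.≟ e a

-- Exactly once, not just at least once: the sum defining Π has one term for each element of the
-- list.
allColourings-count : ∀ q {k} (c : Colouring k) → (∀ a → 1 ℕ.≤ c a) → (∀ a → c a ℕ.≤ q) →
                      count (c ≗?_) (allColourings q k) ≡ 1
allColourings-count q {zero}  c 1≤c c≤q = refl
allColourings-count q {suc k} c 1≤c c≤q = begin
  count (c ≗?_) (allColourings q (suc k))
    ≡⟨ count-concatMap (c ≗?_) (λ x → x ℕ.≟ c zero) _ (List.map suc (List.upTo q)) first ⟩
  count (λ x → x ℕ.≟ c zero) (List.map suc (List.upTo q))   ≡⟨ count-map (λ x → x ℕ.≟ c zero) suc (List.upTo q) ⟩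
  count (λ x → suc x ℕ.≟ c zero) (List.upTo q)              ≡⟨ count-cong (λ x → suc x ℕ.≟ c zero) (ℕ._≟ d) (List.upTo q)
      (λ x _ eq → ℕ.suc-injective (trans eq c₀≡)) (λ x _ eq → trans (cong suc eq) (sym c₀≡)) ⟩
  count (ℕ._≟ d) (List.upTo q)                              ≡⟨ count-upTo-≟ q (subst (ℕ._≤ q) c₀≡ (c≤q zero)) ⟩
  1                                                         ∎
  where
  open ≡-Reasoning
  d = ℕ.pred (c zero)
  c₀≡ : c zero ≡ suc d
  c₀≡ = sym (ℕ.suc-pred (c zero) {{ℕ.>-nonZero (1≤c zero)}})
  first : ∀ x → count (c ≗?_) (List.map (x Vector.∷_) (allColourings q k)) ≡ indicator (x ℕ.≟ c zero)
  first x with x ℕ.≟ c zero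
  ... | yes refl = trans (count-map (c ≗?_) (c zero Vector.∷_) (allColourings q k)) (trans
    (count-cong (λ e → c ≗? (c zero Vector.∷ e)) ((c ∘ suc) ≗?_) (allColourings q k)
      (λ e _ eq a → eq (suc a)) (λ e _ eq → λ { zero → refl ; (suc a) → eq a }))
    (allColourings-count q (c ∘ suc) (1≤c ∘ suc) (c≤q ∘ suc)))
  ... | no x≢ = trans (count-map (c ≗?_) (x Vector.∷_) (allColourings q k))
    (count≡0 (λ e → c ≗? (x Vector.∷ e)) (allColourings q k) λ e _ eq → x≢ (sym (eq zero)))

count⇒Any : ∀ {A : Set} {P : A → Set} (P? : Decidable P) xs → count P? xs ≢ 0 → Any P xs
count⇒Any P? xs ≢0 with Any.any? P? xs
... | yes any = any
... | no ¬any = contradiction (count≡0 P? xs λ x x∈ Px → ¬any (Any.map (λ { refl → Px }) x∈)) ≢0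

inheritedPerms : ∀ {n} → 2 ℕ.≤ n → ∀ k → List (𝒞 n k)
inheritedPerms {n} 2≤n k = filterΣ (inherited? 2≤n)
  (List.concatMap (λ π → List.map (π ,_) (allColourings (n ∸ 1) k)) (permutations k))

-- An edge carries a proof of inheritance, and permutations are compared pointwise. Passing to a
-- listed representative makes propositional membership available for pigeonhole arguments.
inheritedPerms-complete : ∀ {n k} (2≤n : 2 ℕ.≤ n) (x : ColouredPerm k) → Consistent n x →
                          ∃[ e ] (e ∈ inheritedPerms 2≤n k × x ≈ᶜ proj₁ e)
inheritedPerms-complete {n} {k} 2≤n x@(π , c) C = find (filterΣ-complete (inherited? 2≤n)
  (λ y x≈y → consistent⇒inherited 2≤n y (consistent-resp x≈y C))
  (Any.concat⁺ (Any.map⁺ (Any.map (λ ρ≈π → Any.map⁺ (Any.map (λ c≗e → (λ a → sym (ρ≈π a)) , c≗e)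
    (count⇒Any (c ≗?_) (allColourings (n ∸ 1) k) λ eq → contradiction (trans (sym eq)
      (allColourings-count (n ∸ 1) c positive (λ a → ℕ.∸-monoˡ-≤ 1 (bounded a)))) λ ())))
    (permutations-complete π)))))
  where open Consistent C

-- Loop erasure

allPairs-++⁻ : ∀ {A : Set} {R : A → A → Set} xs {ys} → AllPairs R (xs List.++ ys) → AllPairs R xs × AllPairs R ys
allPairs-++⁻ []       ps       = [] , ps
allPairs-++⁻ (x ∷ xs) (p ∷ ps) = let l , r = allPairs-++⁻ xs ps in All.++⁻ˡ xs p ∷ l , r

-- Vertices occur only as sources of edges: e ∼ f says that e and f have the
-- same source, and Adj e f that e ends where f starts.
module LoopErasure {E : Set} {_∼_ : E → E → Set} (_∼?_ : ∀ e f → Dec (e ∼ f))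
                   (∼-refl : ∀ e → e ∼ e) (∼-sym : ∀ {e f} → e ∼ f → f ∼ e)
                   {Adj : E → E → Set} (Adj? : ∀ e f → Dec (Adj e f))
                   (adj-resp : ∀ {e f g} → Adj e f → f ∼ g → Adj e g) where

  Chain : E → List E → Set
  Chain e []       = ⊤
  Chain e (f ∷ es) = Adj e f × Chain f es

  ChainTo : E → List E → E → Set
  ChainTo e []       t = Adj e t
  ChainTo e (f ∷ es) t = Adj e f × ChainTo f es t

  Distinct : List E → Set
  Distinct = AllPairs (λ e f → ¬ (e ∼ f))

  IsCycle : List E → Set
  IsCycle []       = ⊥
  IsCycle (e ∷ es) = ChainTo e es e × Distinct (e ∷ es)

  chainTo? : ∀ e es t → Dec (ChainTo e es t)
  chainTo? e []       t = Adj? e t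
  chainTo? e (f ∷ es) t = Adj? e f ×-dec chainTo? f es t

  isCycle? : ∀ es → Dec (IsCycle es)
  isCycle? []       = no λ ()
  isCycle? (e ∷ es) = chainTo? e es e ×-dec AllPairs.allPairs? (λ e f → ¬? (e ∼? f)) (e ∷ es)

  chainTo-resp : ∀ e es {t u} → ChainTo e es t → t ∼ u → ChainTo e es u
  chainTo-resp e []       ch        t∼u = adj-resp ch t∼u
  chainTo-resp e (f ∷ es) (ef , ch) t∼u = ef , chainTo-resp f es ch t∼u

  private
    record Loop (e p : E) (ps : List E) : Set where
      field
        before    : List E
        meet      : E
        after     : List E
        split≡    : p ∷ ps ≡ before List.++ meet ∷ after
        meet∼     : meet ∼ e
        fresh     : All (λ f → ¬ (e ∼ f)) before
        chainTo   : ∀ {a} → Adj a p → ChainTo a before meet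
        chain     : Chain meet after

    findLoop : ∀ e p ps → Chain p ps → All (λ f → ¬ (e ∼ f)) (p ∷ ps) ⊎ Loop e p ps
    findLoop e p ps ch with e ∼? p
    ... | yes e∼p = inj₂ record
      { before = [] ; meet = p ; after = ps ; split≡ = refl ; meet∼ = ∼-sym e∼p
      ; fresh = [] ; chainTo = λ ap → ap ; chain = ch }
    findLoop e p []       ch        | no e≁p = inj₁ (e≁p ∷ [])
    findLoop e p (f ∷ ps) (pf , ch) | no e≁p with findLoop e f ps ch
    ... | inj₁ fresh = inj₁ (e≁p ∷ fresh)
    ... | inj₂ L     = inj₂ record
      { before = p ∷ L.before ; meet = L.meet ; after = L.after ; split≡ = cong (p ∷_) L.split≡ ; meet∼ = L.meet∼
      ; fresh = e≁p ∷ L.fresh ; chainTo = λ ap → ap , L.chainTo pf ; chain = L.chain }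
      where module L = Loop L

  countAll : ∀ {P : E → Set} → Decidable P → List (List E) → ℕ
  countAll P? css = sum (List.map (count P?) css)

  -- `head ∷ tail` is the simple path that remains. It starts at the vertex where `e` starts, but
  -- `e` itself may have gone into a cycle. `counts` holds for every predicate, so it yields both
  -- pattern counts and lengths.
  record Erasure (e : E) (es : List E) : Set₁ where
    field
      head     : E
      tail     : List E
      head∼    : head ∼ e
      chain    : Chain head tail
      distinct : Distinct (head ∷ tail)
      cycles   : List (List E)
      areCycles : All IsCycle cycles
      inherit  : ∀ (Q : E → Set) → All Q (e ∷ es) → All Q (head ∷ tail) × All (All Q) cycles
      counts   : ∀ {P : E → Set} (P? : Decidable P) →
                 count P? (e ∷ es) ≡ count P? (head ∷ tail) ℕ.+ countAll P? cycles

  -- The remainder is erased before `e` is prepended. If the simple path returns to the source of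
  -- `e`, the first return closes `e ∷ before` to a simple cycle, and the path restarts at `meet`.
  erase : ∀ e es → Chain e es → Erasure e es
  erase e []       ch = record
    { head = e ; tail = [] ; head∼ = ∼-refl e ; chain = tt ; distinct = [] ∷ []
    ; cycles = [] ; areCycles = [] ; inherit = λ Q q → q , [] ; counts = λ P? → sym (ℕ.+-identityʳ _) }
  erase e (f ∷ es) (ef , ch) = step (erase f es ch)
    where
    step : Erasure f es → Erasure e (f ∷ es)
    step R = result (findLoop e R.head R.tail R.chain)
      where
      module R = Erasure R
      e-head : Adj e R.head
      e-head = adj-resp ef (∼-sym R.head∼)
      result : All (λ f → ¬ (e ∼ f)) (R.head ∷ R.tail) ⊎ Loop e R.head R.tail → Erasure e (f ∷ es)
      result (inj₁ fresh) = record
        { head = e ; tail = R.head ∷ R.tail ; head∼ = ∼-refl e ; chain = e-head , R.chain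
        ; distinct = fresh ∷ R.distinct ; cycles = R.cycles ; areCycles = R.areCycles
        ; inherit = λ { Q (q ∷ qs) → let p , c = R.inherit Q qs in q ∷ p , c }
        ; counts = λ P? → begin
            count P? (e ∷ f ∷ es)                                               ≡⟨ count-∷ P? e (f ∷ es) ⟩
            indicator (P? e) ℕ.+ count P? (f ∷ es)
              ≡⟨ cong (indicator (P? e) ℕ.+_) (R.counts P?) ⟩
            indicator (P? e) ℕ.+ (count P? (R.head ∷ R.tail) ℕ.+ countAll P? R.cycles) ≡⟨ ℕ.+-assoc (indicator (P? e)) _ _ ⟨
            indicator (P? e) ℕ.+ count P? (R.head ∷ R.tail) ℕ.+ countAll P? R.cycles
              ≡⟨ cong (ℕ._+ countAll P? R.cycles) (count-∷ P? e (R.head ∷ R.tail)) ⟨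
            count P? (e ∷ R.head ∷ R.tail) ℕ.+ countAll P? R.cycles             ∎
        }
        where open ≡-Reasoning
      result (inj₂ L) = record
        { head = L.meet ; tail = L.after ; head∼ = L.meet∼ ; chain = L.chain
        ; distinct = proj₂ pairs
        ; cycles = (e ∷ L.before) ∷ R.cycles
        ; areCycles = (chainTo-resp e L.before (L.chainTo e-head) L.meet∼ , L.fresh ∷ proj₁ pairs) ∷ R.areCycles
        ; inherit = λ { Q (q ∷ qs) → let p , c = R.inherit Q qs
                                         b , a = All.++⁻ L.before (subst (All Q) L.split≡ p)
                                     in a , (q ∷ b) ∷ c }
        ; counts = λ P? → begin
            count P? (e ∷ f ∷ es)                                               ≡⟨ count-∷ P? e (f ∷ es) ⟩
            indicator (P? e) ℕ.+ count P? (f ∷ es)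
              ≡⟨ cong (indicator (P? e) ℕ.+_) (R.counts P?) ⟩
            indicator (P? e) ℕ.+ (count P? (R.head ∷ R.tail) ℕ.+ countAll P? R.cycles)
              ≡⟨ cong (λ s → indicator (P? e) ℕ.+ (s ℕ.+ countAll P? R.cycles)) (trans (cong (count P?) L.split≡) (count-++ P? L.before _)) ⟩
            indicator (P? e) ℕ.+ (count P? L.before ℕ.+ count P? (L.meet ∷ L.after) ℕ.+ countAll P? R.cycles)
              ≡⟨ rearrange (indicator (P? e)) (count P? L.before) (count P? (L.meet ∷ L.after)) (countAll P? R.cycles) ⟩
            count P? (L.meet ∷ L.after) ℕ.+ (indicator (P? e) ℕ.+ count P? L.before ℕ.+ countAll P? R.cycles)
              ≡⟨ cong (λ s → count P? (L.meet ∷ L.after) ℕ.+ (s ℕ.+ countAll P? R.cycles)) (count-∷ P? e L.before) ⟨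
            count P? (L.meet ∷ L.after) ℕ.+ (count P? (e ∷ L.before) ℕ.+ countAll P? R.cycles) ∎
        }
        where
        open ≡-Reasoning
        module L = Loop L
        pairs = allPairs-++⁻ L.before (subst Distinct L.split≡ R.distinct)
        rearrange : ∀ a b c d → a ℕ.+ (b ℕ.+ c ℕ.+ d) ≡ c ℕ.+ (a ℕ.+ b ℕ.+ d)
        rearrange = solve-∀

  distinct-lookup : ∀ ys → Distinct ys → ∀ i j → List.lookup ys i ∼ List.lookup ys j → i ≡ j
  distinct-lookup (y ∷ ys) (y≁ ∷ d) zero    zero    _   = refl
  distinct-lookup (y ∷ ys) (y≁ ∷ d) zero    (suc j) y∼  = contradiction y∼ (All.lookup y≁ (∈-lookup j))
  distinct-lookup (y ∷ ys) (y≁ ∷ d) (suc i) zero    ∼y  = contradiction (∼-sym ∼y) (All.lookup y≁ (∈-lookup i))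
  distinct-lookup (y ∷ ys) (y≁ ∷ d) (suc i) (suc j) eq  = cong suc (distinct-lookup ys d i j eq)

  -- This bounds both the path left over by loop erasure and the length of the cycles to be
  -- enumerated.
  distinct-length : ∀ {xs ys} → Distinct ys → All (_∈ xs) ys → List.length ys ℕ.≤ List.length xs
  distinct-length {xs} {ys} dist ys⊆ = Fin.injective⇒≤ {f = position} λ {i} {j} eq → inj i j eq
    where
    position : Fin (List.length ys) → Fin (List.length xs)
    position i = Any.index (All.lookup ys⊆ (∈-lookup i))
    lookup-position : ∀ i → List.lookup ys i ≡ List.lookup xs (position i)
    lookup-position i = lookup-index (All.lookup ys⊆ (∈-lookup i))
    inj : ∀ i j → position i ≡ position j → i ≡ j
    inj i j eq = distinct-lookup ys dist i j (subst (List.lookup ys i ∼_)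
      (trans (lookup-position i) (trans (cong (List.lookup xs) eq) (sym (lookup-position j)))) (∼-refl _))

-- Simple cycles of the coloured overlap graph

listsUpTo : ∀ {A : Set} → List A → ℕ → List (List A)
listsUpTo xs zero    = [] ∷ []
listsUpTo xs (suc l) = [] ∷ List.concatMap (λ x → List.map (x ∷_) (listsUpTo xs l)) xs

listsUpTo-complete : ∀ {A : Set} (xs : List A) l ys → All (_∈ xs) ys → List.length ys ℕ.≤ l → ys ∈ listsUpTo xs l
listsUpTo-complete xs zero    []       _          _         = here refl
listsUpTo-complete xs (suc l) []       _          _         = here refl
listsUpTo-complete xs (suc l) (y ∷ ys) (y∈ ∷ ys∈) (s≤s len) = there (Any.concat⁺ (Any.map⁺ (Any.map
  (λ { refl → Any.map⁺ (Any.map (cong (y ∷_)) (listsUpTo-complete xs l ys ys∈ len)) }) y∈)))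

count-lookup : ∀ {A : Set} {P : A → Set} (P? : Decidable P) xs →
               count (P? ∘ List.lookup xs) (List.allFin (List.length xs)) ≡ count P? xs
count-lookup P? xs = begin
  count (P? ∘ List.lookup xs) (List.allFin (List.length xs))
    ≡⟨ count-map P? (List.lookup xs) (List.allFin (List.length xs)) ⟨
  count P? (List.map (List.lookup xs) (List.allFin (List.length xs)))
    ≡⟨ cong (count P?) (trans (List.map-tabulate id (List.lookup xs)) (List.tabulate-lookup xs)) ⟩
  count P? xs                                                           ∎
  where open ≡-Reasoning

module OverlapGraph {n : ℕ} (2≤n : 2 ℕ.≤ n) (k′ : ℕ) where

  open Graph (𝒪v n (suc k′)) public using (Edge; Vertex; _≈ⱽ_; _from_to_)

  1≤n : 1 ℕ.≤ n
  1≤n = ℕ.<⇒≤ 2≤n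

  edge-consistent : ∀ (e : Edge) → Consistent n (proj₁ e)
  edge-consistent (x , inh) = inherited⇒consistent 1≤n x inh

  src : Edge → Vertex
  src e = source (proj₁ e) , consistent⇒inherited 2≤n (source (proj₁ e)) (source-consistent (proj₁ e) (edge-consistent e))

  private
    module V = DecSetoid (colouredPerm k′)
    vert : Edge → ColouredPerm k′
    vert e = source (proj₁ e)

  _∼_ : Edge → Edge → Set
  e ∼ f = vert e ≈ᶜ vert f

  Adj : Edge → Edge → Set
  Adj e f = IsEnd (proj₁ e) (vert f)

  _∼?_ : ∀ e f → Dec (e ∼ f)
  e ∼? f = vert e V.≟ vert f

  Adj? : ∀ e f → Dec (Adj e f)
  Adj? e f = isEnd? (ℕ.n≤1+n k′) (proj₁ e) (vert f)

  ∼-refl : ∀ e → e ∼ e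
  ∼-refl e = V.refl {vert e}

  ∼-sym : ∀ {e f} → e ∼ f → f ∼ e
  ∼-sym {e} {f} = V.sym {vert e} {vert f}

  adj-resp : ∀ {e f g} → Adj e f → f ∼ g → Adj e g
  adj-resp {e} {f} {g} ef f∼g = isEnd-resp (proj₁ e) (vert f) (vert g) f∼g ef

  open LoopErasure _∼?_ ∼-refl (λ {e} {f} → ∼-sym {e} {f}) Adj? (λ {e} {f} {g} → adj-resp {e} {f} {g}) public

  private
    vertices : ∀ e (es : List Edge) → Edge → Fin (suc (suc (List.length es))) → Vertex
    vertices e es       t zero       = src e
    vertices e []       t (suc zero) = src t
    vertices e (f ∷ es) t (suc i)    = vertices f es t i

    vertices-walk : ∀ e es t → ChainTo e es t →
                    ∀ i → List.lookup (e ∷ es) i from vertices e es t (inject₁ i) to vertices e es t (suc i)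
    vertices-walk e []       t et       zero    = source-isBeginning (proj₁ e) , et
    vertices-walk e (f ∷ es) t (ef , _) zero    = source-isBeginning (proj₁ e) , ef
    vertices-walk e (f ∷ es) t (_ , ch) (suc i) = vertices-walk f es t ch i

    vertices-last : ∀ e es t → vertices e es t (fromℕ (suc (List.length es))) ≡ src t
    vertices-last e []       t = refl
    vertices-last e (f ∷ es) t = vertices-last f es t

    vertices-inject₁ : ∀ e es t i → vertices e es t (inject₁ i) ≡ src (List.lookup (e ∷ es) i)
    vertices-inject₁ e es       t zero    = refl
    vertices-inject₁ e (f ∷ es) t (suc i) = vertices-inject₁ f es t i

  toSimpleCycle : ∀ es → IsCycle es → SimpleCycle (𝒪v n (suc k′))
  toSimpleCycle (e ∷ es) (ch , dist) = record
    { len-1             = List.length es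
    ; vertex            = vertices e es e
    ; edge              = List.lookup (e ∷ es)
    ; walk              = vertices-walk e es e ch
    ; closed            = subst (_≈ⱽ src e) (sym (vertices-last e es e)) (∼-refl e)
    ; distinct-vertices = λ {i} {j} eq → distinct-lookup (e ∷ es) dist i j
        (subst₂ _≈ⱽ_ (vertices-inject₁ e es e i) (vertices-inject₁ e es e j) eq)
    -- Equal edges have equal sources, and the sources are distinct.
    ; distinct-edges    = λ {i} {j} eq → distinct-lookup (e ∷ es) dist i j
        (source-cong (proj₁ (List.lookup (e ∷ es) i)) (proj₁ (List.lookup (e ∷ es) j)) eq)
    }

  opaque
    allEdges : List Edge
    allEdges = inheritedPerms 2≤n (suc k′)

    allEdges-complete : ∀ x → Consistent n x → ∃[ e ] (e ∈ allEdges × x ≈ᶜ proj₁ e)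
    allEdges-complete = inheritedPerms-complete 2≤n

    -- By `distinct-length` no cycle through listed edges is longer than `allEdges`, so finitely
    -- many lists have to be tested.
    allCycles : List (Σ (List Edge) IsCycle)
    allCycles = filterΣ isCycle? (listsUpTo allEdges (List.length allEdges))

    allCycles-any : ∀ es → IsCycle es → All (_∈ allEdges) es → Any (λ c → es ≡ proj₁ c) allCycles
    allCycles-any es cyc es⊆ = filterΣ-complete isCycle? (λ { _ refl → cyc })
      (listsUpTo-complete allEdges (List.length allEdges) es es⊆ (distinct-length (distinct es cyc) es⊆))
      where
      distinct : ∀ es → IsCycle es → Distinct es
      distinct (e ∷ es) (_ , d) = d

  allCycles-complete : ∀ es → IsCycle es → All (_∈ allEdges) es → ∃[ i ] proj₁ (List.lookup allCycles i) ≡ es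
  allCycles-complete es cyc es⊆ = Any.index found , sym (lookup-index found)
    where
    found = allCycles-any es cyc es⊆

-- Forgetting colours

opaque
  fraction≡ : ∀ a m .{{_ : NonZero m}} → (+ a) ℚ./ m ≡ ι a ℚ.* ((+ 1) ℚ./ m)
  fraction≡ a m = begin
    (+ a) ℚ./ m                                 ≡⟨ ℚ.*-identityʳ _ ⟨
    (+ a) ℚ./ m ℚ.* 1ℚ                          ≡⟨ cong ((+ a) ℚ./ m ℚ.*_) (trans (fraction-cancel 1 m) ι-1) ⟨
    (+ a) ℚ./ m ℚ.* (ρ ℚ.* ι m)                 ≡⟨ regroup ((+ a) ℚ./ m) ρ (ι m) ⟩
    (+ a) ℚ./ m ℚ.* ι m ℚ.* ρ                   ≡⟨ cong (ℚ._* ρ) (fraction-cancel a m) ⟩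
    ι a ℚ.* ρ                                   ∎
    where
    open ≡-Reasoning
    ρ : ℚ
    ρ = (+ 1) ℚ./ m
    regroup : ∀ x y z → x ℚ.* (y ℚ.* z) ≡ x ℚ.* z ℚ.* y
    regroup = solve 3 (λ x y z → x :* (y :* z) := x :* z :* y) refl where open ℚ.+-*-Solver

sum-map-+ : ∀ {A : Set} (f g : A → ℕ) xs →
            sum (List.map (λ x → f x ℕ.+ g x) xs) ≡ sum (List.map f xs) ℕ.+ sum (List.map g xs)
sum-map-+ f g []       = refl
sum-map-+ f g (x ∷ xs) = trans (cong (f x ℕ.+ g x ℕ.+_) (sum-map-+ f g xs)) (swap (f x) (g x) _ _)
  where
  swap : ∀ a b c d → a ℕ.+ b ℕ.+ (c ℕ.+ d) ≡ a ℕ.+ c ℕ.+ (b ℕ.+ d)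
  swap = solve-∀

sum-map-cong : ∀ {A : Set} (f g : A → ℕ) xs → f ≗ g → sum (List.map f xs) ≡ sum (List.map g xs)
sum-map-cong f g xs f≗g = cong sum (List.map-cong f≗g xs)

sum-indicators : ∀ {A : Set} {P : A → Set} (P? : Decidable P) xs → sum (List.map (indicator ∘ P?) xs) ≡ count P? xs
sum-indicators P? []       = refl
sum-indicators P? (x ∷ xs) = trans (cong (indicator (P? x) ℕ.+_) (sum-indicators P? xs)) (sym (count-∷ P? x xs))

-- Exchange of summation. In `edgeCount-sum`, `i` runs over the edges of a cycle and `c` over the
-- colourings: an edge whose pattern is `π` matches one colouring, any other edge none.
doubleCount : ∀ {A B : Set} {R : A → B → Set} {Q : A → Set} (R? : ∀ i c → Dec (R i c)) (Q? : Decidable Q) is cs →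
              (∀ i → count (R? i) cs ≡ indicator (Q? i)) →
              sum (List.map (λ c → count (λ i → R? i c) is) cs) ≡ count Q? is
doubleCount R? Q? []       cs h = zeros cs
  where
  zeros : ∀ {B : Set} (cs : List B) → sum (List.map (λ _ → 0) cs) ≡ 0
  zeros []       = refl
  zeros (_ ∷ cs) = zeros cs
doubleCount R? Q? (i ∷ is) cs h = begin
  sum (List.map (λ c → count (λ i → R? i c) (i ∷ is)) cs)
    ≡⟨ sum-map-cong _ _ cs (λ c → count-∷ (λ i → R? i c) i is) ⟩
  sum (List.map (λ c → indicator (R? i c) ℕ.+ count (λ i → R? i c) is) cs)
    ≡⟨ sum-map-+ (λ c → indicator (R? i c)) (λ c → count (λ i → R? i c) is) cs ⟩
  sum (List.map (λ c → indicator (R? i c)) cs) ℕ.+ sum (List.map (λ c → count (λ i → R? i c) is) cs)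
    ≡⟨ cong₂ ℕ._+_ (trans (sum-indicators (R? i) cs) (h i)) (doubleCount R? Q? is cs h) ⟩
  indicator (Q? i) ℕ.+ count Q? is
    ≡⟨ count-∷ Q? i is ⟨
  count Q? (i ∷ is) ∎
  where open ≡-Reasoning

sumℚ : ∀ {A : Set} → (A → ℚ) → List A → ℚ
sumℚ f []       = 0ℚ
sumℚ f (x ∷ xs) = f x ℚ.+ sumℚ f xs

approx-∑ₗ : ∀ {A : Set} (xs : List A) (f : A → ℝ) n → approx (∑ₗ xs f) n ≡ sumℚ (λ x → approx (f x) n) xs
approx-∑ₗ []       f n = refl
approx-∑ₗ (x ∷ xs) f n = cong (approx (f x) n ℚ.+_) (approx-∑ₗ xs f n)

sumℚ-cong : ∀ {A : Set} {f g : A → ℚ} xs → f ≗ g → sumℚ f xs ≡ sumℚ g xs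
sumℚ-cong []       f≗g = refl
sumℚ-cong (x ∷ xs) f≗g = cong₂ ℚ._+_ (f≗g x) (sumℚ-cong xs f≗g)

∑ₗ-cong : ∀ {A : Set} (xs : List A) (f g : A → ℝ) → (∀ x → f x ≈ g x) → ∑ₗ xs f ≈ ∑ₗ xs g
∑ₗ-cong []       f g f≈g = ≋-≡ {approx 0ℝ} {approx 0ℝ} λ _ → refl
∑ₗ-cong (x ∷ xs) f g f≈g = ≋-+ {approx (f x)} {approx (g x)} {approx (∑ₗ xs f)} {approx (∑ₗ xs g)}
  (f≈g x) (∑ₗ-cong xs f g f≈g)

∑ℚ-0 : ∀ r → ∑ℚ {r} (λ _ → 0ℚ) ≡ 0ℚ
∑ℚ-0 zero    = refl
∑ℚ-0 (suc r) = trans (ℚ.+-identityˡ _) (∑ℚ-0 r)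

sumℚ-∑ℚ : ∀ {A : Set} {r} (f : A → Vector ℚ r) xs → sumℚ (∑ℚ ∘ f) xs ≡ ∑ℚ (λ i → sumℚ (λ x → f x i) xs)
sumℚ-∑ℚ {r = r} f []       = sym (∑ℚ-0 r)
sumℚ-∑ℚ f (x ∷ xs) = trans (cong (∑ℚ (f x) ℚ.+_) (sumℚ-∑ℚ f xs)) (sym (∑ℚ-+ (f x) (λ i → sumℚ (λ y → f y i) xs)))

sumℚ-scaled : ∀ {A : Set} (q ρ : ℚ) (f : A → ℕ) xs →
              sumℚ (λ x → q ℚ.* (ι (f x) ℚ.* ρ)) xs ≡ q ℚ.* (ι (sum (List.map f xs)) ℚ.* ρ)
sumℚ-scaled q ρ f []       = sym (trans (cong (λ z → q ℚ.* (z ℚ.* ρ)) ι-0) (zero-case q ρ))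
  where
  zero-case : ∀ q ρ → q ℚ.* (0ℚ ℚ.* ρ) ≡ 0ℚ
  zero-case = solve 2 (λ q ρ → q :* (con 0ℚ :* ρ) := con 0ℚ) refl where open ℚ.+-*-Solver
sumℚ-scaled q ρ f (x ∷ xs) = begin
  q ℚ.* (ι (f x) ℚ.* ρ) ℚ.+ sumℚ (λ x → q ℚ.* (ι (f x) ℚ.* ρ)) xs
    ≡⟨ cong (q ℚ.* (ι (f x) ℚ.* ρ) ℚ.+_) (sumℚ-scaled q ρ f xs) ⟩
  q ℚ.* (ι (f x) ℚ.* ρ) ℚ.+ q ℚ.* (ι (sum (List.map f xs)) ℚ.* ρ)
    ≡⟨ distrib q (ι (f x)) (ι (sum (List.map f xs))) ρ ⟩
  q ℚ.* ((ι (f x) ℚ.+ ι (sum (List.map f xs))) ℚ.* ρ)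
    ≡⟨ cong (λ z → q ℚ.* (z ℚ.* ρ)) (ι-+ (f x) (sum (List.map f xs))) ⟨
  q ℚ.* (ι (f x ℕ.+ sum (List.map f xs)) ℚ.* ρ)                             ∎
  where
  open ≡-Reasoning
  distrib : ∀ q a b ρ → q ℚ.* (a ℚ.* ρ) ℚ.+ q ℚ.* (b ℚ.* ρ) ≡ q ℚ.* ((a ℚ.+ b) ℚ.* ρ)
  distrib = solve 4 (λ q a b ρ → q :* (a :* ρ) :+ q :* (b :* ρ) := q :* ((a :+ b) :* ρ)) refl where open ℚ.+-*-Solver

≈-refl : ∀ x → x ≈ x
≈-refl x = ≋-≡ {approx x} {approx x} λ _ → refl

≈-sym : ∀ x y → x ≈ y → y ≈ x
≈-sym x y = ≋-sym {approx x} {approx y}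

≈-trans : ∀ x y z → x ≈ y → y ≈ z → x ≈ z
≈-trans x y z = ≋-trans {approx x} {approx y} {approx z}

opaque
  combination : ∀ {r} → Vector ℝ r → Vector ℚ r → ℝ
  combination w q = ∑ (λ i → w i * fromℚ (q i))

  combination≈ : ∀ {r} (w : Vector ℝ r) q → ∑ (λ i → w i * fromℚ (q i)) ≈ combination w q
  combination≈ w q = ≈-refl (combination w q)

  approx-combination : ∀ {r} (w : Vector ℝ r) q m → approx (combination w q) m ≡ ∑ℚ (λ i → approx (w i) m ℚ.* q i)
  approx-combination w q m = approx-∑ (λ i → w i * fromℚ (q i)) m

combination-zero : ∀ {r} (w : Vector ℝ r) q → (∀ i → q i ≡ 0ℚ) → combination w q ≈ 0ℝ
combination-zero {r} w q q≡0 = ≋-≡ {approx (combination w q)} {approx 0ℝ} λ m → trans (approx-combination w q m)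
  (trans (∑ℚ-cong λ i → trans (cong (approx (w i) m ℚ.*_) (q≡0 i)) (ℚ.*-zeroʳ (approx (w i) m))) (∑ℚ-0 r))

module _ {n : ℕ} (2≤n : 2 ℕ.≤ n) {k′ : ℕ} where

  private
    1≤n : 1 ℕ.≤ n
    1≤n = ℕ.<⇒≤ 2≤n
    Cycle = SimpleCycle (𝒪v n (suc k′))
    module K = DecSetoid (colouredPerm (suc k′))

  module _ (C : Cycle) where
    open SimpleCycle C

    cycleLength : ℕ
    cycleLength = suc len-1

    edgeCount : ColouredPerm (suc k′) → ℕ
    edgeCount x = count (λ i → proj₁ (edge i) K.≟ x) (List.allFin cycleLength)

    patternCount : Permutation′ (suc k′) → ℕ
    patternCount π = count (λ i → π ≟ₚ proj₁ (proj₁ (edge i))) (List.allFin cycleLength)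

    opaque
      unitRate : ℚ
      unitRate = (+ 1) ℚ./ cycleLength

      unitRate-length : unitRate ℚ.* ι cycleLength ≡ 1ℚ
      unitRate-length = trans (fraction-cancel 1 cycleLength) ι-1

      edgeRate : ColouredPerm (suc k′) → ℚ
      edgeRate x = (+ edgeCount x) ℚ./ cycleLength

      edgeRate≡ : ∀ x → edgeRate x ≡ ι (edgeCount x) ℚ.* unitRate
      edgeRate≡ x = fraction≡ (edgeCount x) cycleLength

      cycleVector≡ : ∀ e → cycleVector (𝒪v n (suc k′)) C e ≡ edgeRate (proj₁ e)
      cycleVector≡ e = refl

    -- By `edgeRate-sum` this is the coordinate `π` of the image of the cycle vector under Π.
    rate : Permutation′ (suc k′) → ℚ
    rate π = ι (patternCount π) ℚ.* unitRate

    private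
      vanish : ∀ {s} → s ≡ 0 → ι s ℚ.* unitRate ≡ 0ℚ
      vanish refl = trans (cong (ℚ._* unitRate) ι-0) (ℚ.*-zeroˡ unitRate)

    patternCount≡0 : ∀ π → ¬ Avoids π (↘ n) → patternCount π ≡ 0
    patternCount≡0 π ¬av = count≡0 (λ i → π ≟ₚ proj₁ (proj₁ (edge i))) (List.allFin cycleLength) λ i _ π≈ → ¬av (consistent⇒avoids 1≤n
      (consistent-resp {x = proj₁ (edge i)} {y = π , proj₂ (proj₁ (edge i))} ((λ a → sym (π≈ a)) , λ _ → refl)
        (inherited⇒consistent 1≤n (proj₁ (edge i)) (proj₂ (edge i)))))

    rate≡0 : ∀ π → ¬ Avoids π (↘ n) → rate π ≡ 0ℚ
    rate≡0 π ¬av = vanish (patternCount≡0 π ¬av)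

    edgeCount≡0 : ∀ x → ¬ IsInherited n x → edgeCount x ≡ 0
    edgeCount≡0 x ¬inh = count≡0 (λ i → proj₁ (edge i) K.≟ x) (List.allFin cycleLength) λ i _ eq → ¬inh (consistent⇒inherited 2≤n x
      (consistent-resp {x = proj₁ (edge i)} {y = x} eq (inherited⇒consistent 1≤n (proj₁ (edge i)) (proj₂ (edge i)))))

    edgeRate≡0 : ∀ x → ¬ IsInherited n x → edgeRate x ≡ 0ℚ
    edgeRate≡0 x ¬inh = trans (edgeRate≡ x) (vanish (edgeCount≡0 x ¬inh))

    edgeCount-sum : ∀ π → sum (List.map (λ c → edgeCount (π , c)) (allColourings (n ∸ 1) (suc k′))) ≡ patternCount π
    edgeCount-sum π = doubleCount (λ i c → proj₁ (edge i) K.≟ (π , c)) (λ i → π ≟ₚ proj₁ (proj₁ (edge i)))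
      (List.allFin cycleLength) (allColourings (n ∸ 1) (suc k′)) colours
      where
      colours : ∀ i → count (λ c → proj₁ (edge i) K.≟ (π , c)) (allColourings (n ∸ 1) (suc k′)) ≡ indicator (π ≟ₚ proj₁ (proj₁ (edge i)))
      colours i = byCases (π ≟ₚ proj₁ x)
        where
        x = proj₁ (edge i)
        open Consistent (inherited⇒consistent 1≤n x (proj₂ (edge i)))
        byCases : (d : Dec (π Perm.≈ proj₁ x)) → count (λ c → x K.≟ (π , c)) (allColourings (n ∸ 1) (suc k′)) ≡ indicator d
        byCases (yes π≈) = trans (count-cong (λ c → x K.≟ (π , c)) (proj₂ x ≗?_) (allColourings (n ∸ 1) (suc k′))
            (λ c _ eq → proj₂ eq) (λ c _ eq → (λ a → sym (π≈ a)) , eq))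
          (allColourings-count (n ∸ 1) (proj₂ x) positive (λ a → ℕ.∸-monoˡ-≤ 1 (bounded a)))
        byCases (no π≉) = count≡0 (λ c → x K.≟ (π , c)) (allColourings (n ∸ 1) (suc k′)) λ c _ eq → π≉ λ a → sym (proj₁ eq a)

    edgeRate-sum : ∀ q π → sumℚ (λ c → q ℚ.* edgeRate (π , c)) (allColourings (n ∸ 1) (suc k′)) ≡ q ℚ.* rate π
    edgeRate-sum q π = begin
      sumℚ (λ c → q ℚ.* edgeRate (π , c)) cs
        ≡⟨ sumℚ-cong cs (λ c → cong (q ℚ.*_) (edgeRate≡ (π , c))) ⟩
      sumℚ (λ c → q ℚ.* (ι (edgeCount (π , c)) ℚ.* unitRate)) cs
        ≡⟨ sumℚ-scaled q unitRate (λ c → edgeCount (π , c)) cs ⟩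
      q ℚ.* (ι (sum (List.map (λ c → edgeCount (π , c)) cs)) ℚ.* unitRate)
        ≡⟨ cong (λ s → q ℚ.* (ι s ℚ.* unitRate)) (edgeCount-sum π) ⟩
      q ℚ.* rate π                                                          ∎
      where
      open ≡-Reasoning
      cs = allColourings (n ∸ 1) (suc k′)

  mixture : ∀ {r} → Vector Cycle r → Vector ℝ r → Permutation′ (suc k′) → ℝ
  mixture C w π = combination w (λ i → rate (C i) π)

  colouredMixture : ∀ {r} → Vector Cycle r → Vector ℝ r → ColouredPerm (suc k′) → ℝ
  colouredMixture C w x = combination w (λ i → edgeRate (C i) x)

  -- v is the image under Π of a point of the cycle polytope.
  IsMixture : (Permutation′ (suc k′) → ℝ) → Set
  IsMixture v = Σ[ r ∈ ℕ ] Σ[ C ∈ Vector Cycle r ] Σ[ w ∈ Vector ℝ r ]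
    (∀ i → 0ℝ ≤ w i) × (∑ w ≈ 1ℝ) × (∀ π → v π ≈ mixture C w π)

  module _ {r} (C : Vector Cycle r) (w : Vector ℝ r) where

    mixture-sum : ∀ π → ∑ₗ (allColourings (n ∸ 1) (suc k′)) (λ c → colouredMixture C w (π , c)) ≈ mixture C w π
    mixture-sum π = ≋-≡ {approx (∑ₗ (allColourings (n ∸ 1) (suc k′)) (λ c → colouredMixture C w (π , c)))} {approx (mixture C w π)} λ m → begin
      approx (∑ₗ (allColourings (n ∸ 1) (suc k′)) (λ c → colouredMixture C w (π , c))) m
        ≡⟨ approx-∑ₗ (allColourings (n ∸ 1) (suc k′)) (λ c → colouredMixture C w (π , c)) m ⟩
      sumℚ (λ c → approx (colouredMixture C w (π , c)) m) cs
        ≡⟨ sumℚ-cong cs (λ c → approx-combination w (λ i → edgeRate (C i) (π , c)) m) ⟩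
      sumℚ (λ c → ∑ℚ (λ i → approx (w i) m ℚ.* edgeRate (C i) (π , c))) cs
        ≡⟨ sumℚ-∑ℚ (λ c i → approx (w i) m ℚ.* edgeRate (C i) (π , c)) cs ⟩
      ∑ℚ (λ i → sumℚ (λ c → approx (w i) m ℚ.* edgeRate (C i) (π , c)) cs)
        ≡⟨ ∑ℚ-cong (λ i → edgeRate-sum (C i) (approx (w i) m) π) ⟩
      ∑ℚ (λ i → approx (w i) m ℚ.* rate (C i) π)
        ≡⟨ approx-combination w (λ i → rate (C i) π) m ⟨
      approx (mixture C w π) m ∎
      where
      open ≡-Reasoning
      cs = allColourings (n ∸ 1) (suc k′)

    cycleCombination : ∀ e → ∑ (λ i → w i * fromℚ (cycleVector (𝒪v n (suc k′)) (C i) e)) ≈ colouredMixture C w (proj₁ e)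
    cycleCombination e = ≈-trans (∑ (λ i → w i * fromℚ (cycleVector (𝒪v n (suc k′)) (C i) e)))
      (combination w (λ i → cycleVector (𝒪v n (suc k′)) (C i) e)) (colouredMixture C w (proj₁ e))
      (combination≈ w (λ i → cycleVector (𝒪v n (suc k′)) (C i) e))
      (≋-≡ {approx (combination w (λ i → cycleVector (𝒪v n (suc k′)) (C i) e))} {approx (colouredMixture C w (proj₁ e))} λ m →
        trans (approx-combination w (λ i → cycleVector (𝒪v n (suc k′)) (C i) e) m)
          (trans (∑ℚ-cong λ i → cong (approx (w i) m ℚ.*_) (cycleVector≡ (C i) e))
            (sym (approx-combination w (λ i → edgeRate (C i) (proj₁ e)) m))))

    mixture-zero : ∀ π → ¬ Avoids π (↘ n) → mixture C w π ≈ 0ℝ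
    mixture-zero π ¬av = combination-zero w (λ i → rate (C i) π) λ i → rate≡0 (C i) π ¬av

    colouredMixture-zero : ∀ x → ¬ IsInherited n x → colouredMixture C w x ≈ 0ℝ
    colouredMixture-zero x ¬inh = combination-zero w (λ i → edgeRate (C i) x) λ i → edgeRate≡0 (C i) x ¬inh

  -- A zero extension is specified separately on a subset and outside it. To identify it with a
  -- formula valid everywhere, both subsets must be decidable, which is the role of `inherited?` and
  -- `avoids?`.
  projected⇒mixture : ∀ v → ProjectedCyclePolytope n (suc k′) v → IsMixture v
  projected⇒mixture v (p , (r , C , w , 0≤w , ∑w≈1 , p≈) , u , (p̃ , (p̃-in , p̃-out) , u≈) , (v-in , v-out)) =
    r , C , w , 0≤w , ∑w≈1 , values
    where
    p̃≈ : ∀ x → p̃ x ≈ colouredMixture C w x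
    p̃≈ x = byInheritance (inherited? 2≤n x)
      where
      byInheritance : Dec (IsInherited n x) → p̃ x ≈ colouredMixture C w x
      byInheritance (yes inh) = ≈-trans (p̃ x) (p (x , inh)) (colouredMixture C w x) (p̃-in x inh)
        (≈-trans (p (x , inh)) (∑ (λ i → w i * fromℚ (cycleVector (𝒪v n (suc k′)) (C i) (x , inh)))) (colouredMixture C w x)
          (p≈ (x , inh)) (cycleCombination C w (x , inh)))
      byInheritance (no ¬inh) = ≈-trans (p̃ x) 0ℝ (colouredMixture C w x) (p̃-out x ¬inh)
        (≈-sym (colouredMixture C w x) 0ℝ (colouredMixture-zero C w x ¬inh))

    values : ∀ π → v π ≈ mixture C w π
    values π = byAvoidance (avoids? 1≤n π)
      where
      byAvoidance : Dec (Avoids π (↘ n)) → v π ≈ mixture C w π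
      byAvoidance (no ¬av) = ≈-trans (v π) 0ℝ (mixture C w π) (v-out π ¬av) (≈-sym (mixture C w π) 0ℝ (mixture-zero C w π ¬av))
      byAvoidance (yes av) = ≈-trans (v π) (u (π , av)) (mixture C w π) (v-in π av)
        (≈-trans (u (π , av)) (∑ₗ (allColourings (n ∸ 1) (suc k′)) (λ c → p̃ (π , c))) (mixture C w π) (u≈ (π , av))
          (≈-trans (∑ₗ (allColourings (n ∸ 1) (suc k′)) (λ c → p̃ (π , c))) (∑ₗ (allColourings (n ∸ 1) (suc k′)) (λ c → colouredMixture C w (π , c))) (mixture C w π)
            (∑ₗ-cong (allColourings (n ∸ 1) (suc k′)) (λ c → p̃ (π , c)) (λ c → colouredMixture C w (π , c)) (λ c → p̃≈ (π , c)))
            (mixture-sum C w π)))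

  mixture⇒projected : ∀ v → IsMixture v → ProjectedCyclePolytope n (suc k′) v
  mixture⇒projected v (r , C , w , nonNeg , total≈1 , values) =
    (λ e → colouredMixture C w (proj₁ e)) , (r , C , w , nonNeg , total≈1 , p≈) ,
    (λ x → v (proj₁ x)) , (colouredMixture C w , (p̃-in , p̃-out) , u≈) , (v-in , v-out)
    where
    p≈ : ∀ e → colouredMixture C w (proj₁ e) ≈ ∑ (λ i → w i * fromℚ (cycleVector (𝒪v n (suc k′)) (C i) e))
    p≈ e = ≈-sym (∑ (λ i → w i * fromℚ (cycleVector (𝒪v n (suc k′)) (C i) e))) (colouredMixture C w (proj₁ e)) (cycleCombination C w e)
    p̃-in : ∀ x → IsInherited n x → colouredMixture C w x ≈ colouredMixture C w x
    p̃-in x _ = ≈-refl (colouredMixture C w x)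
    p̃-out : ∀ x → ¬ IsInherited n x → colouredMixture C w x ≈ 0ℝ
    p̃-out = colouredMixture-zero C w
    u≈ : ∀ (x : Σ[ π ∈ Permutation′ (suc k′) ] Avoids π (↘ n)) →
         v (proj₁ x) ≈ ∑ₗ (allColourings (n ∸ 1) (suc k′)) (λ c → colouredMixture C w (proj₁ x , c))
    u≈ (π , _) = ≈-trans (v π) (mixture C w π) (∑ₗ (allColourings (n ∸ 1) (suc k′)) (λ c → colouredMixture C w (π , c))) (values π)
      (≈-sym (∑ₗ (allColourings (n ∸ 1) (suc k′)) (λ c → colouredMixture C w (π , c))) (mixture C w π) (mixture-sum C w π))
    v-in : ∀ π → Avoids π (↘ n) → v π ≈ v π
    v-in π _ = ≈-refl (v π)
    v-out : ∀ π → ¬ Avoids π (↘ n) → v π ≈ 0ℝ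
    v-out π ¬av = ≈-trans (v π) (mixture C w π) 0ℝ (values π) (mixture-zero C w π ¬av)

-- Walking around a cycle

hits-cong : ∀ {k} (π : Permutation′ k) (E F : ℕ → ColouredPerm k) u → (∀ t → E t ≡ F t) → hits π E u ≡ hits π F u
hits-cong π E F zero    E≡F = refl
hits-cong π E F (suc u) E≡F = cong₂ (λ h x → h ℕ.+ indicator (π ≟ₚ proj₁ x)) (hits-cong π E F u E≡F) (E≡F u)

hits-+ : ∀ {k} (π : Permutation′ k) (E : ℕ → ColouredPerm k) u v →
         hits π E (u ℕ.+ v) ≡ hits π E u ℕ.+ hits π (λ t → E (u ℕ.+ t)) v
hits-+ π E u zero    = trans (cong (hits π E) (ℕ.+-identityʳ u)) (sym (ℕ.+-identityʳ _))
hits-+ π E u (suc v) = trans (cong (hits π E) (ℕ.+-suc u v))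
  (trans (cong (ℕ._+ indicator (π ≟ₚ proj₁ (E (u ℕ.+ v)))) (hits-+ π E u v)) (ℕ.+-assoc (hits π E u) _ _))

hits≡count : ∀ {k} (π : Permutation′ k) (E : ℕ → ColouredPerm k) u →
             hits π E u ≡ count (λ t → π ≟ₚ proj₁ (E t)) (List.upTo u)
hits≡count π E zero    = refl
hits≡count π E (suc u) = trans (cong (ℕ._+ indicator (π ≟ₚ proj₁ (E u))) (hits≡count π E u))
  (sym (count-upTo-suc (λ t → π ≟ₚ proj₁ (E t)) u))

applyUpTo≡tabulate : ∀ {A : Set} (f : ℕ → A) m → List.applyUpTo f m ≡ List.tabulate {n = m} (f ∘ toℕ)
applyUpTo≡tabulate f zero    = refl
applyUpTo≡tabulate f (suc m) = cong (f 0 ∷_) (applyUpTo≡tabulate (f ∘ suc) m)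

suc-% : ∀ t m .{{_ : NonZero m}} → suc t ℕ.% m ≡ suc (t ℕ.% m) ℕ.% m
suc-% t m = trans (cong (λ s → suc s ℕ.% m) (ℕ.m≡m%n+[m/n]*n t m)) (ℕ.[m+kn]%n≡m%n (suc (t ℕ.% m)) (t ℕ./ m) m)

module _ {n : ℕ} (2≤n : 2 ℕ.≤ n) {k′ : ℕ} (C : SimpleCycle (𝒪v n (suc k′))) where
  open SimpleCycle C

  private
    L : ℕ
    L = suc len-1

    stop : ∀ t → t ℕ.% L ℕ.< L
    stop t = ℕ.m%n<n t L

    at : ℕ → Fin L
    at t = fromℕ< (stop t)

    toℕ-at : ∀ t → toℕ (at t) ≡ t ℕ.% L
    toℕ-at t = Fin.toℕ-fromℕ< (stop t)

    lap : ℕ → ColouredPerm (suc k′)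
    lap t = proj₁ (edge (at t))

    at-≡ : ∀ t (i : Fin L) → t ℕ.% L ≡ toℕ i → at t ≡ i
    at-≡ t i eq = Fin.toℕ-injective (trans (toℕ-at t) eq)

    lap-consistent : ∀ t → Consistent n (lap t)
    lap-consistent t = inherited⇒consistent (ℕ.<⇒≤ 2≤n) (lap t) (proj₂ (edge (at t)))

    join : ∀ i j → suc (toℕ i) ≡ toℕ j ⊎ (suc (toℕ i) ≡ L × toℕ j ≡ 0) → Linked (proj₁ (edge i)) (proj₁ (edge j))
    join i j (inj₁ next) = record
      { vertex = proj₁ (vertex (suc i)) ; end = proj₂ (walk i)
      ; beginning = subst (λ v → IsBeginning (proj₁ (edge j)) (proj₁ (vertex v)))
          (Fin.toℕ-injective (trans (Fin.toℕ-inject₁ j) (sym next))) (proj₁ (walk j)) }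
    -- The walk wraps around; `closed` identifies the last vertex with the first only up to
    -- pointwise equality.
    join i zero (inj₂ (last , _)) = record
      { vertex = proj₁ (vertex zero)
      ; end = isEnd-resp (proj₁ (edge i)) (proj₁ (vertex (suc i))) (proj₁ (vertex zero))
          (subst (λ v → proj₁ (vertex v) ≈ᶜ proj₁ (vertex zero))
            (Fin.toℕ-injective (trans (Fin.toℕ-fromℕ L) (sym last))) closed)
          (proj₂ (walk i))
      ; beginning = proj₁ (walk zero) }

    lap-linked : ∀ t → Linked (lap t) (lap (suc t))
    lap-linked t = join (at t) (at (suc t)) (byPosition (ℕ.m≤n⇒m<n∨m≡n (stop t)))
      where
      byPosition : suc (t ℕ.% L) ℕ.< L ⊎ suc (t ℕ.% L) ≡ L →
                   suc (toℕ (at t)) ≡ toℕ (at (suc t)) ⊎ (suc (toℕ (at t)) ≡ L × toℕ (at (suc t)) ≡ 0)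
      byPosition (inj₁ lt) = inj₁ (trans (cong suc (toℕ-at t))
        (sym (trans (toℕ-at (suc t)) (trans (suc-% t L) (ℕ.m<n⇒m%n≡m lt)))))
      byPosition (inj₂ eq) = inj₂ (trans (cong suc (toℕ-at t)) eq ,
        trans (toℕ-at (suc t)) (trans (suc-% t L) (trans (cong (ℕ._% L) eq) (ℕ.n%n≡0 L))))

    lap-periodic : ∀ t → lap (L ℕ.+ t) ≡ lap t
    lap-periodic t = cong (λ i → proj₁ (edge i)) (at-≡ (L ℕ.+ t) (at t)
      (trans (trans (cong (ℕ._% L) (ℕ.+-comm L t)) (ℕ.[m+n]%n≡m%n t L)) (sym (toℕ-at t))))

    hits-lap : ∀ π → hits π lap L ≡ patternCount 2≤n C π
    hits-lap π = begin
      hits π lap L                                                              ≡⟨ hits≡count π lap L ⟩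
      count (λ t → π ≟ₚ proj₁ (lap t)) (List.upTo L)
        ≡⟨ cong (count (λ t → π ≟ₚ proj₁ (lap t))) (trans (applyUpTo≡tabulate id L) (sym (List.map-tabulate id toℕ))) ⟩
      count (λ t → π ≟ₚ proj₁ (lap t)) (List.map toℕ (List.allFin L))
        ≡⟨ count-map (λ t → π ≟ₚ proj₁ (lap t)) toℕ (List.allFin L) ⟩
      count (λ i → π ≟ₚ proj₁ (lap (toℕ i))) (List.allFin L)
        ≡⟨ count-cong (λ i → π ≟ₚ proj₁ (lap (toℕ i))) (λ i → π ≟ₚ proj₁ (proj₁ (edge i))) (List.allFin L)
            (λ i _ → subst (λ x → π Perm.≈ proj₁ x) (lap≡ i)) (λ i _ → subst (λ x → π Perm.≈ proj₁ x) (sym (lap≡ i))) ⟩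
      patternCount 2≤n C π                                                      ∎
      where
      open ≡-Reasoning
      lap≡ : ∀ i → lap (toℕ i) ≡ proj₁ (edge i)
      lap≡ i = cong (λ j → proj₁ (edge j)) (at-≡ (toℕ i) i (ℕ.m<n⇒m%n≡m (Fin.toℕ<n i)))

    hits-laps : ∀ π a → hits π lap (a ℕ.* L) ≡ a ℕ.* patternCount 2≤n C π
    hits-laps π zero    = refl
    hits-laps π (suc a) = trans (hits-+ π lap L (a ℕ.* L)) (cong₂ ℕ._+_ (hits-lap π)
      (trans (hits-cong π (λ t → lap (L ℕ.+ t)) lap (a ℕ.* L) lap-periodic) (hits-laps π a)))

  cyclicWalk : Σ[ E ∈ (ℕ → ColouredPerm (suc k′)) ] (∀ t → Consistent n (E t)) × (∀ t → Linked (E t) (E (suc t))) ×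
               (∀ π a → hits π E (a ℕ.* cycleLength 2≤n C) ≡ a ℕ.* patternCount 2≤n C π)
  cyclicWalk = lap , lap-consistent , lap-linked , hits-laps

  patternCount≤length : ∀ π → patternCount 2≤n C π ℕ.≤ cycleLength 2≤n C
  patternCount≤length π = ℕ.≤-trans (List.length-filter (λ i → π ≟ₚ proj₁ (proj₁ (edge i))) (List.allFin L)) (ℕ.≤-reflexive (List.length-tabulate {n = L} id))

total-cong : ∀ {r} {f g : Vector ℕ r} → f ≗ g → total f ≡ total g
total-cong {zero}  f≗g = refl
total-cong {suc r} f≗g = cong₂ ℕ._+_ (f≗g zero) (total-cong (f≗g ∘ suc))

total-+ : ∀ {r} (f g : Vector ℕ r) → total (λ i → f i ℕ.+ g i) ≡ total f ℕ.+ total g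
total-+ {zero}  f g = refl
total-+ {suc r} f g = trans (cong (f zero ℕ.+ g zero ℕ.+_) (total-+ (f ∘ suc) (g ∘ suc))) (swap (f zero) (g zero) _ _)
  where
  swap : ∀ a b c d → a ℕ.+ b ℕ.+ (c ℕ.+ d) ≡ a ℕ.+ c ℕ.+ (b ℕ.+ d)
  swap = solve-∀

total≡∑ℚ : ∀ {r} (f : Vector ℕ r) → ι (total f) ≡ ∑ℚ (ι ∘ f)
total≡∑ℚ {zero}  f = ι-0
total≡∑ℚ {suc r} f = trans (ι-+ (f zero) (total (f ∘ suc))) (cong (ι (f zero) ℚ.+_) (total≡∑ℚ (f ∘ suc)))

-- A word going a i times around each cycle.
record Tour {n : ℕ} (2≤n : 2 ℕ.≤ n) {k′ r : ℕ} (C : Vector (SimpleCycle (𝒪v n (suc k′))) r) (a : Vector ℕ r) : Set where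
  field
    sz    : ℕ
    word  : Word n sz
    size≡ : sz ≡ total (λ i → a i ℕ.* cycleLength 2≤n (C i)) ℕ.+ (total {r} (λ _ → suc k′) ℕ.+ (n ∸ 1))
    lower : ∀ π → total (λ i → a i ℕ.* patternCount 2≤n (C i) π) ℕ.≤ occurrences π word
    upper : ∀ π → occurrences π word ℕ.≤ total (λ i → a i ℕ.* patternCount 2≤n (C i) π) ℕ.+ (total {r} (λ _ → suc k′) ℕ.+ (n ∸ 1))

tour : ∀ {n} (2≤n : 2 ℕ.≤ n) {k′ r} (C : Vector (SimpleCycle (𝒪v n (suc k′))) r) a → Tour 2≤n C a
tour {n} 2≤n {k′} {r} C a = record
  { sz    = X.size
  ; word  = X.word
  ; size≡ = trans X.size≡ (regroup (λ i → a i ℕ.* cycleLength 2≤n (C i)))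
  ; lower = λ π → ℕ.≤-trans (ℕ.≤-reflexive (sym (total-cong (laps π)))) (X.lower π)
  ; upper = λ π → ℕ.≤-trans (X.upper π) (ℕ.≤-reflexive (trans (regroup (λ i → hits π (E i) (u i)))
      (cong (ℕ._+ (total {r} (λ _ → suc k′) ℕ.+ (n ∸ 1))) (total-cong (laps π)))))
  }
  where
  E : Fin r → ℕ → ColouredPerm (suc k′)
  E i = proj₁ (cyclicWalk 2≤n (C i))
  u : Fin r → ℕ
  u i = a i ℕ.* cycleLength 2≤n (C i)
  module X = Concatenation (concatenation (ℕ.<⇒≤ 2≤n) E (λ i → proj₁ (proj₂ (cyclicWalk 2≤n (C i))))
    (λ i → proj₁ (proj₂ (proj₂ (cyclicWalk 2≤n (C i))))) u)
  laps : ∀ π i → hits π (E i) (u i) ≡ a i ℕ.* patternCount 2≤n (C i) π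
  laps π i = proj₂ (proj₂ (proj₂ (cyclicWalk 2≤n (C i)))) π (a i)
  regroup : ∀ f → total (λ i → f i ℕ.+ suc k′) ℕ.+ (n ∸ 1) ≡ total f ℕ.+ (total {r} (λ _ → suc k′) ℕ.+ (n ∸ 1))
  regroup f = trans (cong (ℕ._+ (n ∸ 1)) (total-+ f (λ _ → suc k′))) (ℕ.+-assoc (total f) _ (n ∸ 1))

-- Every mixture is feasible

0≤+ : ∀ {p q} → 0ℚ ℚ.≤ p → 0ℚ ℚ.≤ q → 0ℚ ℚ.≤ p ℚ.+ q
0≤+ {p} {q} 0≤p 0≤q = subst (ℚ._≤ p ℚ.+ q) (ℚ.+-identityʳ 0ℚ) (ℚ.+-mono-≤ 0≤p 0≤q)

0≤½ : 0ℚ ℚ.≤ ½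
0≤½ = ℚ.nonNegative⁻¹ ½

½≤1 : ½ ℚ.≤ 1ℚ
½≤1 = p≤q-by 0≤½

0≤2 : 0ℚ ℚ.≤ 1ℚ ℚ.+ 1ℚ
0≤2 = ℚ.nonNegative⁻¹ (1ℚ ℚ.+ 1ℚ)

ι-cancel-≤ : ∀ {a b} → ι a ℚ.≤ ι b → a ℕ.≤ b
ι-cancel-≤ {a} {b} ιa≤ιb = ℕ.≮⇒≥ λ b<a → ℚ.<-irrefl refl (ℚ.<-≤-trans (ι-mono-< b<a) ιa≤ιb)

natFloor : ∀ q → 0ℚ ℚ.≤ q → ∃[ a ] (ι a ℚ.≤ q × q ℚ.≤ ι a ℚ.+ 1ℚ)
natFloor q 0≤q = go (proj₁ (archimedean q)) (proj₂ (archimedean q))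
  where
  go : ∀ N → q ℚ.< ι N → ∃[ a ] (ι a ℚ.≤ q × q ℚ.≤ ι a ℚ.+ 1ℚ)
  go zero    q<0 = contradiction (ℚ.<-≤-trans q<0 (subst (ℚ._≤ q) (sym ι-0) 0≤q)) (ℚ.<-irrefl refl)
  go (suc N) q<1+N with ι N ℚ.≤? q
  ... | yes N≤q = N , N≤q , ℚ.<⇒≤ (subst (q ℚ.<_) (trans (cong ι (ℕ.+-comm 1 N)) (trans (ι-+ N 1) (cong (ι N ℚ.+_) ι-1))) q<1+N)
  ... | no  N≰q = go N (ℚ.≰⇒> N≰q)

∣*∣≤ : ∀ {x c y} → ℚ.∣ x ∣ ℚ.≤ c → 0ℚ ℚ.≤ y → ℚ.∣ x ℚ.* y ∣ ℚ.≤ c ℚ.* y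
∣*∣≤ {x} {c} {y} x≤c 0≤y = begin
  ℚ.∣ x ℚ.* y ∣           ≡⟨ ℚ.∣p*q∣≡∣p∣*∣q∣ x y ⟩
  ℚ.∣ x ∣ ℚ.* ℚ.∣ y ∣     ≡⟨ cong (ℚ.∣ x ∣ ℚ.*_) (ℚ.0≤p⇒∣p∣≡p 0≤y) ⟩
  ℚ.∣ x ∣ ℚ.* y           ≤⟨ ℚ.*-monoʳ-≤-nonNeg y {{ℚ.nonNegative 0≤y}} x≤c ⟩
  c ℚ.* y                 ∎
  where open ℚ.≤-Reasoning

∑ℚ-mono : ∀ {r} {f g : Vector ℚ r} → (∀ i → f i ℚ.≤ g i) → ∑ℚ f ℚ.≤ ∑ℚ g
∑ℚ-mono {zero}  f≤g = ℚ.≤-refl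
∑ℚ-mono {suc r} f≤g = ℚ.+-mono-≤ (f≤g zero) (∑ℚ-mono (f≤g ∘ suc))

≋-∑ℚ : ∀ {r} (f g : Fin r → ℕ → ℚ) → (∀ i → f i ≋ g i) → (λ m → ∑ℚ (λ i → f i m)) ≋ (λ m → ∑ℚ (λ i → g i m))
≋-∑ℚ {zero}  f g f≋g = ≋-≡ {λ _ → 0ℚ} {λ _ → 0ℚ} λ _ → refl
≋-∑ℚ {suc r} f g f≋g = ≋-+ {f zero} {g zero} {λ m → ∑ℚ (λ i → f (suc i) m)} {λ m → ∑ℚ (λ i → g (suc i) m)}
  (f≋g zero) (≋-∑ℚ (f ∘ suc) (g ∘ suc) (f≋g ∘ suc))

≋-* : ∀ {a b} ρ → 0ℚ ℚ.≤ ρ → ρ ℚ.≤ 1ℚ → a ≋ b → (λ m → a m ℚ.* ρ) ≋ (λ m → b m ℚ.* ρ)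
≋-* {a} {b} ρ 0≤ρ ρ≤1 a≋b ε 0<ε with a≋b ε 0<ε
... | N , close = N , λ m N≤m → begin
  ℚ.∣ a m ℚ.* ρ ℚ.- b m ℚ.* ρ ∣      ≡⟨ cong ℚ.∣_∣ (factor (a m) (b m) ρ) ⟩
  ℚ.∣ (a m ℚ.- b m) ℚ.* ρ ∣          ≤⟨ ∣*∣≤ (close m N≤m) 0≤ρ ⟩
  ε ℚ.* ρ                            ≤⟨ ℚ.*-monoˡ-≤-nonNeg ε {{ℚ.nonNegative (ℚ.<⇒≤ 0<ε)}} ρ≤1 ⟩
  ε ℚ.* 1ℚ                           ≡⟨ ℚ.*-identityʳ ε ⟩
  ε                                  ∎
  where
  open ℚ.≤-Reasoning
  factor : ∀ a b ρ → a ℚ.* ρ ℚ.- b ℚ.* ρ ≡ (a ℚ.- b) ℚ.* ρ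
  factor = solve 3 (λ a b ρ → a :* ρ :- b :* ρ := (a :- b) :* ρ) refl where open ℚ.+-*-Solver

-- N / D is close to q when N and D are within B of m q and m s, with s close to 1.
module _ (N D m q s B η : ℚ) (0≤m : 0ℚ ℚ.≤ m) (0≤q : 0ℚ ℚ.≤ q) (q≤2 : q ℚ.≤ 1ℚ ℚ.+ 1ℚ) (0≤η : 0ℚ ℚ.≤ η)
         (N≈ : ℚ.∣ N ℚ.- m ℚ.* q ∣ ℚ.≤ B) (D≈ : ℚ.∣ D ℚ.- m ℚ.* s ∣ ℚ.≤ B)
         (s≈½ : ℚ.∣ s ℚ.- 1ℚ ∣ ℚ.≤ ½) where
  private
    0≤B : 0ℚ ℚ.≤ B
    0≤B = ℚ.≤-trans (ℚ.0≤∣p∣ (N ℚ.- m ℚ.* q)) N≈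

    ms≤ : m ℚ.* s ℚ.≤ D ℚ.+ B
    ms≤ = dist≤⇒≤ {m ℚ.* s} {D} {B} (subst (ℚ._≤ B) (dist-sym D (m ℚ.* s)) D≈)

    1≤ : 1ℚ ℚ.≤ s ℚ.+ ½
    1≤ = dist≤⇒≤ {1ℚ} {s} {½} (subst (ℚ._≤ ½) (dist-sym s 1ℚ) s≈½)

  -- From `m s ≤ D + B` and `s ≥ ½`.
  scale≤ : m ℚ.≤ (1ℚ ℚ.+ 1ℚ) ℚ.* (D ℚ.+ B)
  scale≤ = p≤q-by (subst (0ℚ ℚ.≤_) (identity D B m s)
    (0≤+ (*-nonNeg 0≤2 (0≤q-p ms≤)) (*-nonNeg (*-nonNeg 0≤2 0≤m) (0≤q-p 1≤))))
    where
    identity : ∀ D B m s → (1ℚ ℚ.+ 1ℚ) ℚ.* (D ℚ.+ B ℚ.- m ℚ.* s) ℚ.+ (1ℚ ℚ.+ 1ℚ) ℚ.* m ℚ.* (s ℚ.+ ½ ℚ.- 1ℚ) ≡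
                           (1ℚ ℚ.+ 1ℚ) ℚ.* (D ℚ.+ B) ℚ.- m
    identity = solve 4 (λ D B m s →
      (con 1ℚ :+ con 1ℚ) :* (D :+ B :- m :* s) :+ (con 1ℚ :+ con 1ℚ) :* m :* (s :+ con ½ :- con 1ℚ) :=
      (con 1ℚ :+ con 1ℚ) :* (D :+ B) :- m) refl where open ℚ.+-*-Solver

  -- `N` differs from `m q` by at most `B`, and `m` from `D` by at most `B + m η`. As `q ≤ 2`, the
  -- total error is at most `3 B + 2 m η`, and `scale≤` turns `m` into `2 (D + B)`.
  ratioClose : ℚ.∣ s ℚ.- 1ℚ ∣ ℚ.≤ η →
    ℚ.∣ N ℚ.- D ℚ.* q ∣ ℚ.≤ (1ℚ ℚ.+ 1ℚ ℚ.+ 1ℚ) ℚ.* B ℚ.+ (1ℚ ℚ.+ 1ℚ) ℚ.* (1ℚ ℚ.+ 1ℚ) ℚ.* η ℚ.* (D ℚ.+ B)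
  ratioClose s≈ = ℚ.≤-trans (dist-triangle N (m ℚ.* q) (D ℚ.* q) N≈ mq≈Dq)
    (p≤q-by (subst (0ℚ ℚ.≤_) (identity D B m q η)
      (0≤+ (*-nonNeg (0≤+ 0≤B (*-nonNeg 0≤m 0≤η)) (0≤q-p q≤2)) (*-nonNeg (*-nonNeg 0≤2 0≤η) (0≤q-p scale≤)))))
    where
    ms≈m : ℚ.∣ m ℚ.* s ℚ.- m ∣ ℚ.≤ m ℚ.* η
    ms≈m = subst₂ ℚ._≤_ (cong ℚ.∣_∣ (factor m s)) (ℚ.*-comm η m) (∣*∣≤ s≈ 0≤m)
      where
      factor : ∀ m s → (s ℚ.- 1ℚ) ℚ.* m ≡ m ℚ.* s ℚ.- m
      factor = solve 2 (λ m s → (s :- con 1ℚ) :* m := m :* s :- m) refl where open ℚ.+-*-Solver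
    D≈m : ℚ.∣ D ℚ.- m ∣ ℚ.≤ B ℚ.+ m ℚ.* η
    D≈m = dist-triangle D (m ℚ.* s) m D≈ ms≈m
    mq≈Dq : ℚ.∣ m ℚ.* q ℚ.- D ℚ.* q ∣ ℚ.≤ (B ℚ.+ m ℚ.* η) ℚ.* q
    mq≈Dq = subst (ℚ._≤ (B ℚ.+ m ℚ.* η) ℚ.* q) (trans (cong ℚ.∣_∣ (factor D m q)) (dist-sym (D ℚ.* q) (m ℚ.* q))) (∣*∣≤ D≈m 0≤q)
      where
      factor : ∀ D m q → (D ℚ.- m) ℚ.* q ≡ D ℚ.* q ℚ.- m ℚ.* q
      factor = solve 3 (λ D m q → (D :- m) :* q := D :* q :- m :* q) refl where open ℚ.+-*-Solver
    identity : ∀ D B m q η →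
      (B ℚ.+ m ℚ.* η) ℚ.* (1ℚ ℚ.+ 1ℚ ℚ.- q) ℚ.+ (1ℚ ℚ.+ 1ℚ) ℚ.* η ℚ.* ((1ℚ ℚ.+ 1ℚ) ℚ.* (D ℚ.+ B) ℚ.- m) ≡
      ((1ℚ ℚ.+ 1ℚ ℚ.+ 1ℚ) ℚ.* B ℚ.+ (1ℚ ℚ.+ 1ℚ) ℚ.* (1ℚ ℚ.+ 1ℚ) ℚ.* η ℚ.* (D ℚ.+ B)) ℚ.- (B ℚ.+ (B ℚ.+ m ℚ.* η) ℚ.* q)
    identity = solve 5 (λ D B m q η →
      (B :+ m :* η) :* (con 1ℚ :+ con 1ℚ :- q) :+ (con 1ℚ :+ con 1ℚ) :* η :* ((con 1ℚ :+ con 1ℚ) :* (D :+ B) :- m) :=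
      ((con 1ℚ :+ con 1ℚ :+ con 1ℚ) :* B :+ (con 1ℚ :+ con 1ℚ) :* (con 1ℚ :+ con 1ℚ) :* η :* (D :+ B)) :- (B :+ (B :+ m :* η) :* q))
      refl where open ℚ.+-*-Solver

-- Rounding the scaled weights down costs at most one lap per cycle.
sandwich : ∀ {N S K Λ : ℕ} {X : ℚ} → S ℕ.≤ N → N ℕ.≤ S ℕ.+ K → ι S ℚ.≤ X → X ℚ.≤ ι S ℚ.+ ι Λ →
           ℚ.∣ ι N ℚ.- X ∣ ℚ.≤ ι (Λ ℕ.+ K)
sandwich {N} {S} {K} {Λ} {X} S≤N N≤S+K S≤X X≤S+Λ = dist≤
  (begin
    ι N                     ≤⟨ ι-mono-≤ N≤S+K ⟩
    ι (S ℕ.+ K)             ≡⟨ ι-+ S K ⟩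
    ι S ℚ.+ ι K             ≤⟨ ℚ.+-mono-≤ S≤X (ι-mono-≤ (ℕ.m≤n+m K Λ)) ⟩
    X ℚ.+ ι (Λ ℕ.+ K)       ∎)
  (begin
    X                       ≤⟨ X≤S+Λ ⟩
    ι S ℚ.+ ι Λ             ≤⟨ ℚ.+-mono-≤ (ι-mono-≤ S≤N) (ι-mono-≤ (ℕ.m≤m+n Λ K)) ⟩
    ι N ℚ.+ ι (Λ ℕ.+ K)     ∎)
  where open ℚ.≤-Reasoning

frequency : ∀ {n k} → Permutation′ k → Av (↘ n) → ℚ
frequency π σ = c-occ {{nonEmpty σ}} π (perm σ)

frequency-size : ∀ {n k} (π : Permutation′ k) (σ : Av (↘ n)) →
                 frequency π σ ℚ.* ι (size σ) ≡ ι (count (occursAt? π (perm σ)) (List.upTo (size σ)))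
frequency-size π σ = fraction-cancel (count (occursAt? π (perm σ)) (List.upTo (size σ))) (size σ) {{nonEmpty σ}}

0<size : ∀ {n} (σ : Av (↘ n)) → 0ℚ ℚ.< ι (size σ)
0<size σ = subst (ℚ._< ι (size σ)) ι-0 (ι-mono-< (ℕ.>-nonZero⁻¹ (size σ) {{nonEmpty σ}}))

0≤frequency : ∀ {n k} (π : Permutation′ k) (σ : Av (↘ n)) → 0ℚ ℚ.≤ frequency π σ
0≤frequency π σ = *-nonNeg-cancel (0<size σ) (subst (0ℚ ℚ.≤_)
  (trans (sym (frequency-size π σ)) (ℚ.*-comm (frequency π σ) (ι (size σ)))) (0≤ι _))

frequency≤1 : ∀ {n k} (π : Permutation′ k) (σ : Av (↘ n)) → frequency π σ ℚ.≤ 1ℚ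
frequency≤1 π σ = ℚ.*-cancelʳ-≤-pos (ι (size σ)) {{ℚ.positive (0<size σ)}}
  (subst₂ ℚ._≤_ (sym (frequency-size π σ)) (sym (ℚ.*-identityˡ (ι (size σ))))
    (ι-mono-≤ (ℕ.≤-trans (List.length-filter (occursAt? π (perm σ)) (List.upTo (size σ))) (ℕ.≤-reflexive (List.length-upTo (size σ))))))

feasible-bounds : ∀ {n k} (π : Permutation′ k) (σ : ℕ → Av (↘ n)) (x : ℝ) → (λ i → frequency π (σ i)) ≋ approx x →
                  (0ℝ ≤ x) × (x ≤ 1ℝ)
feasible-bounds π σ x close =
  (λ ε 0<ε → let N , h = close ε 0<ε in N , λ i N≤i → ℚ.≤-trans (0≤frequency π (σ i)) (dist≤⇒≤ {frequency π (σ i)} {approx x i} {ε} (h i N≤i))) ,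
  (λ ε 0<ε → let N , h = close ε 0<ε in N , λ i N≤i → ℚ.≤-trans
    (dist≤⇒≤ {approx x i} {frequency π (σ i)} {ε} (subst (ℚ._≤ ε) (dist-sym (frequency π (σ i)) (approx x i)) (h i N≤i)))
    (ℚ.+-monoˡ-≤ ε (frequency≤1 π (σ i))))

module _ {n : ℕ} (2≤n : 2 ℕ.≤ n) {k′ r : ℕ} (C : Vector (SimpleCycle (𝒪v n (suc k′))) r) (w : Vector ℝ r)
         (0≤w : ∀ i → 0ℝ ≤ w i) (∑w≈1 : ∑ w ≈ 1ℝ) where
  private
    L : Fin r → ℕ
    L i = cycleLength 2≤n (C i)
    U : Fin r → ℚ
    U i = unitRate 2≤n (C i)

    UL≡1 : ∀ i → ι (L i) ℚ.* U i ≡ 1ℚ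
    UL≡1 i = trans (ℚ.*-comm (ι (L i)) (U i)) (unitRate-length 2≤n (C i))

    0≤U : ∀ i → 0ℚ ℚ.≤ U i
    0≤U i = *-nonNeg-cancel {ι (L i)} (subst (ℚ._< ι (L i)) ι-0 (ι-mono-< (s≤s z≤n)))
      (subst (0ℚ ℚ.≤_) (sym (UL≡1 i)) (ℚ.nonNegative⁻¹ 1ℚ))

    -- A nonnegative real may have negative approximations, and a number of laps must not be
    -- negative. The clipped weights need not add up to 1; their sum `s` merely tends to 1.
    W : Fin r → ℕ → ℚ
    W i m = 0ℚ ℚ.⊔ approx (w i) m

    0≤W : ∀ i m → 0ℚ ℚ.≤ W i m
    0≤W i m = ℚ.p≤p⊔q 0ℚ (approx (w i) m)

    W≋w : ∀ i → W i ≋ approx (w i)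
    W≋w i ε 0<ε = proj₁ (0≤w i ε 0<ε) , λ m N≤m → dist≤ {W i m} {approx (w i) m} {ε}
      (ℚ.⊔-lub (proj₂ (0≤w i ε 0<ε) m N≤m) (weaken (approx (w i) m)))
      (ℚ.≤-trans (ℚ.p≤q⊔p 0ℚ (approx (w i) m)) (weaken (W i m)))
      where
      weaken : ∀ x → x ℚ.≤ x ℚ.+ ε
      weaken x = subst (ℚ._≤ x ℚ.+ ε) (ℚ.+-identityʳ x) (ℚ.+-monoʳ-≤ x (ℚ.<⇒≤ 0<ε))

    s : ℕ → ℚ
    s m = ∑ℚ (λ i → W i m)

    s≋1 : s ≋ (λ _ → 1ℚ)
    s≋1 = ≋-trans {s} {w̄} {λ _ → 1ℚ} (≋-∑ℚ W (λ i → approx (w i)) W≋w)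
      (≋-trans {w̄} {approx (∑ w)} {λ _ → 1ℚ} (≋-≡ {w̄} {approx (∑ w)} λ m → sym (approx-∑ w m)) ∑w≈1)
      where
      w̄ : ℕ → ℚ
      w̄ m = ∑ℚ (λ i → approx (w i) m)

    -- One lap of `C i` takes `L i` entries and `U i` is the reciprocal of `L i`, so this many laps
    -- fill about `m W` places: the share of the cycle in a word of length about `m`.
    lapsOf : ∀ m i → ∃[ a ] (ι a ℚ.≤ ι m ℚ.* (W i m ℚ.* U i) × ι m ℚ.* (W i m ℚ.* U i) ℚ.≤ ι a ℚ.+ 1ℚ)
    lapsOf m i = natFloor (ι m ℚ.* (W i m ℚ.* U i)) (*-nonNeg (0≤ι m) (*-nonNeg (0≤W i m) (0≤U i)))

    a : ℕ → Fin r → ℕ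
    a m i = proj₁ (lapsOf m i)

    module _ (m : ℕ) (g : Fin r → ℕ) (g≤L : ∀ i → g i ℕ.≤ L i) where

      -- With `g` the pattern counts of the cycles, the bounds below estimate the occurrences; with
      -- `g = L` they estimate the size of the word.
      weighted : ℚ
      weighted = ∑ℚ (λ i → W i m ℚ.* (ι (g i) ℚ.* U i))

      rearrange : ∀ m w u g → m ℚ.* (w ℚ.* u) ℚ.* g ≡ m ℚ.* (w ℚ.* (g ℚ.* u))
      rearrange = solve 4 (λ m w u g → m :* (w :* u) :* g := m :* (w :* (g :* u))) refl where open ℚ.+-*-Solver

      S≤ : ι (total (λ i → a m i ℕ.* g i)) ℚ.≤ ι m ℚ.* weighted
      S≤ = begin
        ι (total (λ i → a m i ℕ.* g i))                                ≡⟨ total≡∑ℚ (λ i → a m i ℕ.* g i) ⟩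
        ∑ℚ (λ i → ι (a m i ℕ.* g i))                                   ≤⟨ ∑ℚ-mono term ⟩
        ∑ℚ (λ i → ι m ℚ.* (W i m ℚ.* (ι (g i) ℚ.* U i)))               ≡⟨ ∑ℚ-*ˡ (ι m) (λ i → W i m ℚ.* (ι (g i) ℚ.* U i)) ⟩
        ι m ℚ.* weighted                                               ∎
        where
        open ℚ.≤-Reasoning
        term : ∀ i → ι (a m i ℕ.* g i) ℚ.≤ ι m ℚ.* (W i m ℚ.* (ι (g i) ℚ.* U i))
        term i = subst₂ ℚ._≤_ (sym (ι-* (a m i) (g i))) (rearrange (ι m) (W i m) (U i) (ι (g i)))
          (ℚ.*-monoʳ-≤-nonNeg (ι (g i)) {{ℚ.nonNegative (0≤ι (g i))}} (proj₁ (proj₂ (lapsOf m i))))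

      ≤S+Λ : ι m ℚ.* weighted ℚ.≤ ι (total (λ i → a m i ℕ.* g i)) ℚ.+ ι (total L)
      ≤S+Λ = begin
        ι m ℚ.* weighted                                               ≡⟨ ∑ℚ-*ˡ (ι m) (λ i → W i m ℚ.* (ι (g i) ℚ.* U i)) ⟨
        ∑ℚ (λ i → ι m ℚ.* (W i m ℚ.* (ι (g i) ℚ.* U i)))               ≤⟨ ∑ℚ-mono term ⟩
        ∑ℚ (λ i → ι (a m i ℕ.* g i) ℚ.+ ι (L i))                       ≡⟨ ∑ℚ-+ (λ i → ι (a m i ℕ.* g i)) (λ i → ι (L i)) ⟩
        ∑ℚ (λ i → ι (a m i ℕ.* g i)) ℚ.+ ∑ℚ (λ i → ι (L i))
          ≡⟨ cong₂ ℚ._+_ (total≡∑ℚ (λ i → a m i ℕ.* g i)) (total≡∑ℚ L) ⟨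
        ι (total (λ i → a m i ℕ.* g i)) ℚ.+ ι (total L)                ∎
        where
        open ℚ.≤-Reasoning
        term : ∀ i → ι m ℚ.* (W i m ℚ.* (ι (g i) ℚ.* U i)) ℚ.≤ ι (a m i ℕ.* g i) ℚ.+ ι (L i)
        term i = begin
          ι m ℚ.* (W i m ℚ.* (ι (g i) ℚ.* U i))         ≡⟨ rearrange (ι m) (W i m) (U i) (ι (g i)) ⟨
          ι m ℚ.* (W i m ℚ.* U i) ℚ.* ι (g i)
            ≤⟨ ℚ.*-monoʳ-≤-nonNeg (ι (g i)) {{ℚ.nonNegative (0≤ι (g i))}} (proj₂ (proj₂ (lapsOf m i))) ⟩
          (ι (a m i) ℚ.+ 1ℚ) ℚ.* ι (g i)
            ≡⟨ trans (ℚ.*-distribʳ-+ (ι (g i)) (ι (a m i)) 1ℚ) (cong₂ ℚ._+_ (sym (ι-* (a m i) (g i))) (ℚ.*-identityˡ (ι (g i)))) ⟩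
          ι (a m i ℕ.* g i) ℚ.+ ι (g i)                 ≤⟨ ℚ.+-monoʳ-≤ (ι (a m i ℕ.* g i)) (ι-mono-≤ (g≤L i)) ⟩
          ι (a m i ℕ.* g i) ℚ.+ ι (L i)                 ∎

    module T (m : ℕ) = Tour (tour 2≤n C (a m))

    K : ℕ
    K = total {r} (λ _ → suc k′) ℕ.+ (n ∸ 1)

    -- Rounding down the laps loses at most `total L`; the initial word and the entries spent on
    -- entering each cycle are covered by `K`. Neither depends on `m`.
    B : ℚ
    B = ι (total L ℕ.+ K)

    0≤B : 0ℚ ℚ.≤ B
    0≤B = 0≤ι (total L ℕ.+ K)

    q : Permutation′ (suc k′) → ℕ → ℚ
    q π m = ∑ℚ (λ i → W i m ℚ.* rate 2≤n (C i) π)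

    N≈ : ∀ π m → ℚ.∣ ι (occurrences π (T.word m)) ℚ.- ι m ℚ.* q π m ∣ ℚ.≤ B
    N≈ π m = sandwich (T.lower m π) (T.upper m π) (S≤ m c c≤L) (≤S+Λ m c c≤L)
      where
      c : Fin r → ℕ
      c i = patternCount 2≤n (C i) π
      c≤L : ∀ i → c i ℕ.≤ L i
      c≤L i = patternCount≤length 2≤n (C i) π

    D≈ : ∀ m → ℚ.∣ ι (T.sz m) ℚ.- ι m ℚ.* s m ∣ ℚ.≤ B
    D≈ m = sandwich (ℕ.≤-trans (ℕ.m≤m+n (total (λ i → a m i ℕ.* L i)) K) (ℕ.≤-reflexive (sym (T.size≡ m)))) (ℕ.≤-reflexive (T.size≡ m))
      (subst (λ x → ι (total (λ i → a m i ℕ.* L i)) ℚ.≤ ι m ℚ.* x) full (S≤ m L (λ _ → ℕ.≤-refl)))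
      (subst (λ x → ι m ℚ.* x ℚ.≤ ι (total (λ i → a m i ℕ.* L i)) ℚ.+ ι (total L)) full (≤S+Λ m L (λ _ → ℕ.≤-refl)))
      where
      full : weighted m L (λ _ → ℕ.≤-refl) ≡ s m
      full = ∑ℚ-cong λ i → trans (cong (W i m ℚ.*_) (UL≡1 i)) (ℚ.*-identityʳ (W i m))

    rate≤1 : ∀ π i → rate 2≤n (C i) π ℚ.≤ 1ℚ
    rate≤1 π i = subst (rate 2≤n (C i) π ℚ.≤_) (UL≡1 i)
      (ℚ.*-monoʳ-≤-nonNeg (U i) {{ℚ.nonNegative (0≤U i)}} (ι-mono-≤ (patternCount≤length 2≤n (C i) π)))

    0≤rate : ∀ π i → 0ℚ ℚ.≤ rate 2≤n (C i) π
    0≤rate π i = *-nonNeg (0≤ι (patternCount 2≤n (C i) π)) (0≤U i)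

    0≤∑ : ∀ {r} (f : Vector ℚ r) → (∀ i → 0ℚ ℚ.≤ f i) → 0ℚ ℚ.≤ ∑ℚ f
    0≤∑ {r} f 0≤f = subst (ℚ._≤ ∑ℚ f) (∑ℚ-0 r) (∑ℚ-mono 0≤f)

    0≤q : ∀ π m → 0ℚ ℚ.≤ q π m
    0≤q π m = 0≤∑ (λ i → W i m ℚ.* rate 2≤n (C i) π) λ i → *-nonNeg (0≤W i m) (0≤rate π i)

    q≤s : ∀ π m → q π m ℚ.≤ s m
    q≤s π m = ∑ℚ-mono λ i → subst (W i m ℚ.* rate 2≤n (C i) π ℚ.≤_) (ℚ.*-identityʳ (W i m))
      (ℚ.*-monoˡ-≤-nonNeg (W i m) {{ℚ.nonNegative (0≤W i m)}} (rate≤1 π i))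

    q≤2 : ∀ π m → ℚ.∣ s m ℚ.- 1ℚ ∣ ℚ.≤ ½ → q π m ℚ.≤ 1ℚ ℚ.+ 1ℚ
    q≤2 π m s≈ = ℚ.≤-trans (q≤s π m) (ℚ.≤-trans (dist≤⇒≤ {s m} {1ℚ} {½} s≈) (ℚ.+-monoʳ-≤ 1ℚ ½≤1))

  sequence : ℕ → Av (↘ n)
  sequence m = toAv (T.word m) (ℕ.<⇒≤ 2≤n)
    (subst (1 ℕ.≤_) (sym (T.size≡ m)) (ℕ.≤-trans (ℕ.∸-monoˡ-≤ 1 2≤n)
      (ℕ.≤-trans (ℕ.m≤n+m (n ∸ 1) (total {r} (λ _ → suc k′))) (ℕ.m≤n+m K (total (λ i → a m i ℕ.* L i))))))

  private
    halfTime : ∃[ M ] ∀ m → M ℕ.≤ m → ℚ.∣ s m ℚ.- 1ℚ ∣ ℚ.≤ ½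
    halfTime = s≋1 ½ (ℚ.positive⁻¹ ½)

    -- For `ι m` above `target`, the chain `2 (R + B) ≤ ι m ≤ 2 (D + B)` gives `R ≤ D`. The estimate
    -- `scale≤` comes with a pattern and its count, for which `Perm.id` is chosen.
    large : ∀ R → ∃[ M ] ∀ m → M ℕ.≤ m → R ℚ.≤ ι (T.sz m)
    large R = proj₁ halfTime ℕ.⊔ M , λ m le → p≤q-by (subst (0ℚ ℚ.≤_) (identity R B (ι (T.sz m)))
        (*-nonNeg 0≤½ (0≤q-p (ℚ.≤-trans (ℚ.<⇒≤ exceeds) (ℚ.≤-trans (ι-mono-≤ (ℕ.m⊔n≤o⇒n≤o (proj₁ halfTime) M le))
          (scale≤ (ι (occurrences Perm.id (T.word m))) (ι (T.sz m)) (ι m) (q Perm.id m) (s m) B ½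
             (0≤ι m) (0≤q Perm.id m) (q≤2 Perm.id m (half m le)) 0≤½ (N≈ Perm.id m) (D≈ m) (half m le)))))))
      where
      target = (1ℚ ℚ.+ 1ℚ) ℚ.* (R ℚ.+ B)
      M = proj₁ (archimedean target)
      exceeds = proj₂ (archimedean target)
      half : ∀ m → proj₁ halfTime ℕ.⊔ M ℕ.≤ m → ℚ.∣ s m ℚ.- 1ℚ ∣ ℚ.≤ ½
      half m le = proj₂ halfTime m (ℕ.m⊔n≤o⇒m≤o (proj₁ halfTime) M le)
      identity : ∀ R B D → ½ ℚ.* ((1ℚ ℚ.+ 1ℚ) ℚ.* (D ℚ.+ B) ℚ.- (1ℚ ℚ.+ 1ℚ) ℚ.* (R ℚ.+ B)) ≡ D ℚ.- R
      identity = solve 3 (λ R B D → con ½ :* ((con 1ℚ :+ con 1ℚ) :* (D :+ B) :- (con 1ℚ :+ con 1ℚ) :* (R :+ B)) := D :- R)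
        refl where open ℚ.+-*-Solver

    frequency≋q : ∀ π → (λ m → frequency π (sequence m)) ≋ q π
    frequency≋q π ε 0<ε = M₁ ℕ.⊔ (M₂ ℕ.⊔ M₃) , close
      where
      -- Since `4 η = h`, the bound of `ratioClose` equals `X + h D`. Once the size `D` is at least
      -- `R = X / h`, this is at most `2 h D = ε D`.
      h = ½ ℚ.* ε
      η = ½ ℚ.* (½ ℚ.* h)
      0<h = ½-pos 0<ε
      0<η = ½-pos (½-pos 0<h)
      instance
        h≢0 : ℚ.NonZero h
        h≢0 = ℚ.pos⇒nonZero h {{ℚ.positive 0<h}}
      X = (1ℚ ℚ.+ 1ℚ ℚ.+ 1ℚ) ℚ.* B ℚ.+ h ℚ.* B
      R = X ℚ.* ℚ.1/ h
      M₁ = proj₁ halfTime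
      M₂ = proj₁ (s≋1 η 0<η)
      M₃ = proj₁ (large R)
      close : ∀ m → M₁ ℕ.⊔ (M₂ ℕ.⊔ M₃) ℕ.≤ m → ℚ.∣ frequency π (sequence m) ℚ.- q π m ∣ ℚ.≤ ε
      close m le = ℚ.*-cancelʳ-≤-pos D {{ℚ.positive (0<size (sequence m))}} (begin
        ℚ.∣ f ℚ.- Q ∣ ℚ.* D                 ≡⟨ cong (ℚ.∣ f ℚ.- Q ∣ ℚ.*_) (ℚ.0≤p⇒∣p∣≡p (0≤ι (T.sz m))) ⟨
        ℚ.∣ f ℚ.- Q ∣ ℚ.* ℚ.∣ D ∣           ≡⟨ ℚ.∣p*q∣≡∣p∣*∣q∣ (f ℚ.- Q) D ⟨
        ℚ.∣ (f ℚ.- Q) ℚ.* D ∣               ≡⟨ cong ℚ.∣_∣ (trans (expand f Q D) (cong (ℚ._- D ℚ.* Q) fD≡N)) ⟩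
        ℚ.∣ N ℚ.- D ℚ.* Q ∣
          ≤⟨ ratioClose N D (ι m) Q (s m) B η (0≤ι m) (0≤q π m) (q≤2 π m half) (ℚ.<⇒≤ 0<η) (N≈ π m) (D≈ m) half
                                                 (proj₂ (s≋1 η 0<η) m (ℕ.≤-trans (ℕ.m≤m⊔n M₂ M₃) (ℕ.m⊔n≤o⇒n≤o M₁ (M₂ ℕ.⊔ M₃) le))) ⟩
        (1ℚ ℚ.+ 1ℚ ℚ.+ 1ℚ) ℚ.* B ℚ.+ (1ℚ ℚ.+ 1ℚ) ℚ.* (1ℚ ℚ.+ 1ℚ) ℚ.* η ℚ.* (D ℚ.+ B)
                                            ≡⟨ collect B D h ⟩
        X ℚ.+ h ℚ.* D                       ≤⟨ ℚ.+-monoˡ-≤ (h ℚ.* D) X≤hD ⟩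
        h ℚ.* D ℚ.+ h ℚ.* D                 ≡⟨ trans (sym (ℚ.*-distribʳ-+ D h h)) (cong (ℚ._* D) (½+½ ε)) ⟩
        ε ℚ.* D                             ∎)
        where
        open ℚ.≤-Reasoning
        f = frequency π (sequence m)
        Q = q π m
        D = ι (T.sz m)
        N = ι (occurrences π (T.word m))
        half : ℚ.∣ s m ℚ.- 1ℚ ∣ ℚ.≤ ½
        half = proj₂ halfTime m (ℕ.m⊔n≤o⇒m≤o M₁ (M₂ ℕ.⊔ M₃) le)
        fD≡N : f ℚ.* D ≡ N
        fD≡N = trans (frequency-size π (sequence m)) (cong ι (sym (occurrences≡count π (T.word m))))
        expand : ∀ f Q D → (f ℚ.- Q) ℚ.* D ≡ f ℚ.* D ℚ.- D ℚ.* Q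
        expand = solve 3 (λ f Q D → (f :- Q) :* D := f :* D :- D :* Q) refl where open ℚ.+-*-Solver
        collect : ∀ B D h → (1ℚ ℚ.+ 1ℚ ℚ.+ 1ℚ) ℚ.* B ℚ.+ (1ℚ ℚ.+ 1ℚ) ℚ.* (1ℚ ℚ.+ 1ℚ) ℚ.* (½ ℚ.* (½ ℚ.* h)) ℚ.* (D ℚ.+ B) ≡
                            (1ℚ ℚ.+ 1ℚ ℚ.+ 1ℚ) ℚ.* B ℚ.+ h ℚ.* B ℚ.+ h ℚ.* D
        collect = solve 3 (λ B D h →
          (con 1ℚ :+ con 1ℚ :+ con 1ℚ) :* B :+ (con 1ℚ :+ con 1ℚ) :* (con 1ℚ :+ con 1ℚ) :* (con ½ :* (con ½ :* h)) :* (D :+ B) :=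
          (con 1ℚ :+ con 1ℚ :+ con 1ℚ) :* B :+ h :* B :+ h :* D) refl where open ℚ.+-*-Solver
        X≤hD : X ℚ.≤ h ℚ.* D
        X≤hD = begin
          X                     ≡⟨ trans (cong (X ℚ.*_) (ℚ.*-inverseˡ h)) (ℚ.*-identityʳ X) ⟨
          X ℚ.* (ℚ.1/ h ℚ.* h)  ≡⟨ ℚ.*-assoc X (ℚ.1/ h) h ⟨
          R ℚ.* h               ≤⟨ ℚ.*-monoʳ-≤-nonNeg h {{ℚ.nonNegative (ℚ.<⇒≤ 0<h)}} (proj₂ (large R) m
                                     (ℕ.≤-trans (ℕ.m≤n⊔m M₂ M₃) (ℕ.m⊔n≤o⇒n≤o M₁ (M₂ ℕ.⊔ M₃) le))) ⟩
          D ℚ.* h               ≡⟨ ℚ.*-comm D h ⟩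
          h ℚ.* D               ∎

    q≋mixture : ∀ π → q π ≋ approx (mixture 2≤n C w π)
    q≋mixture π = ≋-trans {q π} {q̄} {approx (mixture 2≤n C w π)}
      (≋-∑ℚ (λ i m → W i m ℚ.* rate 2≤n (C i) π) (λ i m → approx (w i) m ℚ.* rate 2≤n (C i) π)
        (λ i → ≋-* {W i} {approx (w i)} (rate 2≤n (C i) π) (0≤rate π i) (rate≤1 π i) (W≋w i)))
      (≋-≡ {q̄} {approx (mixture 2≤n C w π)} λ m → sym (approx-combination w (λ i → rate 2≤n (C i) π) m))
      where
      q̄ : ℕ → ℚ
      q̄ m = ∑ℚ (λ i → approx (w i) m ℚ.* rate 2≤n (C i) π)

  sequence-size : ∀ M → ∃[ N ] ∀ i → N ℕ.≤ i → M ℕ.≤ size (sequence i)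
  sequence-size M = proj₁ (large (ι M)) , λ i le → ι-cancel-≤ (proj₂ (large (ι M)) i le)

  sequence-frequency : ∀ π → (λ m → frequency π (sequence m)) ≋ approx (mixture 2≤n C w π)
  sequence-frequency π = ≋-trans {λ m → frequency π (sequence m)} {q π} {approx (mixture 2≤n C w π)} (frequency≋q π) (q≋mixture π)

feasible : ∀ {n k} (v : Permutation′ k → ℝ) (σ : ℕ → Av (↘ n)) → (∀ M → ∃[ N ] ∀ i → N ℕ.≤ i → M ℕ.≤ size (σ i)) →
           (∀ π → (λ i → frequency π (σ i)) ≋ approx (v π)) → FeasibleRegion (↘ n) k v
feasible v σ grows close = (λ π → feasible-bounds π σ (v π) (close π)) , σ , grows ,
  λ π → ≋⇒tends {λ i → frequency π (σ i)} (v π) (close π)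

mixture⇒feasible : ∀ {n} (2≤n : 2 ℕ.≤ n) {k′} (v : Permutation′ (suc k′) → ℝ) → IsMixture 2≤n v → FeasibleRegion (↘ n) (suc k′) v
mixture⇒feasible 2≤n v (r , C , w , 0≤w , ∑w≈1 , values) =
  feasible v (sequence 2≤n C w 0≤w ∑w≈1) (sequence-size 2≤n C w 0≤w ∑w≈1) λ π →
    ≋-trans {λ m → frequency π (sequence 2≤n C w 0≤w ∑w≈1 m)} {approx (mixture 2≤n C w π)} {approx (v π)}
      (sequence-frequency 2≤n C w 0≤w ∑w≈1 π) (≋-sym {approx (v π)} {approx (mixture 2≤n C w π)} (values π))

-- The walk of coloured windows of a permutation

adjacent-windows : ∀ {k′ m i} {σ : Permutation′ m} {c : Colouring m} .(le : i ℕ.+ suc k′ ℕ.≤ m) .(le′ : suc i ℕ.+ suc k′ ℕ.≤ m)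
                   (x y : ColouredPerm (suc k′)) → IsColouredPattern (window i (suc k′) le) (σ , c) x →
                   IsColouredPattern (window (suc i) (suc k′) le′) (σ , c) y → IsEnd x (source y)
adjacent-windows {k′} {m} {i} {σ} {c} le le′ x y (x-pat , x-col) (y-pat , y-col) = end-le ,
  (λ a b → (λ lt → proj₂ (x-pat (end a) (end b)) (σ-< (same a) (same b) (proj₁ (y-pat (init a) (init b)) (proj₁ (beg-pat a b) lt)))) ,
           (λ lt → proj₂ (beg-pat a b) (proj₂ (y-pat (init a) (init b)) (σ-< (sym (same a)) (sym (same b)) (proj₁ (x-pat (end a) (end b)) lt))))) ,
  λ a → trans (beg-col a) (trans (y-col (init a)) (trans (cong c (same a)) (sym (x-col (end a)))))
  where
  end-le : (suc k′ ∸ k′) ℕ.+ k′ ℕ.≤ suc k′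
  end-le = ℕ.≤-reflexive (ℕ.m∸n+n≡m (ℕ.n≤1+n k′))
  beg-le = proj₁ (source-isBeginning y)
  beg-pat = proj₁ (proj₂ (source-isBeginning y))
  beg-col = proj₂ (proj₂ (source-isBeginning y))
  init end : Fin k′ → Fin (suc k′)
  init = window 0 k′ beg-le
  end = window (suc k′ ∸ k′) k′ end-le
  same : ∀ a → window (suc i) (suc k′) le′ (init a) ≡ window i (suc k′) le (end a)
  same a = Fin.toℕ-injective (begin
    toℕ (window (suc i) (suc k′) le′ (init a))   ≡⟨ toℕ-window (suc i) (suc k′) le′ (init a) ⟩
    suc i ℕ.+ toℕ (init a)                       ≡⟨ cong (suc i ℕ.+_) (toℕ-window 0 k′ beg-le a) ⟩
    suc i ℕ.+ toℕ a                              ≡⟨ ℕ.+-suc i (toℕ a) ⟨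
    i ℕ.+ suc (toℕ a)                            ≡⟨ cong (λ d → i ℕ.+ (d ℕ.+ toℕ a)) (ℕ.m+n∸n≡m 1 k′) ⟨
    i ℕ.+ (suc k′ ∸ k′ ℕ.+ toℕ a)                ≡⟨ cong (i ℕ.+_) (toℕ-window (suc k′ ∸ k′) k′ end-le a) ⟨
    i ℕ.+ toℕ (end a)                            ≡⟨ toℕ-window i (suc k′) le (end a) ⟨
    toℕ (window i (suc k′) le (end a))           ∎)
    where open ≡-Reasoning
  σ-< : ∀ {p q p′ q′} → p ≡ p′ → q ≡ q′ → σ ⟨$⟩ʳ p Fin.< σ ⟨$⟩ʳ q → σ ⟨$⟩ʳ p′ Fin.< σ ⟨$⟩ʳ q′
  σ-< refl refl lt = lt

count-applyUpTo : ∀ {A : Set} {P : A → Set} (P? : Decidable P) (f : ℕ → A) m →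
                  count P? (List.applyUpTo f m) ≡ count (P? ∘ f) (List.upTo m)
count-applyUpTo P? f m = trans (cong (count P?) (sym (List.map-upTo f m))) (count-map P? f (List.upTo m))

count-always : ∀ {A : Set} (xs : List A) → count {P = λ _ → ⊤} (λ _ → yes tt) xs ≡ List.length xs
count-always []       = refl
count-always (x ∷ xs) = cong suc (count-always xs)

module WindowWalk {n : ℕ} (2≤n : 2 ℕ.≤ n) (k′ : ℕ) where
  open OverlapGraph 2≤n k′ public

  module _ (σ : Av (↘ n)) (k≤m : suc k′ ℕ.≤ size σ) where
    private
      m = size σ
      ℓ = m ∸ suc k′
      S = 𝕊 (perm σ)

      fits : ∀ i → i ℕ.⊓ ℓ ℕ.+ suc k′ ℕ.≤ m
      fits i = ℕ.≤-trans (ℕ.+-monoˡ-≤ (suc k′) (ℕ.m⊓n≤n i ℓ)) (ℕ.≤-reflexive (ℕ.m∸n+n≡m k≤m))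

      win : ∀ i → Fin (suc k′) → Fin m
      win i = window (i ℕ.⊓ ℓ) (suc k′) (fits i)

      windowPerm : ℕ → ColouredPerm (suc k′)
      windowPerm i = pat (win i) (window-injective (i ℕ.⊓ ℓ) (suc k′) (fits i)) (perm σ) , ℂ (perm σ) ∘ win i

      windowPerm-pattern : ∀ i → IsColouredPattern (win i) S (windowPerm i)
      windowPerm-pattern i = pat-isPattern (win i) (window-injective (i ℕ.⊓ ℓ) (suc k′) (fits i)) (perm σ) , λ _ → refl

      edgeFor : ∀ i → ∃[ e ] (e ∈ allEdges × windowPerm i ≈ᶜ proj₁ e)
      edgeFor i = allEdges-complete (windowPerm i) (window-consistent (ℂ-greedy (perm σ))
        (avoids⇒colours< (ℂ-greedy (perm σ)) 1≤n (avoids σ)) (fits i) {windowPerm i} (windowPerm-pattern i))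

    -- For i > m - k the last window is repeated.
    edgeAt : ℕ → Edge
    edgeAt i = proj₁ (edgeFor i)

    edgeAt∈ : ∀ i → edgeAt i ∈ allEdges
    edgeAt∈ i = proj₁ (proj₂ (edgeFor i))

    private
      edgeAt-pattern : ∀ i → IsColouredPattern (win i) S (proj₁ (edgeAt i))
      edgeAt-pattern i = pattern-resp (win i) (perm σ) (proj₁ (windowPerm i)) (proj₁ (proj₁ (edgeAt i))) (proj₁ (proj₂ (proj₂ (edgeFor i))))
          (proj₁ (windowPerm-pattern i)) ,
        λ a → sym (proj₂ (proj₂ (proj₂ (edgeFor i))) a)

      at : ∀ i j .(le : j ℕ.+ suc k′ ℕ.≤ m) → i ℕ.⊓ ℓ ≡ j → IsColouredPattern (window j (suc k′) le) S (proj₁ (edgeAt i))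
      at i j le refl = edgeAt-pattern i

    edgeAt-adj : ∀ i → i ℕ.< ℓ → Adj (edgeAt i) (edgeAt (suc i))
    edgeAt-adj i i<ℓ = adjacent-windows {i = i} {perm σ} {ℂ (perm σ)} le le′ (proj₁ (edgeAt i)) (proj₁ (edgeAt (suc i)))
      (at i i le (ℕ.m≤n⇒m⊓n≡m (ℕ.<⇒≤ i<ℓ))) (at (suc i) (suc i) le′ (ℕ.m≤n⇒m⊓n≡m i<ℓ))
      where
      le′ : suc i ℕ.+ suc k′ ℕ.≤ m
      le′ = ℕ.≤-trans (ℕ.+-monoˡ-≤ (suc k′) i<ℓ) (ℕ.≤-reflexive (ℕ.m∸n+n≡m k≤m))
      le : i ℕ.+ suc k′ ℕ.≤ m
      le = ℕ.<⇒≤ le′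

    edges-count : ∀ π → count (λ e → π ≟ₚ proj₁ (proj₁ e)) (List.applyUpTo edgeAt (suc ℓ)) ≡
                        count (occursAt? π (perm σ)) (List.upTo m)
    edges-count π = begin
      count (λ e → π ≟ₚ proj₁ (proj₁ e)) (List.applyUpTo edgeAt (suc ℓ))
        ≡⟨ count-applyUpTo (λ e → π ≟ₚ proj₁ (proj₁ e)) edgeAt (suc ℓ) ⟩
      count (λ i → π ≟ₚ proj₁ (proj₁ (edgeAt i))) (List.upTo (suc ℓ))
        ≡⟨ count-cong (λ i → π ≟ₚ proj₁ (proj₁ (edgeAt i))) (occursAt? π (perm σ)) (List.upTo (suc ℓ))
            (λ i i∈ → forth i (ℕ.≤-pred (∈-upTo⁻ i∈))) (λ i i∈ → back i (ℕ.≤-pred (∈-upTo⁻ i∈))) ⟩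
      count (occursAt? π (perm σ)) (List.upTo (suc ℓ))
        ≡⟨ count-upTo-≤ (occursAt? π (perm σ)) ℓ<m (λ i (le , _) → s≤s (ℕ.m+n≤o⇒m≤o∸n i le)) ⟨
      count (occursAt? π (perm σ)) (List.upTo m)                                  ∎
      where
      open ≡-Reasoning
      ℓ<m : suc ℓ ℕ.≤ m
      ℓ<m = ℕ.≤-trans (ℕ.≤-reflexive (ℕ.+-comm 1 ℓ)) (ℕ.≤-trans (ℕ.+-monoʳ-≤ ℓ (s≤s z≤n)) (ℕ.≤-reflexive (ℕ.m∸n+n≡m k≤m)))
      room : ∀ i → i ℕ.≤ ℓ → i ℕ.+ suc k′ ℕ.≤ m
      room i i≤ℓ = ℕ.≤-trans (ℕ.+-monoˡ-≤ (suc k′) i≤ℓ) (ℕ.≤-reflexive (ℕ.m∸n+n≡m k≤m))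
      forth : ∀ i → i ℕ.≤ ℓ → π Perm.≈ proj₁ (proj₁ (edgeAt i)) → OccursAt π (perm σ) i
      forth i i≤ℓ π≈ = room i i≤ℓ , pattern-resp (window i (suc k′) (room i i≤ℓ)) (perm σ) (proj₁ (proj₁ (edgeAt i))) π
        (λ a → sym (π≈ a)) (proj₁ (at i i (room i i≤ℓ) (ℕ.m≤n⇒m⊓n≡m i≤ℓ)))
      back : ∀ i → i ℕ.≤ ℓ → OccursAt π (perm σ) i → π Perm.≈ proj₁ (proj₁ (edgeAt i))
      back i i≤ℓ (le , p) = pattern-unique (window i (suc k′) le) (perm σ) π (proj₁ (proj₁ (edgeAt i))) p
        (proj₁ (at i i le (ℕ.m≤n⇒m⊓n≡m i≤ℓ)))

  chain-applyUpTo : ∀ (f : ℕ → Edge) l → (∀ i → i ℕ.< l → Adj (f i) (f (suc i))) → Chain (f 0) (List.applyUpTo (f ∘ suc) l)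
  chain-applyUpTo f zero    adj = tt
  chain-applyUpTo f (suc l) adj = adj 0 (s≤s z≤n) , chain-applyUpTo (f ∘ suc) l (λ i i<l → adj (suc i) (s≤s i<l))

  all-applyUpTo : ∀ {Q : Edge → Set} (f : ℕ → Edge) l → (∀ i → Q (f i)) → All Q (List.applyUpTo f l)
  all-applyUpTo f zero    q = []
  all-applyUpTo f (suc l) q = q 0 ∷ all-applyUpTo (f ∘ suc) l (q ∘ suc)

  -- The leftover path repeats no source, so it has at most `length allEdges` edges, and it is all
  -- that separates the cycles from the full walk. The extra `k′` in `size≤` is the excess of the
  -- size over the number of windows.
  record Decomposition (σ : Av (↘ n)) : Set where
    field
      cycles  : List (List Edge)
      areCycles : All IsCycle cycles
      inEdges : All (All (_∈ allEdges)) cycles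
      lower   : ∀ π → countAll (λ e → π ≟ₚ proj₁ (proj₁ e)) cycles ℕ.≤ count (occursAt? π (perm σ)) (List.upTo (size σ))
      upper   : ∀ π → count (occursAt? π (perm σ)) (List.upTo (size σ)) ℕ.≤
                      countAll (λ e → π ≟ₚ proj₁ (proj₁ e)) cycles ℕ.+ List.length allEdges
      length≤ : countAll {P = λ _ → ⊤} (λ _ → yes tt) cycles ℕ.≤ size σ
      size≤   : size σ ℕ.≤ countAll {P = λ _ → ⊤} (λ _ → yes tt) cycles ℕ.+ (List.length allEdges ℕ.+ k′)

  decompose : ∀ σ → suc k′ ℕ.≤ size σ → Decomposition σ
  decompose σ k≤m = fromErasure (erase (edgeAt σ k≤m 0) (List.applyUpTo (edgeAt σ k≤m ∘ suc) ℓ)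
      (chain-applyUpTo (edgeAt σ k≤m) ℓ (edgeAt-adj σ k≤m)))
    where
    ℓ : ℕ
    ℓ = size σ ∸ suc k′
    fromErasure : Erasure (edgeAt σ k≤m 0) (List.applyUpTo (edgeAt σ k≤m ∘ suc) ℓ) → Decomposition σ
    fromErasure X = record
      { cycles = X.cycles ; areCycles = X.areCycles ; inEdges = proj₂ inherited
      ; lower = λ π → ℕ.≤-trans (ℕ.m≤n+m _ _) (ℕ.≤-reflexive (counted π))
      ; upper = λ π → ℕ.≤-trans (ℕ.≤-reflexive (sym (counted π))) (ℕ.≤-trans
          (ℕ.+-monoˡ-≤ _ (ℕ.≤-trans (List.length-filter (λ e → π ≟ₚ proj₁ (proj₁ e)) (X.head ∷ X.tail)) path≤))
          (ℕ.≤-reflexive (ℕ.+-comm (List.length allEdges) _)))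
      ; length≤ = ℕ.≤-trans (ℕ.m≤n+m T _) (ℕ.≤-trans (ℕ.≤-reflexive total≡) (ℕ.≤-trans (ℕ.m≤m+n (suc ℓ) k′) (ℕ.≤-reflexive (sym m≡))))
      ; size≤ = ℕ.≤-trans (ℕ.≤-reflexive (trans m≡ (cong (ℕ._+ k′) (sym total≡)))) (ℕ.≤-trans
          (ℕ.+-monoˡ-≤ k′ (ℕ.+-monoˡ-≤ T path≤)) (ℕ.≤-reflexive (swap (List.length allEdges) T k′)))
      }
      where
      module X = Erasure X
      T : ℕ
      T = countAll {P = λ _ → ⊤} (λ _ → yes tt) X.cycles
      swap : ∀ a b c → a ℕ.+ b ℕ.+ c ≡ b ℕ.+ (a ℕ.+ c)
      swap = solve-∀
      inherited : All (_∈ allEdges) (X.head ∷ X.tail) × All (All (_∈ allEdges)) X.cycles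
      inherited = X.inherit (_∈ allEdges) (all-applyUpTo (edgeAt σ k≤m) (suc ℓ) (edgeAt∈ σ k≤m))
      path≤ : List.length (X.head ∷ X.tail) ℕ.≤ List.length allEdges
      path≤ = distinct-length X.distinct (proj₁ inherited)
      counted : ∀ π → count (λ e → π ≟ₚ proj₁ (proj₁ e)) (X.head ∷ X.tail) ℕ.+ countAll (λ e → π ≟ₚ proj₁ (proj₁ e)) X.cycles ≡
                      count (occursAt? π (perm σ)) (List.upTo (size σ))
      counted π = trans (sym (X.counts (λ e → π ≟ₚ proj₁ (proj₁ e)))) (edges-count σ k≤m π)
      m≡ : size σ ≡ suc ℓ ℕ.+ k′
      m≡ = trans (sym (ℕ.m∸n+n≡m k≤m)) (ℕ.+-suc ℓ k′)
      total≡ : List.length (X.head ∷ X.tail) ℕ.+ T ≡ suc ℓ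
      total≡ = trans (cong (ℕ._+ T) (sym (count-always (X.head ∷ X.tail)))) (trans (sym (X.counts (λ _ → yes tt)))
        (trans (count-always (List.applyUpTo (edgeAt σ k≤m) (suc ℓ))) (List.length-applyUpTo (edgeAt σ k≤m) (suc ℓ))))

-- Every feasible point is a mixture

∑ℚ-updateAt : ∀ {r} (U g : Vector ℚ r) j x →
              ∑ℚ (λ i → Vector.updateAt U j (x ℚ.+_) i ℚ.* g i) ≡ x ℚ.* g j ℚ.+ ∑ℚ (λ i → U i ℚ.* g i)
∑ℚ-updateAt U g zero    x = regroup x (U zero) (g zero) _
  where
  regroup : ∀ x u g s → (x ℚ.+ u) ℚ.* g ℚ.+ s ≡ x ℚ.* g ℚ.+ (u ℚ.* g ℚ.+ s)
  regroup = solve 4 (λ x u g s → (x :+ u) :* g :+ s := x :* g :+ (u :* g :+ s)) refl where open ℚ.+-*-Solver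
∑ℚ-updateAt U g (suc j) x = trans (cong (U zero ℚ.* g zero ℚ.+_) (∑ℚ-updateAt (U ∘ suc) (g ∘ suc) j x))
  (swap (U zero ℚ.* g zero) (x ℚ.* g (suc j)) _)
  where
  swap : ∀ a b c → a ℚ.+ (b ℚ.+ c) ≡ b ℚ.+ (a ℚ.+ c)
  swap = solve 3 (λ a b c → a :+ (b :+ c) := b :+ (a :+ c)) refl where open ℚ.+-*-Solver

-- Coordinate `i` ends up as `x i` times the multiplicity of `i` in the list; with `x` the cycle
-- lengths, it is the number of windows spent on cycle `i`.
tally : ∀ {r} → (Fin r → ℚ) → List (Fin r) → Vector ℚ r
tally x []       = λ _ → 0ℚ
tally x (j ∷ js) = Vector.updateAt (tally x js) j (x j ℚ.+_)

∑ℚ-tally : ∀ {r} x (g : Vector ℚ r) js → ∑ℚ (λ i → tally x js i ℚ.* g i) ≡ sumℚ (λ j → x j ℚ.* g j) js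
∑ℚ-tally {r} x g []       = trans (∑ℚ-cong λ i → ℚ.*-zeroˡ (g i)) (∑ℚ-0 r)
∑ℚ-tally     x g (j ∷ js) = trans (∑ℚ-updateAt (tally x js) g j (x j)) (cong (x j ℚ.* g j ℚ.+_) (∑ℚ-tally x g js))

0≤tally : ∀ {r} (x : Fin r → ℚ) → (∀ i → 0ℚ ℚ.≤ x i) → ∀ js i → 0ℚ ℚ.≤ tally x js i
0≤tally x 0≤x []       i = ℚ.≤-refl
0≤tally x 0≤x (j ∷ js) i with i Fin.≟ j
... | yes refl = subst (0ℚ ℚ.≤_) (sym (Vector.updateAt-updates i (tally x js))) (0≤+ (0≤x i) (0≤tally x 0≤x js i))
... | no  i≢j  = subst (0ℚ ℚ.≤_) (sym (Vector.updateAt-minimal i j (tally x js) i≢j)) (0≤tally x 0≤x js i)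

sumℚ-ι : ∀ {A : Set} (f : A → ℕ) xs → sumℚ (ι ∘ f) xs ≡ ι (sum (List.map f xs))
sumℚ-ι f []       = sym ι-0
sumℚ-ι f (x ∷ xs) = trans (cong (ι (f x) ℚ.+_) (sumℚ-ι f xs)) (sym (ι-+ (f x) _))

∑ℚ-delta : ∀ {r} (w : Vector ℚ r) j → ∑ℚ (λ i → Vector.updateAt (λ _ → 0ℚ) j (1ℚ ℚ.+_) i ℚ.* w i) ≡ w j
∑ℚ-delta {r} w j = trans (∑ℚ-updateAt (λ _ → 0ℚ) w j 1ℚ) (trans
  (cong₂ ℚ._+_ (ℚ.*-identityˡ (w j)) (trans (∑ℚ-cong λ i → ℚ.*-zeroˡ (w i)) (∑ℚ-0 r))) (ℚ.+-identityʳ (w j)))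

module _ {r : ℕ} (c : Vector ℚ r) (β : ℝ) where

  equation : List (Form r)
  equation = (c , fromℚ (ℚ.- 1ℚ) * β) ∷ ((λ i → ℚ.- 1ℚ ℚ.* c i) , β) ∷ []

  private
    dot : Vector ℚ r → ℚ
    dot w = ∑ℚ (λ i → c i ℚ.* w i)

    value₁ : ∀ w n → value (c , fromℚ (ℚ.- 1ℚ) * β) w n ≡ dot w ℚ.- approx β n
    value₁ w n = trans (value≡ c (fromℚ (ℚ.- 1ℚ) * β) w n) (neg (dot w) (approx β n))
      where
      neg : ∀ d b → d ℚ.+ ℚ.- 1ℚ ℚ.* b ≡ d ℚ.- b
      neg = solve 2 (λ d b → d :+ (:- con 1ℚ) :* b := d :- b) refl where open ℚ.+-*-Solver

    value₂ : ∀ w n → value ((λ i → ℚ.- 1ℚ ℚ.* c i) , β) w n ≡ approx β n ℚ.- dot w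
    value₂ w n = trans (value≡ (λ i → ℚ.- 1ℚ ℚ.* c i) β w n) (trans
      (cong (ℚ._+ approx β n) (trans (∑ℚ-cong λ i → ℚ.*-assoc (ℚ.- 1ℚ) (c i) (w i)) (∑ℚ-*ˡ (ℚ.- 1ℚ) (λ i → c i ℚ.* w i))))
      (neg (dot w) (approx β n)))
      where
      neg : ∀ d b → ℚ.- 1ℚ ℚ.* d ℚ.+ b ≡ b ℚ.- d
      neg = solve 2 (λ d b → (:- con 1ℚ) :* d :+ b := b :- d) refl where open ℚ.+-*-Solver

  equation⁺ : ∀ w n → ∑ℚ (λ i → c i ℚ.* w i) ≡ approx β n → All (Holds w n) equation
  equation⁺ w n eq = subst (0ℚ ℚ.≤_) (sym (value₁ w n)) (0≤q-p (ℚ.≤-reflexive (sym eq))) ∷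
                     subst (0ℚ ℚ.≤_) (sym (value₂ w n)) (0≤q-p (ℚ.≤-reflexive eq)) ∷ []

  equation⁻ : ∀ w n → All (Holds w n) equation → ∑ℚ (λ i → c i ℚ.* w i) ≡ approx β n
  equation⁻ w n (h₁ ∷ h₂ ∷ []) = ℚ.≤-antisym (p≤q-by (subst (0ℚ ℚ.≤_) (value₂ w n) h₂)) (p≤q-by (subst (0ℚ ℚ.≤_) (value₁ w n) h₁))

module _ {r : ℕ} (j : Fin r) where

  coordinate : Form r
  coordinate = Vector.updateAt (λ _ → 0ℚ) j (1ℚ ℚ.+_) , 0ℝ

  private
    value-coordinate : ∀ w n → value coordinate w n ≡ w j
    value-coordinate w n = trans (value≡ (proj₁ coordinate) 0ℝ w n) (trans (ℚ.+-identityʳ _) (∑ℚ-delta w j))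

  coordinate⁺ : ∀ w n → 0ℚ ℚ.≤ w j → Holds w n coordinate
  coordinate⁺ w n = subst (0ℚ ℚ.≤_) (sym (value-coordinate w n))

  coordinate⁻ : ∀ w n → Holds w n coordinate → 0ℚ ℚ.≤ w j
  coordinate⁻ w n = subst (0ℚ ℚ.≤_) (value-coordinate w n)

-- Convergent convex combinations of finitely many points have convergent weights.
module _ {r : ℕ} {A : Set} (as : List A) (c : A → Vector ℚ r) (β : A → ℝ)
         (u : ℕ → Vector ℚ r) (0≤u : ∀ n i → 0ℚ ℚ.≤ u n i) (∑u≡1 : ∀ n → ∑ℚ (u n) ≡ 1ℚ)
         (solves : ∀ n a → ∑ℚ (λ i → c a i ℚ.* u n i) ≡ approx (β a) n) where
  private
    ones : Vector ℚ r
    ones _ = 1ℚ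

    signs sums points system : List (Form r)
    signs = List.map coordinate (List.allFin r)
    sums = equation ones 1ℝ
    points = List.concatMap (λ a → equation (c a) (β a)) as
    system = signs List.++ sums List.++ points

    ones≡ : ∀ (w : Vector ℚ r) → ∑ℚ (λ i → ones i ℚ.* w i) ≡ ∑ℚ w
    ones≡ w = ∑ℚ-cong λ i → ℚ.*-identityˡ (w i)

    satisfied : ∀ n → All (Holds (u n) n) system
    satisfied n = All.++⁺ (All.map⁺ (All.tabulate λ {j} _ → coordinate⁺ j (u n) n (0≤u n j)))
      (All.++⁺ (equation⁺ ones 1ℝ (u n) n (trans (ones≡ (u n)) (∑u≡1 n)))
        (All.concat⁺ (All.map⁺ {xs = as} (All.tabulate λ {a} _ → equation⁺ (c a) (β a) (u n) n (solves n a)))))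

    solution : Solution r system
    solution = solveSystem r system

  limitWeights : Vector ℝ r
  limitWeights = proj₁ solution

  private
    w : ℕ → Vector ℚ r
    w n i = approx (limitWeights i) n

    holds : ∀ n → All (Holds (w n) n) system
    holds n = proj₂ solution n (u n , satisfied n)

  limitWeights-nonNeg : ∀ n i → 0ℚ ℚ.≤ approx (limitWeights i) n
  limitWeights-nonNeg n i = coordinate⁻ i (w n) n (All.lookup (All.map⁻ (All.++⁻ˡ signs (holds n))) (∈-allFin i))

  limitWeights-total : ∀ n → ∑ℚ (λ i → approx (limitWeights i) n) ≡ 1ℚ
  limitWeights-total n = trans (sym (ones≡ (w n)))
    (equation⁻ ones 1ℝ (w n) n (All.++⁻ˡ sums (All.++⁻ʳ signs (holds n))))

  limitWeights-solve : ∀ n {a} → a ∈ as → ∑ℚ (λ i → c a i ℚ.* approx (limitWeights i) n) ≡ approx (β a) n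
  limitWeights-solve n {a} a∈ = equation⁻ (c a) (β a) (w n) n
    (All.lookup (All.map⁻ (All.concat⁻ {xss = List.map (λ a → equation (c a) (β a)) as}
      (All.++⁻ʳ sums (All.++⁻ʳ signs (holds n))))) a∈)

module _ {n : ℕ} (2≤n : 2 ℕ.≤ n) (k′ : ℕ) where
  open WindowWalk 2≤n k′

  private
    r = List.length allCycles

    cyc : Fin r → List Edge
    cyc i = proj₁ (List.lookup allCycles i)

    isCyc : ∀ i → IsCycle (cyc i)
    isCyc i = proj₂ (List.lookup allCycles i)

    always : ∀ (e : Edge) → Dec ⊤
    always _ = yes tt

    hit : ∀ (π : Permutation′ (suc k′)) (e : Edge) → Dec (π Perm.≈ proj₁ (proj₁ e))
    hit π e = π ≟ₚ proj₁ (proj₁ e)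

  -- One list of cycles for all permutations of the sequence, so that only the weights vary with the
  -- index.
  cycles : Vector (SimpleCycle (𝒪v n (suc k′))) r
  cycles i = toSimpleCycle (cyc i) (isCyc i)

  private
    toSimpleCycle-count : ∀ es c π → patternCount 2≤n (toSimpleCycle es c) π ≡ count (hit π) es
    toSimpleCycle-count (e ∷ es) c π = count-lookup (hit π) (e ∷ es)

    toSimpleCycle-length : ∀ es c → cycleLength 2≤n (toSimpleCycle es c) ≡ count always es
    toSimpleCycle-length (e ∷ es) c = sym (count-always (e ∷ es))

    len : Fin r → ℕ
    len i = cycleLength 2≤n (cycles i)

    len-rate : ∀ i π → ι (len i) ℚ.* rate 2≤n (cycles i) π ≡ ι (patternCount 2≤n (cycles i) π)
    len-rate i π = begin
      ι (len i) ℚ.* (ι c ℚ.* ρ)     ≡⟨ regroup (ι (len i)) (ι c) ρ ⟩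
      ι c ℚ.* (ρ ℚ.* ι (len i))     ≡⟨ cong (ι c ℚ.*_) (unitRate-length 2≤n (cycles i)) ⟩
      ι c ℚ.* 1ℚ                    ≡⟨ ℚ.*-identityʳ (ι c) ⟩
      ι c                           ∎
      where
      open ≡-Reasoning
      c = patternCount 2≤n (cycles i) π
      ρ = unitRate 2≤n (cycles i)
      regroup : ∀ l c ρ → l ℚ.* (c ℚ.* ρ) ≡ c ℚ.* (ρ ℚ.* l)
      regroup = solve 3 (λ l c ρ → l :* (c :* ρ) := c :* (ρ :* l)) refl where open ℚ.+-*-Solver

    indices : ∀ css → All IsCycle css → All (All (_∈ allEdges)) css → Σ[ js ∈ List (Fin r) ] List.map cyc js ≡ css
    indices []         []       []       = [] , refl
    indices (es ∷ css) (c ∷ cs) (∈ ∷ ∈s) =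
      let i , eq = allCycles-complete es c ∈ ; js , eqs = indices css cs ∈s in i ∷ js , cong₂ _∷_ eq eqs

    count-cycles : ∀ {P : Edge → Set} (P? : Decidable P) (f : Fin r → ℕ) → (∀ i → f i ≡ count P? (cyc i)) →
                   ∀ js css → List.map cyc js ≡ css → sum (List.map f js) ≡ countAll P? css
    count-cycles P? f f≡ js css refl = cong sum (trans (List.map-cong f≡ js) (List.map-∘ js))

    slack : ℕ
    slack = List.length allEdges ℕ.+ k′

  -- Each cycle is weighted by its share of the windows lying on cycles. The error is stated
  -- multiplied by the size, where it is a constant number of windows.
  Weights : Av (↘ n) → Set
  Weights σ = Σ[ u ∈ Vector ℚ r ] (∀ i → 0ℚ ℚ.≤ u i) × (∑ℚ u ≡ 1ℚ) ×
    (∀ π → ℚ.∣ frequency π σ ℚ.- ∑ℚ (λ i → rate 2≤n (cycles i) π ℚ.* u i) ∣ ℚ.* ι (size σ) ℚ.≤ ι slack)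

  private
    module _ {σ : Av (↘ n)} (D : Decomposition σ) (slack<size : slack ℕ.< size σ) where
      module D = Decomposition D

      js : List (Fin r)
      js = proj₁ (indices D.cycles D.areCycles D.inEdges)

      js≡ : List.map cyc js ≡ D.cycles
      js≡ = proj₂ (indices D.cycles D.areCycles D.inEdges)

      T : ℕ
      T = countAll always D.cycles

      N : Permutation′ (suc k′) → ℕ
      N π = countAll (hit π) D.cycles

      V : Vector ℚ r
      V = tally (ι ∘ len) js

      V-total : ∑ℚ V ≡ ι T
      V-total = begin
        ∑ℚ V                                    ≡⟨ ∑ℚ-cong (λ i → ℚ.*-identityʳ (V i)) ⟨
        ∑ℚ (λ i → V i ℚ.* 1ℚ)                   ≡⟨ ∑ℚ-tally (ι ∘ len) (λ _ → 1ℚ) js ⟩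
        sumℚ (λ j → ι (len j) ℚ.* 1ℚ) js        ≡⟨ sumℚ-cong js (λ j → ℚ.*-identityʳ (ι (len j))) ⟩
        sumℚ (ι ∘ len) js                       ≡⟨ sumℚ-ι len js ⟩
        ι (sum (List.map len js))
          ≡⟨ cong ι (count-cycles always len (λ i → toSimpleCycle-length (cyc i) (isCyc i)) js D.cycles js≡) ⟩
        ι T                                     ∎
        where open ≡-Reasoning

      V-rate : ∀ π → ∑ℚ (λ i → V i ℚ.* rate 2≤n (cycles i) π) ≡ ι (N π)
      V-rate π = begin
        ∑ℚ (λ i → V i ℚ.* rate 2≤n (cycles i) π)                ≡⟨ ∑ℚ-tally (ι ∘ len) (λ i → rate 2≤n (cycles i) π) js ⟩
        sumℚ (λ j → ι (len j) ℚ.* rate 2≤n (cycles j) π) js     ≡⟨ sumℚ-cong js (λ j → len-rate j π) ⟩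
        sumℚ (λ j → ι (patternCount 2≤n (cycles j) π)) js       ≡⟨ sumℚ-ι (λ j → patternCount 2≤n (cycles j) π) js ⟩
        ι (sum (List.map (λ j → patternCount 2≤n (cycles j) π) js))
          ≡⟨ cong ι (count-cycles (hit π) (λ j → patternCount 2≤n (cycles j) π) (λ i → toSimpleCycle-count (cyc i) (isCyc i) π) js D.cycles js≡) ⟩
        ι (N π)                                                 ∎
        where open ≡-Reasoning

      1≤T : 1 ℕ.≤ T
      1≤T = ℕ.+-cancelʳ-≤ slack 1 T (ℕ.≤-trans slack<size D.size≤)

      instance
        T≢0 : NonZero T
        T≢0 = ℕ.>-nonZero 1≤T

      ρ : ℚ
      ρ = (+ 1) ℚ./ T

      ρT≡1 : ρ ℚ.* ι T ≡ 1ℚ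
      ρT≡1 = trans (fraction-cancel 1 T) ι-1

      0<T : 0ℚ ℚ.< ι T
      0<T = subst (ℚ._< ι T) ι-0 (ι-mono-< 1≤T)

      0≤ρ : 0ℚ ℚ.≤ ρ
      0≤ρ = *-nonNeg-cancel 0<T (subst (0ℚ ℚ.≤_) (sym (trans (ℚ.*-comm (ι T) ρ) ρT≡1)) (ℚ.nonNegative⁻¹ 1ℚ))

      b : Permutation′ (suc k′) → ℚ
      b π = ∑ℚ (λ i → rate 2≤n (cycles i) π ℚ.* (ρ ℚ.* V i))

      b≡ : ∀ π → b π ≡ ρ ℚ.* ι (N π)
      b≡ π = begin
        b π                                                   ≡⟨ ∑ℚ-cong (λ i → regroup (rate 2≤n (cycles i) π) ρ (V i)) ⟩
        ∑ℚ (λ i → ρ ℚ.* (V i ℚ.* rate 2≤n (cycles i) π))      ≡⟨ ∑ℚ-*ˡ ρ (λ i → V i ℚ.* rate 2≤n (cycles i) π) ⟩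
        ρ ℚ.* ∑ℚ (λ i → V i ℚ.* rate 2≤n (cycles i) π)        ≡⟨ cong (ρ ℚ.*_) (V-rate π) ⟩
        ρ ℚ.* ι (N π)                                         ∎
        where
        open ≡-Reasoning
        regroup : ∀ a ρ v → a ℚ.* (ρ ℚ.* v) ≡ ρ ℚ.* (v ℚ.* a)
        regroup = solve 3 (λ a ρ v → a :* (ρ :* v) := ρ :* (v :* a)) refl where open ℚ.+-*-Solver

      N≤T : ∀ π → N π ℕ.≤ T
      N≤T π = go D.cycles
        where
        go : ∀ css → countAll (hit π) css ℕ.≤ countAll always css
        go []         = z≤n
        go (es ∷ css) = ℕ.+-mono-≤ (count-mono-≤ (hit π) always es λ _ _ _ → tt) (go css)

      -- With M windows showing π among m, both M - b m and b m - M are at most the slack.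
      close : ∀ π → ℚ.∣ frequency π σ ℚ.- b π ∣ ℚ.* ι (size σ) ℚ.≤ ι slack
      close π = begin
        ℚ.∣ f ℚ.- b π ∣ ℚ.* m              ≡⟨ cong (ℚ.∣ f ℚ.- b π ∣ ℚ.*_) (ℚ.0≤p⇒∣p∣≡p (0≤ι (size σ))) ⟨
        ℚ.∣ f ℚ.- b π ∣ ℚ.* ℚ.∣ m ∣        ≡⟨ ℚ.∣p*q∣≡∣p∣*∣q∣ (f ℚ.- b π) m ⟨
        ℚ.∣ (f ℚ.- b π) ℚ.* m ∣
          ≡⟨ cong ℚ.∣_∣ (trans (expand f (b π) m) (cong₂ ℚ._-_ (frequency-size π σ) (cong (ℚ._* m) (b≡ π)))) ⟩
        ℚ.∣ ι M ℚ.- ρ ℚ.* ι (N π) ℚ.* m ∣  ≤⟨ dist≤ {ι M} {ρ ℚ.* ι (N π) ℚ.* m} {ι slack} M≤ ≤M ⟩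
        ι slack                            ∎
        where
        open ℚ.≤-Reasoning
        f m : ℚ
        f = frequency π σ
        m = ι (size σ)
        M : ℕ
        M = count (occursAt? π (perm σ)) (List.upTo (size σ))
        expand : ∀ f b m → (f ℚ.- b) ℚ.* m ≡ f ℚ.* m ℚ.- b ℚ.* m
        expand = solve 3 (λ f b m → (f :- b) :* m := f :* m :- b :* m) refl where open ℚ.+-*-Solver
        swap : ∀ ρ c t → ρ ℚ.* c ℚ.* t ≡ c ℚ.* (ρ ℚ.* t)
        swap = solve 3 (λ ρ c t → ρ :* c :* t := c :* (ρ :* t)) refl where open ℚ.+-*-Solver
        0≤ρN : 0ℚ ℚ.≤ ρ ℚ.* ι (N π)
        0≤ρN = *-nonNeg 0≤ρ (0≤ι (N π))
        ρNT : ρ ℚ.* ι (N π) ℚ.* ι T ≡ ι (N π)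
        ρNT = trans (swap ρ (ι (N π)) (ι T)) (trans (cong (ι (N π) ℚ.*_) ρT≡1) (ℚ.*-identityʳ (ι (N π))))
        ρN≤1 : ρ ℚ.* ι (N π) ℚ.≤ 1ℚ
        ρN≤1 = subst (ρ ℚ.* ι (N π) ℚ.≤_) ρT≡1 (ℚ.*-monoˡ-≤-nonNeg ρ {{ℚ.nonNegative 0≤ρ}} (ι-mono-≤ (N≤T π)))
        -- Both estimates exchange the total cycle length `T` for the size, by `T ≤ m ≤ T + slack`,
        -- with `ρ T = 1` and `ρ N ≤ 1`.
        M≤ : ι M ℚ.≤ ρ ℚ.* ι (N π) ℚ.* m ℚ.+ ι slack
        M≤ = begin
          ι M
            ≤⟨ ι-mono-≤ (ℕ.≤-trans (D.upper π) (ℕ.+-monoʳ-≤ (N π) (ℕ.m≤m+n (List.length allEdges) k′))) ⟩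
          ι (N π ℕ.+ slack)                         ≡⟨ ι-+ (N π) slack ⟩
          ι (N π) ℚ.+ ι slack                       ≡⟨ cong (ℚ._+ ι slack) ρNT ⟨
          ρ ℚ.* ι (N π) ℚ.* ι T ℚ.+ ι slack
            ≤⟨ ℚ.+-monoˡ-≤ (ι slack) (ℚ.*-monoˡ-≤-nonNeg (ρ ℚ.* ι (N π)) {{ℚ.nonNegative 0≤ρN}} (ι-mono-≤ D.length≤)) ⟩
          ρ ℚ.* ι (N π) ℚ.* m ℚ.+ ι slack           ∎
        ≤M : ρ ℚ.* ι (N π) ℚ.* m ℚ.≤ ι M ℚ.+ ι slack
        ≤M = begin
          ρ ℚ.* ι (N π) ℚ.* m
            ≤⟨ ℚ.*-monoˡ-≤-nonNeg (ρ ℚ.* ι (N π)) {{ℚ.nonNegative 0≤ρN}} (ι-mono-≤ D.size≤) ⟩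
          ρ ℚ.* ι (N π) ℚ.* ι (T ℕ.+ slack)
            ≡⟨ trans (cong (ρ ℚ.* ι (N π) ℚ.*_) (ι-+ T slack)) (ℚ.*-distribˡ-+ (ρ ℚ.* ι (N π)) (ι T) (ι slack)) ⟩
          ρ ℚ.* ι (N π) ℚ.* ι T ℚ.+ ρ ℚ.* ι (N π) ℚ.* ι slack            ≡⟨ cong (ℚ._+ ρ ℚ.* ι (N π) ℚ.* ι slack) ρNT ⟩
          ι (N π) ℚ.+ ρ ℚ.* ι (N π) ℚ.* ι slack
            ≤⟨ ℚ.+-mono-≤ (ι-mono-≤ (D.lower π)) (ℚ.*-monoʳ-≤-nonNeg (ι slack) {{ℚ.nonNegative (0≤ι slack)}} ρN≤1) ⟩
          ι M ℚ.+ 1ℚ ℚ.* ι slack                                         ≡⟨ cong (ι M ℚ.+_) (ℚ.*-identityˡ (ι slack)) ⟩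
          ι M ℚ.+ ι slack                                                ∎

      weightsFrom : Weights σ
      weightsFrom = (λ i → ρ ℚ.* V i) ,
        (λ i → *-nonNeg 0≤ρ (0≤tally (ι ∘ len) (0≤ι ∘ len) js i)) ,
        trans (∑ℚ-*ˡ ρ V) (trans (cong (ρ ℚ.*_) V-total) ρT≡1) ,
        close

  opaque
    weights : ∀ σ → slack ℕ.+ suc k′ ℕ.< size σ → Weights σ
    weights σ big = weightsFrom (decompose σ (ℕ.≤-trans (ℕ.m≤n+m (suc k′) slack) (ℕ.<⇒≤ big))) (ℕ.≤-<-trans (ℕ.m≤m+n slack (suc k′)) big)

    -- The system has one equation for each listed permutation; this carries its solution over to
    -- every `π`, which is only pointwise equal to a listed one.
    rate-cong : ∀ i π π′ → π Perm.≈ π′ → rate 2≤n (cycles i) π ≡ rate 2≤n (cycles i) π′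
    rate-cong i π π′ π≈π′ = cong (λ c → ι c ℚ.* unitRate 2≤n (cycles i)) (begin
      patternCount 2≤n (cycles i) π    ≡⟨ toSimpleCycle-count (cyc i) (isCyc i) π ⟩
      count (hit π) (cyc i)
        ≡⟨ count-cong (hit π) (hit π′) (cyc i) (λ _ _ eq a → trans (sym (π≈π′ a)) (eq a)) (λ _ _ eq a → trans (π≈π′ a) (eq a)) ⟩
      count (hit π′) (cyc i)           ≡⟨ toSimpleCycle-count (cyc i) (isCyc i) π′ ⟨
      patternCount 2≤n (cycles i) π′   ∎)
      where open ≡-Reasoning

  module _ (v : Permutation′ (suc k′) → ℝ) (σ : ℕ → Av (↘ n)) (big : ∀ m → slack ℕ.+ suc k′ ℕ.< size (σ m))
           (grows : ∀ M → ∃[ N ] ∀ m → N ℕ.≤ m → M ℕ.≤ size (σ m))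
           (tends : ∀ π → (λ m → fromℚ (frequency π (σ m))) ⟶ v π) where
    private
      u : ℕ → Vector ℚ r
      u m = proj₁ (weights (σ m) (big m))

      0≤u : ∀ m i → 0ℚ ℚ.≤ u m i
      0≤u m = proj₁ (proj₂ (weights (σ m) (big m)))

      ∑u≡1 : ∀ m → ∑ℚ (u m) ≡ 1ℚ
      ∑u≡1 m = proj₁ (proj₂ (proj₂ (weights (σ m) (big m))))

      blend : Permutation′ (suc k′) → ℕ → ℚ
      blend π m = ∑ℚ (λ i → rate 2≤n (cycles i) π ℚ.* u m i)

      blend≋frequency : ∀ π → (λ m → frequency π (σ m)) ≋ blend π
      blend≋frequency π ε 0<ε = proj₁ (grows X) , λ m le → ℚ.*-cancelʳ-≤-pos (ι (size (σ m))) {{ℚ.positive (0<size (σ m))}} (begin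
        ℚ.∣ frequency π (σ m) ℚ.- blend π m ∣ ℚ.* ι (size (σ m))     ≤⟨ proj₂ (proj₂ (proj₂ (weights (σ m) (big m)))) π ⟩
        ι slack
          ≡⟨ trans (cong (ι slack ℚ.*_) (ℚ.*-inverseˡ ε)) (ℚ.*-identityʳ (ι slack)) ⟨
        ι slack ℚ.* (ℚ.1/ ε ℚ.* ε)                               ≡⟨ ℚ.*-assoc (ι slack) (ℚ.1/ ε) ε ⟨
        ι slack ℚ.* ℚ.1/ ε ℚ.* ε                                 ≤⟨ ℚ.*-monoʳ-≤-nonNeg ε {{ℚ.nonNegative (ℚ.<⇒≤ 0<ε)}}
            (ℚ.≤-trans (ℚ.<⇒≤ (proj₂ (archimedean (ι slack ℚ.* ℚ.1/ ε)))) (ι-mono-≤ (proj₂ (grows X) m le))) ⟩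
        ι (size (σ m)) ℚ.* ε                                     ≡⟨ ℚ.*-comm (ι (size (σ m))) ε ⟩
        ε ℚ.* ι (size (σ m))                                     ∎)
        where
        open ℚ.≤-Reasoning
        instance
          ε≢0 : ℚ.NonZero ε
          ε≢0 = ℚ.pos⇒nonZero ε {{ℚ.positive 0<ε}}
        -- A size of at least `slack / ε` pushes the error in frequency below `ε`.
        X : ℕ
        X = proj₁ (archimedean (ι slack ℚ.* ℚ.1/ ε))

      blend≋v : ∀ π → blend π ≋ approx (v π)
      blend≋v π = ≋-trans {blend π} {λ m → frequency π (σ m)} {approx (v π)}
        (≋-sym {λ m → frequency π (σ m)} {blend π} (blend≋frequency π)) (tends⇒≋ {λ m → frequency π (σ m)} {v π} (tends π))

      -- The same real as `v π`, represented by the combinations themselves. With this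
      -- representation the weights `u m` solve the system exactly at each stage `m`, so that the
      -- hypothesis `solves` of `limitWeights` is `refl`.
      β : Permutation′ (suc k′) → ℝ
      β π = mkℝ (blend π) (cauchy-resp {blend π} (v π) (blend≋v π))

      ps : List (Permutation′ (suc k′))
      ps = permutations (suc k′)

      rates : Permutation′ (suc k′) → Vector ℚ r
      rates π i = rate 2≤n (cycles i) π

      w : Vector ℝ r
      w = limitWeights ps rates β u 0≤u ∑u≡1 (λ m π → refl)

      mixture≡blend : ∀ π m → approx (mixture 2≤n cycles w π) m ≡ blend π m
      mixture≡blend π m = byRepresentative (find (permutations-complete π))
        where
        open ≡-Reasoning
        byRepresentative : ∃[ ρ ] (ρ ∈ ps × ρ Perm.≈ π) → approx (mixture 2≤n cycles w π) m ≡ blend π m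
        byRepresentative (ρ , ρ∈ , ρ≈π) = begin
          approx (mixture 2≤n cycles w π) m                   ≡⟨ approx-combination w (rates π) m ⟩
          ∑ℚ (λ i → approx (w i) m ℚ.* rates π i)
            ≡⟨ ∑ℚ-cong (λ i → trans (ℚ.*-comm (approx (w i) m) (rates π i)) (cong (ℚ._* approx (w i) m) (sym (rate-cong i ρ π ρ≈π)))) ⟩
          ∑ℚ (λ i → rates ρ i ℚ.* approx (w i) m)
            ≡⟨ limitWeights-solve ps rates β u 0≤u ∑u≡1 (λ m π → refl) m ρ∈ ⟩
          blend ρ m
            ≡⟨ ∑ℚ-cong (λ i → cong (ℚ._* u m i) (rate-cong i ρ π ρ≈π)) ⟩
          blend π m                                               ∎

    limit⇒mixture : IsMixture 2≤n v
    limit⇒mixture = r , cycles , w ,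
      (λ i ε 0<ε → 0 , λ m _ → ℚ.≤-trans (limitWeights-nonNeg ps rates β u 0≤u ∑u≡1 (λ m π → refl) m i)
        (subst (ℚ._≤ approx (w i) m ℚ.+ ε) (ℚ.+-identityʳ (approx (w i) m)) (ℚ.+-monoʳ-≤ (approx (w i) m) (ℚ.<⇒≤ 0<ε)))) ,
      ≋-≡ {approx (∑ w)} {approx 1ℝ} (λ m → trans (approx-∑ w m) (limitWeights-total ps rates β u 0≤u ∑u≡1 (λ m π → refl) m)) ,
      λ π → ≋-trans {approx (v π)} {blend π} {approx (mixture 2≤n cycles w π)} (≋-sym {blend π} {approx (v π)} (blend≋v π))
        (≋-≡ {blend π} {approx (mixture 2≤n cycles w π)} λ m → sym (mixture≡blend π m))

  -- `limitWeights` asks for a solution at every stage, not just eventually, so the first `N₀`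
  -- terms, which may be too short for `weights`, are dropped.
  feasible⇒mixture : ∀ v → FeasibleRegion (↘ n) (suc k′) v → IsMixture 2≤n v
  feasible⇒mixture v (_ , σ , grows , tends) = limit⇒mixture v (λ m → σ (N₀ ℕ.+ m)) (λ m → late (N₀ ℕ.+ m) (ℕ.m≤m+n N₀ m))
    (λ M → let N , h = grows M in N , λ m le → h (N₀ ℕ.+ m) (ℕ.≤-trans le (ℕ.m≤n+m m N₀)))
    (λ π ε 0<ε → let N , h = tends π ε 0<ε in N , λ m le → h (N₀ ℕ.+ m) (ℕ.≤-trans le (ℕ.m≤n+m m N₀)))
    where
    N₀ : ℕ
    N₀ = proj₁ (grows (suc (slack ℕ.+ suc k′)))
    late : ∀ i → N₀ ℕ.≤ i → slack ℕ.+ suc k′ ℕ.< size (σ i)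
    late = proj₂ (grows (suc (slack ℕ.+ suc k′)))

feasible⇒projected : ∀ {n} (2≤n : 2 ℕ.≤ n) k′ v → FeasibleRegion (↘ n) (suc k′) v → ProjectedCyclePolytope n (suc k′) v
feasible⇒projected 2≤n k′ v F = mixture⇒projected 2≤n {k′} v (feasible⇒mixture 2≤n k′ v F)

projected⇒feasible : ∀ {n} (2≤n : 2 ℕ.≤ n) k′ v → ProjectedCyclePolytope n (suc k′) v → FeasibleRegion (↘ n) (suc k′) v
projected⇒feasible 2≤n k′ v P = mixture⇒feasible 2≤n {k′} v (projected⇒mixture 2≤n {k′} v P)

mainTheorem7 : ∀ (n k : ℕ) → 2 ℕ.≤ n → 1 ℕ.≤ k →
    (v : Permutation′ k → ℝ) →
    FeasibleRegion (↘ n) k v ⇔ ProjectedCyclePolytope n k v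
mainTheorem7 n (suc k′) 2≤n _ v = mk⇔ (feasible⇒projected 2≤n k′ v) (projected⇒feasible 2≤n k′ v)
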